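{- The dyadic partial field $\mathbb{D}=(\mathbb{Z}[\tfrac12],\langle -1,2\rangle)$ is the universal partial field of the matroid $P_8$; that is, $\mathbb{P}_{P_8}\cong\mathbb{D}$.
   Context: A partial field is a pair $(R,G)$ with $R$ a commutative ring with identity and $G$ a subgroup of $R^*$ with $-1\in G$; as a set it is $G\cup\{0\}$. A partial-field homomorphism is a map $\phi:\mathbb{P}_1\to\mathbb{P}_2$ with $\phi(1)=1$, $\phi(pq)=\phi(p)\phi(q)$, and $\phi(p)+\phi(q)=\phi(p+q)$ whenever $p,q,p+q\in\mathbb{P}_1$. An isomorphism is a bijective homomorphism such that $\phi(p)+\phi(q)\in\mathbb{P}_2$ if and only if $p+q\in\mathbb{P}_1$. $\langle S\rangle$ is the multiplicative group generated by the nonzero elements of $S$. $P_8=M[I\;A_8]$ is the rank-4 matroid on 8 elements represented over $\mathbb{Q}$ by $[I\;A_8]$, where $I$ is the $4\times 4$ identity matrix and $$A_8=\begin{bmatrix}0&1&1&2\\1&0&1&1\\1&1&0&1\\2&1&1&0\end{bmatrix}.$$ Universal partial field. Let $M=(E,\mathcal{B})$ be a matroid of rank $r$. For every $Z\in E^r$ introduce a symbol $[Z]$, and for every $Z\in E^r$ whose set of entries $\{Z\}$ is a basis, a symbol $\overline{[Z]}$. Let $I_M$ be the ideal, in the polynomial ring over $\mathbb{Z}$ in these symbols, generated by: (1) $[Z]$ for all $Z$ with $\{Z\}\notin\mathcal{B}$; (2) $[Z]-\mathrm{sgn}(\sigma)[Z^\sigma]$ for all $Z$ and permutations $\sigma$;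 (3) $[x_1,x_2,W][y_1,y_2,W]-[y_1,x_2,W][x_1,y_2,W]-[y_2,x_2,W][y_1,x_1,W]$ for all $x_1,x_2,y_1,y_2\in E$, $W\in E^{r-2}$; (4) $[Z]\overline{[Z]}-1$ for all $Z$ with $\{Z\}\in\mathcal{B}$. Let $\mathbb{B}_M$ be the quotient ring. For $B\in E^r$ with $\{B\}$ a basis, $A_{M,B}$ is the $\{B\}\times(E\setminus\{B\})$ matrix over $\mathbb{B}_M$ with $(A_{M,B})_{uv}=[B/u\to v]/[B]$, where $B/u\to v$ is $B$ with $u$ replaced by $v$; all its subdeterminants are zero or units. For an $X\times Y$ matrix $A$ all of whose subdeterminants are zero or units, $A'\preceq A$ means that $A'$ is obtained from $A$ by scaling rows or columns by units, deleting or permuting rows or columns, and pivoting (for $A_{xy}\neq0$, $A^{xy}$ is the $((X\setminus x)\cup y)\times((Y\setminus y)\cup x)$ matrix with $(A^{xy})_{yx}=A_{xy}^{ -1}$, $(A^{xy})_{yv}=A_{xy}^{ -1}A_{xv}$ for $v\neq x$, $(A^{xy})_{ux}=-A_{xy}^{ -1}A_{uy}$ for $u\ne y$, $(A^{xy})_{uv}=A_{uv}-A_{xy}^{ -1}A_{uy}A_{xv}$ otherwise). Put $\mathrm{Cr}(A)=\{p\mid\left[\begin{smallmatrix}1 & 1 \\ p & 1\end{smallmatrix}\right]\preceq A\}$ and $\mathrm{Cr}(M)=\mathrm{Cr}(A_{M,B})$ (independent of $B$). Let $R_M=\mathbb{Z}[\mathrm{Cr}(M)]\subseteq\mathbb{B}_M$.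 The universal partial field of $M$ is $\mathbb{P}_M=(R_M,\langle\mathrm{Cr}(M)\cup\{ -1\}\rangle)$. -}

module Defs where

open import Algebra.Bundles using (CommutativeRing; RawRing; Semiring)
import Algebra.Definitions as AlgebraDefinitions
import Algebra.Definitions.RawMonoid as RawMonoidDefinitions
import Algebra.Definitions.RawSemiring as RawSemiringDefinitions
import Algebra.Morphism.RingMonomorphism as RingMonomorphism
import Algebra.Properties.Ring as RingProperties
open import Data.Bool.Base using (Bool)
open import Data.Fin.Base using (Fin; zero; suc; toℕ; cast; punchIn; splitAt)
open import Data.Fin.Permutation using (Permutation′; _⟨$⟩ʳ_)
import Data.Fin.Properties as Fin
open import Data.Fin.Subset using (Subset; inside; outside; _∈_; _∉_; _∪_; _─_; ∁; ⁅_⁆; ∣_∣; ⋃)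
open import Data.Fin.Subset.Properties using (_∈?_)
open import Data.Integer.Base as ℤ using (ℤ; +_; 0ℤ; 1ℤ)
open import Data.List.Base as List using (List; []; _∷_; allFin; cartesianProduct; filter; length)
import Data.List.Membership.DecPropositional as ListMembership
open import Data.Nat.Base using (ℕ; zero; suc) renaming (_+_ to _+ℕ_)
import Data.Nat.Properties as ℕ
open import Data.Product.Base using (Σ-syntax; ∃; ∃-syntax; _×_; _,_; proj₁; proj₂)
open import Data.Rational.Base as ℚ using (ℚ; 0ℚ; 1ℚ; ½)
import Data.Rational.Properties as ℚ
open import Data.Sum.Base using (_⊎_; inj₁; inj₂; [_,_]′)
open import Data.Vec.Base as Vec using (Vec; []; _∷_; lookup; tabulate; toList; _[_]≔_)
import Data.Vec.Functional as Vector
import Data.Vec.Properties as Vec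
import Data.Bool.Properties as Bool
open import Function.Base using (_∘_)
open import Function.Definitions using (Congruent; Bijective)
open import Function.Bundles using (_⇔_)
open import Level using (0ℓ) renaming (suc to lsuc)
open import Relation.Binary.PropositionalEquality using (_≡_; _≢_; refl; sym; subst)
import Relation.Binary.Reasoning.Setoid as SetoidReasoning
open import Relation.Nullary using (¬_; Dec; yes; no; map′; ¬?; _×-dec_; _→-dec_; from-yes)
open import Relation.Unary using (Pred; Decidable)

Ring : Set₁
Ring = CommutativeRing 0ℓ 0ℓ

------------------------------------------------------------------------
-- Rings

module _ (R : Ring) where
  open CommutativeRing R renaming (refl to ≈-refl; sym to ≈-sym; trans to ≈-trans)
  open RingProperties ring using (-‿distribˡ-*; -‿distribʳ-*; -‿+-comm; -‿involutive; -0#≈0#)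
  private module ≈-Reasoning = SetoidReasoning setoid

  IsUnit : Pred Carrier 0ℓ
  IsUnit = AlgebraDefinitions.Invertible _≈_ 1# _*_

  data IdealGeneratedBy (S : Pred Carrier 0ℓ) : Pred Carrier 0ℓ where
    gen    : ∀ {x} → S x → IdealGeneratedBy S x
    0#∈    : IdealGeneratedBy S 0#
    +-∈    : ∀ {x y} → IdealGeneratedBy S x → IdealGeneratedBy S y → IdealGeneratedBy S (x + y)
    *-∈    : ∀ r {x} → IdealGeneratedBy S x → IdealGeneratedBy S (r * x)
    resp-≈ : ∀ {x y} → x ≈ y → IdealGeneratedBy S x → IdealGeneratedBy S y

  module _ (S : Pred Carrier 0ℓ) where
    private
      I : Pred Carrier 0ℓ
      I = IdealGeneratedBy S

      _≈ᴵ_ : Carrier → Carrier → Set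
      x ≈ᴵ y = I (x - y)

      neg-∈ : ∀ {x} → I x → I (- x)
      neg-∈ {x} x∈ = resp-≈
        (≈-trans (≈-sym (-‿distribˡ-* 1# x)) (-‿cong (*-identityˡ x))) (*-∈ (- 1#) x∈)

      ≈⇒≈ᴵ : ∀ {x y} → x ≈ y → x ≈ᴵ y
      ≈⇒≈ᴵ {x} {y} x≈y = resp-≈ (≈-sym (≈-trans (+-congʳ x≈y) (-‿inverseʳ y))) 0#∈

      neg-sub : ∀ x y → - (x - y) ≈ y - x
      neg-sub x y = begin
        - (x - y)     ≈⟨ ≈-sym (-‿+-comm x (- y)) ⟩
        - x - (- y)   ≈⟨ +-congˡ (-‿involutive y) ⟩
        - x + y       ≈⟨ +-comm (- x) y ⟩
        y - x         ∎
        where open ≈-Reasoning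

      sub-add : ∀ x y z → (x - y) + (y - z) ≈ x - z
      sub-add x y z = begin
        (x - y) + (y - z)      ≈⟨ +-assoc x (- y) (y - z) ⟩
        x + (- y + (y - z))    ≈⟨ +-congˡ (≈-sym (+-assoc (- y) y (- z))) ⟩
        x + ((- y + y) - z)    ≈⟨ +-congˡ (+-congʳ (-‿inverseˡ y)) ⟩
        x + (0# - z)           ≈⟨ +-congˡ (+-identityˡ (- z)) ⟩
        x - z                  ∎
        where open ≈-Reasoning

      ≈ᴵ-sym : ∀ {x y} → x ≈ᴵ y → y ≈ᴵ x
      ≈ᴵ-sym {x} {y} p = resp-≈ (neg-sub x y) (neg-∈ p)

      ≈ᴵ-trans : ∀ {x y z} → x ≈ᴵ y → y ≈ᴵ z → x ≈ᴵ z
      ≈ᴵ-trans {x} {y} {z} p q = resp-≈ (sub-add x y z) (+-∈ p q)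

      +-congˡᴵ : ∀ x {y z} → y ≈ᴵ z → (x + y) ≈ᴵ (x + z)
      +-congˡᴵ x {y} {z} p = resp-≈ eq p
        where
        open ≈-Reasoning
        eq : y - z ≈ (x + y) - (x + z)
        eq = begin
          y - z                       ≈⟨ ≈-sym (sub-add y 0# z) ⟩
          (y - 0#) + (0# - z)         ≈⟨ +-cong (≈-trans (+-congˡ -0#≈0#) (+-identityʳ y)) (+-congʳ (≈-sym (-‿inverseʳ x))) ⟩
          y + ((x - x) - z)           ≈⟨ +-congˡ (+-assoc x (- x) (- z)) ⟩
          y + (x + (- x - z))         ≈⟨ ≈-sym (+-assoc y x _) ⟩
          (y + x) + (- x - z)         ≈⟨ +-cong (+-comm y x) (-‿+-comm x z) ⟩
          (x + y) - (x + z)           ∎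

      *-congˡᴵ : ∀ x {y z} → y ≈ᴵ z → (x * y) ≈ᴵ (x * z)
      *-congˡᴵ x {y} {z} p = resp-≈
        (≈-trans (distribˡ x y (- z)) (+-congˡ (≈-sym (-‿distribʳ-* x z)))) (*-∈ x p)

      +-congᴵ : ∀ {x x′ y y′} → x ≈ᴵ x′ → y ≈ᴵ y′ → (x + y) ≈ᴵ (x′ + y′)
      +-congᴵ {x} {x′} {y} {y′} p q = ≈ᴵ-trans (+-congˡᴵ x q)
        (≈ᴵ-trans (≈⇒≈ᴵ (+-comm x y′)) (≈ᴵ-trans (+-congˡᴵ y′ p) (≈⇒≈ᴵ (+-comm y′ x′))))

      *-congᴵ : ∀ {x x′ y y′} → x ≈ᴵ x′ → y ≈ᴵ y′ → (x * y) ≈ᴵ (x′ * y′)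
      *-congᴵ {x} {x′} {y} {y′} p q = ≈ᴵ-trans (*-congˡᴵ x q)
        (≈ᴵ-trans (≈⇒≈ᴵ (*-comm x y′)) (≈ᴵ-trans (*-congˡᴵ y′ p) (≈⇒≈ᴵ (*-comm y′ x′))))

      -‿congᴵ : ∀ {x y} → x ≈ᴵ y → (- x) ≈ᴵ (- y)
      -‿congᴵ {x} {y} p = resp-≈ (≈-sym (-‿+-comm x (- y))) (neg-∈ p)

    quotientRing : Ring
    quotientRing = record
      { Carrier = Carrier
      ; _≈_ = _≈ᴵ_
      ; _+_ = _+_
      ; _*_ = _*_
      ; -_ = -_
      ; 0# = 0#
      ; 1# = 1#
      ; isCommutativeRing = record
        { isRing = record
          { +-isAbelianGroup = record
            { isGroup = record
              { isMonoid = record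
                { isSemigroup = record
                  { isMagma = record
                    { isEquivalence = record
                      { refl = ≈⇒≈ᴵ ≈-refl ; sym = ≈ᴵ-sym ; trans = ≈ᴵ-trans }
                    ; ∙-cong = +-congᴵ
                    }
                  ; assoc = λ x y z → ≈⇒≈ᴵ (+-assoc x y z)
                  }
                ; identity = (λ x → ≈⇒≈ᴵ (+-identityˡ x)) , (λ x → ≈⇒≈ᴵ (+-identityʳ x))
                }
              ; inverse = (λ x → ≈⇒≈ᴵ (-‿inverseˡ x)) , (λ x → ≈⇒≈ᴵ (-‿inverseʳ x))
              ; ⁻¹-cong = -‿congᴵ
              }
            ; comm = λ x y → ≈⇒≈ᴵ (+-comm x y)
            }
          ; *-cong = *-congᴵ
          ; *-assoc = λ x y z → ≈⇒≈ᴵ (*-assoc x y z)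
          ; *-identity = (λ x → ≈⇒≈ᴵ (*-identityˡ x)) , (λ x → ≈⇒≈ᴵ (*-identityʳ x))
          ; distrib = (λ x y z → ≈⇒≈ᴵ (distribˡ x y z)) , (λ x y z → ≈⇒≈ᴵ (distribʳ x y z))
          }
        ; *-comm = λ x y → ≈⇒≈ᴵ (*-comm x y)
        }
      }

  data SubringGeneratedBy (S : Pred Carrier 0ℓ) : Pred Carrier 0ℓ where
    gen    : ∀ {x} → S x → SubringGeneratedBy S x
    0#∈    : SubringGeneratedBy S 0#
    1#∈    : SubringGeneratedBy S 1#
    +-∈    : ∀ {x y} → SubringGeneratedBy S x → SubringGeneratedBy S y → SubringGeneratedBy S (x + y)
    *-∈    : ∀ {x y} → SubringGeneratedBy S x → SubringGeneratedBy S y → SubringGeneratedBy S (x * y)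
    neg-∈  : ∀ {x} → SubringGeneratedBy S x → SubringGeneratedBy S (- x)
    resp-≈ : ∀ {x y} → x ≈ y → SubringGeneratedBy S x → SubringGeneratedBy S y

  -- The subring ℤ[S] of R.  Membership proofs play no role in its equality.
  subring : Pred Carrier 0ℓ → Ring
  subring S = record
    { isCommutativeRing = RingMonomorphism.isCommutativeRing proj₁-isMonomorphism isCommutativeRing }
    where
    raw : RawRing 0ℓ 0ℓ
    raw = record
      { Carrier = ∃ (SubringGeneratedBy S)
      ; _≈_ = λ x y → proj₁ x ≈ proj₁ y
      ; _+_ = λ (x , x∈) (y , y∈) → x + y , +-∈ x∈ y∈
      ; _*_ = λ (x , x∈) (y , y∈) → x * y , *-∈ x∈ y∈
      ; -_ = λ (x , x∈) → - x , neg-∈ x∈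
      ; 0# = 0# , 0#∈
      ; 1# = 1# , 1#∈
      }

    open import Algebra.Morphism.Structures using (module RingMorphisms)
    open RingMorphisms raw rawRing using (IsRingMonomorphism)

    proj₁-isMonomorphism : IsRingMonomorphism proj₁
    proj₁-isMonomorphism = record
      { isRingHomomorphism = record
        { isSemiringHomomorphism = record
          { isNearSemiringHomomorphism = record
            { +-isMonoidHomomorphism = record
              { isMagmaHomomorphism = record
                { isRelHomomorphism = record { cong = λ x≈y → x≈y }
                ; homo = λ _ _ → ≈-refl
                }
              ; ε-homo = ≈-refl
              }
            ; *-homo = λ _ _ → ≈-refl
            }
          ; 1#-homo = ≈-refl
          }
        ; -‿homo = λ _ → ≈-refl
        }
      ; injective = λ x≈y → x≈y
      }

  -- ⟨ S ⟩, as a subgroup of the group of units of R.  Only units can generate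
  -- such a subgroup, so the generators are the elements of S that are units;
  -- when every nonzero element of S is a unit and R is nontrivial these are
  -- exactly the nonzero elements of S.
  data SubgroupGeneratedBy (S : Pred Carrier 0ℓ) : Pred Carrier 0ℓ where
    gen    : ∀ {x} → S x → IsUnit x → SubgroupGeneratedBy S x
    1#∈    : SubgroupGeneratedBy S 1#
    *-∈    : ∀ {x y} → SubgroupGeneratedBy S x → SubgroupGeneratedBy S y → SubgroupGeneratedBy S (x * y)
    inv-∈  : ∀ {x y} → x * y ≈ 1# → SubgroupGeneratedBy S x → SubgroupGeneratedBy S y
    resp-≈ : ∀ {x y} → x ≈ y → SubgroupGeneratedBy S x → SubgroupGeneratedBy S y

-- The polynomial ring ℤ[X], as the free commutative ring on X: ring expressions
-- with integer constants, modulo the laws of commutative rings.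
module Polynomial (X : Set) where

  infixl 6 _⊕_
  infixl 7 _⊗_
  infix 8 ⊝_
  infix 4 _≋_

  data Poly : Set where
    con : ℤ → Poly
    var : X → Poly
    _⊕_ _⊗_ : Poly → Poly → Poly
    ⊝_ : Poly → Poly

  data _≋_ : Poly → Poly → Set where
    ≋-refl      : ∀ {p} → p ≋ p
    ≋-sym       : ∀ {p q} → p ≋ q → q ≋ p
    ≋-trans     : ∀ {p q r} → p ≋ q → q ≋ r → p ≋ r
    ⊕-cong      : ∀ {p p′ q q′} → p ≋ p′ → q ≋ q′ → p ⊕ q ≋ p′ ⊕ q′
    ⊗-cong      : ∀ {p p′ q q′} → p ≋ p′ → q ≋ q′ → p ⊗ q ≋ p′ ⊗ q′
    ⊝-cong      : ∀ {p q} → p ≋ q → ⊝ p ≋ ⊝ q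
    ⊕-assoc     : ∀ p q r → (p ⊕ q) ⊕ r ≋ p ⊕ (q ⊕ r)
    ⊕-comm      : ∀ p q → p ⊕ q ≋ q ⊕ p
    ⊕-identityˡ : ∀ p → con 0ℤ ⊕ p ≋ p
    ⊝-inverseˡ  : ∀ p → ⊝ p ⊕ p ≋ con 0ℤ
    ⊗-assoc     : ∀ p q r → (p ⊗ q) ⊗ r ≋ p ⊗ (q ⊗ r)
    ⊗-comm      : ∀ p q → p ⊗ q ≋ q ⊗ p
    ⊗-identityˡ : ∀ p → con 1ℤ ⊗ p ≋ p
    distribˡ    : ∀ p q r → p ⊗ (q ⊕ r) ≋ p ⊗ q ⊕ p ⊗ r
    con-⊕       : ∀ i j → con (i ℤ.+ j) ≋ con i ⊕ con j
    con-⊗       : ∀ i j → con (i ℤ.* j) ≋ con i ⊗ con j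

  polynomialRing : Ring
  polynomialRing = record
    { Carrier = Poly
    ; _≈_ = _≋_
    ; _+_ = _⊕_
    ; _*_ = _⊗_
    ; -_ = ⊝_
    ; 0# = con 0ℤ
    ; 1# = con 1ℤ
    ; isCommutativeRing = record
      { isRing = record
        { +-isAbelianGroup = record
          { isGroup = record
            { isMonoid = record
              { isSemigroup = record
                { isMagma = record
                  { isEquivalence = record { refl = ≋-refl ; sym = ≋-sym ; trans = ≋-trans }
                  ; ∙-cong = ⊕-cong
                  }
                ; assoc = ⊕-assoc
                }
              ; identity = ⊕-identityˡ , λ p → ≋-trans (⊕-comm _ _) (⊕-identityˡ p)
              }
            ; inverse = ⊝-inverseˡ , λ p → ≋-trans (⊕-comm _ _) (⊝-inverseˡ p)
            ; ⁻¹-cong = ⊝-cong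
            }
          ; comm = ⊕-comm
          }
        ; *-cong = ⊗-cong
        ; *-assoc = ⊗-assoc
        ; *-identity = ⊗-identityˡ , λ p → ≋-trans (⊗-comm _ _) (⊗-identityˡ p)
        ; distrib = distribˡ , λ p q r →
            ≋-trans (⊗-comm _ _) (≋-trans (distribˡ p q r) (⊕-cong (⊗-comm _ _) (⊗-comm _ _)))
        }
      ; *-comm = ⊗-comm
      }
    }

open Polynomial using (Poly; con; var; polynomialRing)

------------------------------------------------------------------------
-- Partial fields

record PartialField : Set₁ where
  field
    R : Ring
  open CommutativeRing R public
  field
    G       : Pred Carrier 0ℓ
    G-resp  : ∀ {x y} → x ≈ y → G x → G y
    G-1     : G 1#
    G-*     : ∀ {x y} → G x → G y → G (x * y)
    G-units : ∀ {x} → G x → IsUnit R x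
    G-inv   : ∀ {x y} → x * y ≈ 1# → G x → G y
    G-neg1  : G (- 1#)

  infix 4 _∈ℙ _≈ℙ_
  infixl 7 _*ℙ_

  _∈ℙ : Pred Carrier 0ℓ
  x ∈ℙ = x ≈ 0# ⊎ G x

  Element : Set
  Element = ∃ _∈ℙ

  _≈ℙ_ : Element → Element → Set
  p ≈ℙ q = proj₁ p ≈ proj₁ q

  1ℙ : Element
  1ℙ = 1# , inj₂ G-1

  _*ℙ_ : Element → Element → Element
  (p , inj₁ p≈0) *ℙ (q , _)        = p * q , inj₁ (trans (*-congʳ p≈0) (zeroˡ q))
  (p , inj₂ _)   *ℙ (q , inj₁ q≈0) = p * q , inj₁ (trans (*-congˡ q≈0) (zeroʳ p))
  (p , inj₂ p∈)  *ℙ (q , inj₂ q∈)  = p * q , inj₂ (G-* p∈ q∈)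

record IsPartialFieldHomomorphism (P₁ P₂ : PartialField)
       (φ : PartialField.Element P₁ → PartialField.Element P₂) : Set where
  private
    module P₁ = PartialField P₁
    module P₂ = PartialField P₂
  field
    cong   : Congruent P₁._≈ℙ_ P₂._≈ℙ_ φ
    1-homo : φ P₁.1ℙ P₂.≈ℙ P₂.1ℙ
    *-homo : ∀ p q → φ (p P₁.*ℙ q) P₂.≈ℙ (φ p P₂.*ℙ φ q)
    -- s is p + q as an element of P₁; there is one just when p + q ∈ℙ.
    +-homo : ∀ p q s → (proj₁ p P₁.+ proj₁ q) P₁.≈ proj₁ s →
             (proj₁ (φ p) P₂.+ proj₁ (φ q)) P₂.≈ proj₁ (φ s)

record _≅_ (P₁ P₂ : PartialField) : Set where
  private
    module P₁ = PartialField P₁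
    module P₂ = PartialField P₂
  field
    φ              : P₁.Element → P₂.Element
    isHomomorphism : IsPartialFieldHomomorphism P₁ P₂ φ
    bijective      : Bijective P₁._≈ℙ_ P₂._≈ℙ_ φ
    +-reflects     : ∀ p q → ((proj₁ (φ p) P₂.+ proj₁ (φ q)) P₂.∈ℙ) ⇔ ((proj₁ p P₁.+ proj₁ q) P₁.∈ℙ)

-- (R , ⟨ S ⟩)
partialField : (R : Ring) (S : Pred (CommutativeRing.Carrier R) 0ℓ) →
               S (CommutativeRing.-_ R (CommutativeRing.1# R)) → PartialField
partialField R S -1∈S = record
  { R       = R
  ; G       = SubgroupGeneratedBy R S
  ; G-resp  = resp-≈
  ; G-1     = 1#∈
  ; G-*     = *-∈
  ; G-units = units
  ; G-inv   = inv-∈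
  ; G-neg1  = gen -1∈S (- 1# , -1*-1≈1 , -1*-1≈1)
  }
  where
  open CommutativeRing R renaming (sym to ≈-sym; trans to ≈-trans)
  open RingProperties ring using (-‿distribˡ-*; -‿involutive)

  -1*-1≈1 : - 1# * - 1# ≈ 1#
  -1*-1≈1 = ≈-trans (≈-sym (-‿distribˡ-* 1# (- 1#)))
              (≈-trans (-‿cong (*-identityˡ (- 1#))) (-‿involutive 1#))

  unit : ∀ {x y} → x * y ≈ 1# → IsUnit R x
  unit {x} {y} xy≈1 = y , ≈-trans (*-comm y x) xy≈1 , xy≈1

  swap : ∀ a b c d → (a * b) * (c * d) ≈ (a * c) * (b * d)
  swap a b c d = ≈-trans (*-assoc a b (c * d)) (≈-trans
    (*-congˡ (≈-trans (≈-sym (*-assoc b c d)) (≈-trans (*-congʳ (*-comm b c)) (*-assoc c b d))))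
    (≈-sym (*-assoc a c (b * d))))

  units : ∀ {x} → SubgroupGeneratedBy R S x → IsUnit R x
  units (gen _ u) = u
  units 1#∈ = unit (*-identityˡ 1#)
  units (*-∈ {x} {y} p q) with units p | units q
  ... | x′ , _ , xx′≈1 | y′ , _ , yy′≈1 =
    unit (≈-trans (swap x y x′ y′) (≈-trans (*-cong xx′≈1 yy′≈1) (*-identityˡ 1#)))
  units (inv-∈ {x} {y} xy≈1 _) = unit (≈-trans (*-comm y x) xy≈1)
  units (resp-≈ x≈y p) with units p
  ... | x′ , _ , xx′≈1 = unit (≈-trans (*-congʳ (≈-sym x≈y)) xx′≈1)

------------------------------------------------------------------------
-- Matrices and their minors

-- Rows and columns are indexed by position; row and column labels, where a
-- matrix has them, are kept separately.
Matrix : Set → ℕ → ℕ → Set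
Matrix A m n = Fin m → Fin n → A

module _ (R : Ring) where
  open CommutativeRing R hiding (zero)
  open RawMonoidDefinitions +-rawMonoid using (sum)
  open RawSemiringDefinitions (Semiring.rawSemiring semiring) using (_^_)

  det : ∀ {n} → Matrix Carrier n n → Carrier
  det {zero}  A = 1#
  det {suc n} A =
    sum (λ j → (- 1#) ^ toℕ j * (A zero j * det (λ u v → A (suc u) (punchIn j v))))

  inversions : ∀ {n} → Permutation′ n → ℕ
  inversions σ = length (filter
    (λ (i , j) → (i Fin.<? j) ×-dec ((σ ⟨$⟩ʳ j) Fin.<? (σ ⟨$⟩ʳ i)))
    (cartesianProduct (allFin _) (allFin _)))

  sgn : ∀ {n} → Permutation′ n → Carrier
  sgn σ = (- 1#) ^ inversions σ

  -- The pivot Aˣʸ, where a is the inverse of A x y.  The labels of row x and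
  -- column y are exchanged by pivoting: the row of Aˣʸ in position x is the one
  -- labelled y, and the column in position y is the one labelled x.
  pivot : ∀ {m n} → Matrix Carrier m n → Fin m → Fin n → Carrier → Matrix Carrier m n
  pivot A x y a u v with u Fin.≟ x | v Fin.≟ y
  ... | yes _ | yes _ = a
  ... | yes _ | no  _ = a * A x v
  ... | no  _ | yes _ = - (a * A u y)
  ... | no  _ | no  _ = A u v - a * A u y * A x v

  infix 4 _⪯_

  data _⪯_ : ∀ {m n m′ n′} → Matrix Carrier m′ n′ → Matrix Carrier m n → Set where
    equal         : ∀ {m n} {A A′ : Matrix Carrier m n} → (∀ i j → A′ i j ≈ A i j) → A′ ⪯ A
    transitive    : ∀ {m n m′ n′ m″ n″} {A : Matrix Carrier m n} {A′ : Matrix Carrier m′ n′}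
                    {A″ : Matrix Carrier m″ n″} → A″ ⪯ A′ → A′ ⪯ A → A″ ⪯ A
    scaleRows     : ∀ {m n} {A : Matrix Carrier m n} (c : Fin m → Carrier) →
                    (∀ i → IsUnit R (c i)) → (λ i j → c i * A i j) ⪯ A
    scaleColumns  : ∀ {m n} {A : Matrix Carrier m n} (c : Fin n → Carrier) →
                    (∀ j → IsUnit R (c j)) → (λ i j → A i j * c j) ⪯ A
    deleteRow     : ∀ {m n} {A : Matrix Carrier (suc m) n} (x : Fin (suc m)) →
                    (λ i j → A (punchIn x i) j) ⪯ A
    deleteColumn  : ∀ {m n} {A : Matrix Carrier m (suc n)} (y : Fin (suc n)) →
                    (λ i j → A i (punchIn y j)) ⪯ A
    permuteRows   : ∀ {m n} {A : Matrix Carrier m n} (σ : Permutation′ m) →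
                    (λ i j → A (σ ⟨$⟩ʳ i) j) ⪯ A
    permuteColumns : ∀ {m n} {A : Matrix Carrier m n} (σ : Permutation′ n) →
                    (λ i j → A i (σ ⟨$⟩ʳ j)) ⪯ A
    pivotOn       : ∀ {m n} {A : Matrix Carrier m n} (x : Fin m) (y : Fin n) →
                    ¬ A x y ≈ 0# → ((a , _) : IsUnit R (A x y)) → pivot A x y a ⪯ A

  crossRatioMatrix : Carrier → Matrix Carrier 2 2
  crossRatioMatrix p zero       _          = 1#
  crossRatioMatrix p (suc zero) zero       = p
  crossRatioMatrix p (suc zero) (suc zero) = 1#

  Cr : ∀ {m n} → Matrix Carrier m n → Pred Carrier 0ℓ
  Cr A p = crossRatioMatrix p ⪯ A

------------------------------------------------------------------------
-- Matroids

-- A matroid of rank r on Fin n.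
record Matroid (n r : ℕ) : Set₁ where
  field
    IsBasis   : Pred (Subset n) 0ℓ
    isBasis?  : Decidable IsBasis
    nonempty  : ∃ IsBasis
    size      : ∀ {B} → IsBasis B → ∣ B ∣ ≡ r
    exchange  : ∀ {B B′} → IsBasis B → IsBasis B′ → ∀ {x} → x ∈ B → x ∉ B′ →
                ∃[ y ] y ∈ B′ × y ∉ B × IsBasis ((B ─ ⁅ x ⁆) ∪ ⁅ y ⁆)

elements : ∀ {n} (S : Subset n) → Vec (Fin n) ∣ S ∣
elements []            = []
elements (inside  ∷ S) = zero ∷ Vec.map suc (elements S)
elements (outside ∷ S) = Vec.map suc (elements S)

-- {Z}
entries : ∀ {n r} → Vec (Fin n) r → Subset n
entries Z = ⋃ (List.map ⁅_⁆ (toList Z))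

------------------------------------------------------------------------
-- The universal partial field of a matroid

module _ {n r} (M : Matroid n r) where
  open Matroid M

  -- The proof in the argument of the second constructor is irrelevant, so there
  -- is one such symbol for each Z.
  data Symbol : Set where
    ⟦_⟧  : Vec (Fin n) r → Symbol
    ⟦_⟧⁻ : (Z : Vec (Fin n) r) → .(IsBasis (entries Z)) → Symbol

  open CommutativeRing (polynomialRing Symbol) using (_*_; _-_; 1#)

  data Generator : Pred (Poly Symbol) 0ℓ where
    nonbasis    : ∀ Z → ¬ IsBasis (entries Z) → Generator (var ⟦ Z ⟧)
    alternating : ∀ Z (σ : Permutation′ r) → Generator
      (var ⟦ Z ⟧ - sgn (polynomialRing Symbol) σ * var ⟦ tabulate (λ i → lookup Z (σ ⟨$⟩ʳ i)) ⟧)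
    three-term  : ∀ {k} (2+k≡r : 2 +ℕ k ≡ r) (x₁ x₂ y₁ y₂ : Fin n) (W : Vec (Fin n) k) →
      let [_,_,W] = λ u v → var ⟦ subst (Vec (Fin n)) 2+k≡r (u ∷ v ∷ W) ⟧ in Generator
      ([ x₁ , x₂ ,W] * [ y₁ , y₂ ,W] - [ y₁ , x₂ ,W] * [ x₁ , y₂ ,W] - [ y₂ , x₂ ,W] * [ y₁ , x₁ ,W])
    inverse     : ∀ Z (b : IsBasis (entries Z)) → Generator (var ⟦ Z ⟧ * var (⟦ Z ⟧⁻ b) - 1#)

module _ {n r} (M : Matroid n r) where
  open Matroid M

  𝔹 : Ring
  𝔹 = quotientRing (polynomialRing (Symbol M)) (Generator M)

  module _ (B : Vec (Fin n) r) (b : IsBasis (entries B)) where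
    open CommutativeRing 𝔹

    -- A_{M,B}: row i is labelled by the i-th entry of B, and the columns by the
    -- elements outside B.
    basisMatrix : Matrix Carrier r ∣ ∁ (entries B) ∣
    basisMatrix i j = var ⟦ B [ i ]≔ lookup (elements (∁ (entries B))) j ⟧ * var (⟦ B ⟧⁻ b)

    CrossRatio : Pred Carrier 0ℓ
    CrossRatio = Cr 𝔹 basisMatrix

    -- ℙ_M, with Cr(M) computed from A_{M,B}.  The nonzero elements of Cr(M) are
    -- units of R_M, since Cr(M) contains their inverses.
    universalPartialField : PartialField
    universalPartialField = partialField R_M (λ p → CrossRatio (proj₁ p) ⊎ proj₁ p ≈ - 1#)
      (inj₂ (CommutativeRing.refl 𝔹 { - 1# }))
      where
      R_M : Ring
      R_M = subring 𝔹 CrossRatio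

------------------------------------------------------------------------
-- The matroid P₈

ℚ-ring : Ring
ℚ-ring = ℚ.+-*-commutativeRing

-- The bases of M[A], for A of rank r: the sets of r columns with nonzero determinant.
IsColumnBasis : ∀ {r n} → Matrix ℚ r n → Pred (Subset n) 0ℓ
IsColumnBasis {r} A S =
  Σ[ e ∈ ∣ S ∣ ≡ r ] det ℚ-ring (λ i j → A i (lookup (elements S) (cast (sym e) j))) ≢ 0ℚ

isColumnBasis? : ∀ {r n} (A : Matrix ℚ r n) → Decidable (IsColumnBasis A)
isColumnBasis? {r} A S with ∣ S ∣ ℕ.≟ r
... | no ∣S∣≢r = no (∣S∣≢r ∘ proj₁)
... | yes e = map′ (e ,_) (λ (e′ , d) → subst (λ e → _ ≢ 0ℚ) (ℕ.≡-irrelevant e′ e) d)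
                (¬? (_ ℚ.≟ 0ℚ))

A₈ : Matrix ℚ 4 4
A₈ i j = lookup (lookup rows i) j ℚ./ 1
  where
  rows : Vec (Vec ℤ 4) 4
  rows = (+ 0 ∷ + 1 ∷ + 1 ∷ + 2 ∷ [])
       ∷ (+ 1 ∷ + 0 ∷ + 1 ∷ + 1 ∷ [])
       ∷ (+ 1 ∷ + 1 ∷ + 0 ∷ + 1 ∷ [])
       ∷ (+ 2 ∷ + 1 ∷ + 1 ∷ + 0 ∷ [])
       ∷ []

identityMatrix : ∀ {m} → Matrix ℚ m m
identityMatrix i j with i Fin.≟ j
... | yes _ = 1ℚ
... | no  _ = 0ℚ

[I_] : ∀ {m n} → Matrix ℚ m n → Matrix ℚ m (m +ℕ n)
[I_] {m} A i j = [ identityMatrix i , A i ]′ (splitAt m j)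

private
  _≟ˢ_ : ∀ {n} (S T : Subset n) → Dec (S ≡ T)
  _≟ˢ_ = Vec.≡-dec Bool._≟_

  allSubsets? : ∀ {n} {P : Pred (Subset n) 0ℓ} → Decidable P → Dec (∀ S → P S)
  allSubsets? {zero}  P? = map′ (λ p → λ { [] → p }) (λ p → p []) (P? [])
  allSubsets? {suc n} P? = map′
    (λ (p , q) → λ { (inside ∷ S) → p S ; (outside ∷ S) → q S })
    (λ p → (λ S → p (inside ∷ S)) , (λ S → p (outside ∷ S)))
    (allSubsets? (λ S → P? (inside ∷ S)) ×-dec allSubsets? (λ S → P? (outside ∷ S)))

  -- The dependent sets of size 4, listed to speed up the check of the exchange axiom.
  dependent : List (Subset 8)
  dependent =
      (i ∷ i ∷ i ∷ o ∷ o ∷ o ∷ o ∷ i ∷ [])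
    ∷ (i ∷ i ∷ o ∷ i ∷ o ∷ o ∷ i ∷ o ∷ [])
    ∷ (i ∷ o ∷ i ∷ i ∷ o ∷ i ∷ o ∷ o ∷ [])
    ∷ (i ∷ o ∷ o ∷ i ∷ i ∷ o ∷ o ∷ i ∷ [])
    ∷ (i ∷ o ∷ o ∷ o ∷ i ∷ i ∷ i ∷ o ∷ [])
    ∷ (o ∷ i ∷ i ∷ i ∷ i ∷ o ∷ o ∷ o ∷ [])
    ∷ (o ∷ i ∷ i ∷ o ∷ o ∷ i ∷ i ∷ o ∷ [])
    ∷ (o ∷ i ∷ o ∷ o ∷ i ∷ i ∷ o ∷ i ∷ [])
    ∷ (o ∷ o ∷ i ∷ o ∷ i ∷ o ∷ i ∷ i ∷ [])
    ∷ (o ∷ o ∷ o ∷ i ∷ o ∷ i ∷ i ∷ i ∷ [])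
    ∷ []
    where
    i o : Bool
    i = inside
    o = outside

  open ListMembership (_≟ˢ_ {8}) using () renaming (_∈_ to _∈ᴸ_; _∈?_ to _∈ᴸ?_)

  IsListedBasis : Pred (Subset 8) 0ℓ
  IsListedBasis S = ∣ S ∣ ≡ 4 × ¬ (S ∈ᴸ dependent)

  listed? : Decidable IsListedBasis
  listed? S = (∣ S ∣ ℕ.≟ 4) ×-dec ¬? (S ∈ᴸ? dependent)

  _⇔-dec_ : {P Q : Set} → Dec P → Dec Q → Dec ((P → Q) × (Q → P))
  P? ⇔-dec Q? = (P? →-dec Q?) ×-dec (Q? →-dec P?)

  abstract
    basis⇔listed : ∀ S → (IsColumnBasis [I A₈ ] S → IsListedBasis S)
                            × (IsListedBasis S → IsColumnBasis [I A₈ ] S)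
    basis⇔listed = from-yes (allSubsets? λ S → isColumnBasis? [I A₈ ] S ⇔-dec listed? S)

    listed-exchange : ∀ B → IsListedBasis B → ∀ B′ → IsListedBasis B′ → ∀ x → x ∈ B → x ∉ B′ →
                           ∃[ y ] y ∈ B′ × y ∉ B × IsListedBasis ((B ─ ⁅ x ⁆) ∪ ⁅ y ⁆)
    listed-exchange = from-yes (
      allSubsets? λ B → listed? B →-dec allSubsets? λ B′ → listed? B′ →-dec
      Fin.all? λ x → (x ∈? B) →-dec (¬? (x ∈? B′) →-dec
      Fin.any? λ y → (y ∈? B′) ×-dec (¬? (y ∈? B) ×-dec listed? ((B ─ ⁅ x ⁆) ∪ ⁅ y ⁆))))

P₈ : Matroid 8 4
P₈ = record
  { IsBasis  = IsColumnBasis [I A₈ ]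
  ; isBasis? = isColumnBasis? [I A₈ ]
  ; nonempty = entries (zero ∷ suc zero ∷ suc (suc zero) ∷ suc (suc (suc zero)) ∷ []) , refl , λ ()
  ; size     = proj₁
  ; exchange = λ {B} {B′} b b′ {x} x∈B x∉B′ →
      let y , y∈B′ , y∉B , i = listed-exchange B (proj₁ (basis⇔listed B) b)
                                 B′ (proj₁ (basis⇔listed B′) b′) x x∈B x∉B′
      in y , y∈B′ , y∉B , proj₂ (basis⇔listed _) i
  }

------------------------------------------------------------------------
-- The dyadic partial field

ℤ[½] : Ring
ℤ[½] = subring ℚ-ring (_≡ ½)

𝔻 : PartialField
𝔻 = partialField ℤ[½] (λ x → x ≈ - 1# ⊎ x ≈ 1# + 1#) (inj₁ (CommutativeRing.refl ℤ[½] { - 1# }))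
  where open CommutativeRing ℤ[½] using (_≈_; -_; 1#; _+_)

{-# OPTIONS --safe #-}
module Submission where

-- The three-term relations determine the brackets of P₈ up to rescaling the eight elements:
-- k ∏ s z · [ Z ] = det₈ Z in 𝔹, with k and the s z units, and this forces 2 to be a unit.
-- So, up to row and column scaling, every A′ ⪯ A_{M,B} has entries det₈ Z with Z ranging over
-- the words obtained from one basis B′ by replacing one entry (pivoting changes B′ only).
-- Since det₈ only takes the values 0, ± 1, ± 2 and ± 4, Cr(P₈) ⊆ {0} ∪ ⟨ −1 , 2 ⟩; moreover
-- ½ is a cross ratio.  Therefore R_M = ℤ[½] inside 𝔹, and the evaluation [ Z ] ↦ det₈ Z ∈ ℚ
-- restricts to the isomorphism.

open import Data.Fin.Base using (Fin)
open import Data.Vec.Base using (Vec)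
open import Defs

open import Algebra.Bundles using (CommutativeRing; Semiring)
import Algebra.Definitions.RawSemiring as RawSemiringDefinitions
import Algebra.Properties.CommutativeSemigroup as CommutativeSemigroupProperties
import Algebra.Properties.Group as GroupProperties
import Algebra.Properties.Ring as RingProperties
import Algebra.Solver.Ring as RingSolver
open import Algebra.Solver.Ring.AlmostCommutativeRing
  using (_-Raw-AlmostCommutative⟶_; fromCommutativeRing; -raw-almostCommutative⟶)
open import Data.Bool.Base using (Bool; false; not; if_then_else_)
import Data.Bool.Properties as Bool
open import Data.Fin.Base as Fin using (zero; suc; toℕ; inject₁; punchIn; punchOut)
open import Data.Fin.Patterns
open import Data.Fin.Permutation as Perm using (Permutation′; _⟨$⟩ʳ_)
import Data.Fin.Properties as Fin
open import Data.Fin.Subset using (Subset; inside; outside; ∁; ∣_∣)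
open import Data.Integer.Base as ℤ using (ℤ; +_; 0ℤ; 1ℤ; -1ℤ)
import Data.Integer.Properties as ℤ
open import Data.Integer.Solver using (module +-*-Solver)
open import Data.List.Base as List using (List; []; _∷_; length; filter; cartesianProduct; allFin)
import Data.List.Membership.DecPropositional as DecMembership
import Data.List.Properties as List
open import Data.List.Relation.Unary.All as All using (All; []; _∷_)
import Data.Maybe.Base as Maybe
open import Data.Nat.Base as ℕ using (ℕ; zero; suc)
import Data.Nat.Properties as ℕ
open import Data.Product.Base using (∃-syntax; Σ-syntax; _×_; _,_; proj₁; proj₂)
open import Data.Rational.Base as ℚ using (ℚ; 0ℚ; 1ℚ; ½)
import Data.Rational.Properties as ℚ
open import Data.Rational.Unnormalised.Base as ℚᵘ using (mkℚᵘ; *≡*)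
import Data.Rational.Unnormalised.Properties as ℚᵘ
open import Data.Sum.Base using (_⊎_; inj₁; inj₂; [_,_]′)
open import Data.Vec.Base as Vec using ([]; _∷_; lookup; tabulate; toList; _[_]≔_)
import Data.Vec.Functional as Vector
import Data.Vec.Functional.Properties as Vector
import Data.Vec.Properties as Vec
open import Function.Base using (_∘_; const)
open import Function.Bundles using (mk⇔)
open import Level using (0ℓ)
open import Relation.Binary.PropositionalEquality as ≡
  using (_≡_; _≢_; refl; sym; trans; cong; cong₂)
import Relation.Binary.Reasoning.Setoid as SetoidReasoning
open import Relation.Nullary
  using (¬_; Dec; yes; no; map′; ¬?; _×-dec_; _→-dec_; _⊎-dec_; True; toWitness; ⌊_⌋; dec⇒maybe)
open import Relation.Nullary.Negation using (contradiction)
open import Relation.Unary using (Pred; Decidable)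

-- Scaling every `s z` by t and `k` by t⁻⁴ changes nothing, so the nine factors have eight degrees
-- of freedom: `s 0F` is taken to be 1, and eight brackets can be normalised to 1, namely [0123] and
-- one neighbour for each edge of a spanning tree. Most other brackets then follow linearly: a
-- three-term relation whose other brackets are known, with an invertible cofactor, yields the last
-- one. The obstacle is [0356], which the first batch of such relations leaves open. Combining
-- several relations gives a² = 1 for its value a, and only the invertibility of [4102], whose value
-- is 2, selects -1. Cancelling a unit also makes the step valid in a ring with zero divisors. The
-- ring 𝔹 is larger than ℤ[½]: the scaling factors survive in it as units, so evaluation in ℚ is not
-- injective on 𝔹. Injectivity is proved on R_M alone, where every x satisfies x · 2^k = n with n an
-- integer; the question thus reduces to ℤ → ℚ. Evaluation also shows that 𝔹 is nontrivial, which
-- the presentation does not reveal.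

permutation-injective : ∀ {n} (σ : Permutation′ n) {i j} → σ ⟨$⟩ʳ i ≡ σ ⟨$⟩ʳ j → i ≡ j
permutation-injective σ eq =
  trans (sym (Perm.inverseˡ σ)) (trans (cong (σ Perm.⟨$⟩ˡ_) eq) (Perm.inverseˡ σ))

Word : Set
Word = Vec (Fin 8) 4

allWords? : ∀ {n k} {P : Pred (Vec (Fin n) k) 0ℓ} → Decidable P → Dec (∀ Z → P Z)
allWords? {k = zero}  P? = map′ (λ p → λ { [] → p }) (λ p → p []) (P? [])
allWords? {k = suc k} P? = map′ (λ p → λ { (z ∷ Z) → p z Z }) (λ p z Z → p (z ∷ Z))
  (Fin.all? λ z → allWords? λ Z → P? (z ∷ Z))

allSubsets? : ∀ {n} {P : Pred (Subset n) 0ℓ} → Decidable P → Dec (∀ S → P S)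
allSubsets? {zero}  P? = map′ (λ p → λ { [] → p }) (λ p → p []) (P? [])
allSubsets? {suc n} P? = map′
  (λ (p , q) → λ { (inside ∷ S) → p S ; (outside ∷ S) → q S })
  (λ p → (λ S → p (inside ∷ S)) , (λ S → p (outside ∷ S)))
  (allSubsets? (λ S → P? (inside ∷ S)) ×-dec allSubsets? (λ S → P? (outside ∷ S)))

-- The determinant function of P₈ over ℤ.

Column : Set
Column = Vec ℤ 4

-- An integer copy of the columns of `[I A₈ ]`. The link with the matroid `P₈` is made by
-- `isBasis≡nonzero`.
column : Fin 8 → Column
column = lookup (
    (+ 1 ∷ + 0 ∷ + 0 ∷ + 0 ∷ [])
  ∷ (+ 0 ∷ + 1 ∷ + 0 ∷ + 0 ∷ [])
  ∷ (+ 0 ∷ + 0 ∷ + 1 ∷ + 0 ∷ [])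
  ∷ (+ 0 ∷ + 0 ∷ + 0 ∷ + 1 ∷ [])
  ∷ (+ 0 ∷ + 1 ∷ + 1 ∷ + 2 ∷ [])
  ∷ (+ 1 ∷ + 0 ∷ + 1 ∷ + 1 ∷ [])
  ∷ (+ 1 ∷ + 1 ∷ + 0 ∷ + 1 ∷ [])
  ∷ (+ 2 ∷ + 1 ∷ + 1 ∷ + 0 ∷ [])
  ∷ [])

module _ where
  open import Data.Integer.Base using (_+_; _*_; _-_)

  -- Laplace expansion along the first two columns.
  columnDet : Column → Column → Column → Column → ℤ
  columnDet (a₀ ∷ a₁ ∷ a₂ ∷ a₃ ∷ []) (b₀ ∷ b₁ ∷ b₂ ∷ b₃ ∷ []) (c₀ ∷ c₁ ∷ c₂ ∷ c₃ ∷ []) (d₀ ∷ d₁ ∷ d₂ ∷ d₃ ∷ []) =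
      (a₀ * b₁ - a₁ * b₀) * (c₂ * d₃ - c₃ * d₂)
    - (a₀ * b₂ - a₂ * b₀) * (c₁ * d₃ - c₃ * d₁)
    + (a₀ * b₃ - a₃ * b₀) * (c₁ * d₂ - c₂ * d₁)
    + (a₁ * b₂ - a₂ * b₁) * (c₀ * d₃ - c₃ * d₀)
    - (a₁ * b₃ - a₃ * b₁) * (c₀ * d₂ - c₂ * d₀)
    + (a₂ * b₃ - a₃ * b₂) * (c₀ * d₁ - c₁ * d₀)

det₈ : Word → ℤ
det₈ (a ∷ b ∷ c ∷ d ∷ []) = columnDet (column a) (column b) (column c) (column d)

-- Integer constants and units in a commutative ring.

-- Up to equality in R there is only one such map. Taking it as data lets the ring solver use
-- integer coefficients and lets each ring choose convenient values: `con` in 𝔹, `ℤ→ℚ` in ℚ.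
IntegerMorphism : Ring → Set
IntegerMorphism R = ℤ.+-*-rawRing -Raw-AlmostCommutative⟶ fromCommutativeRing R

module Integers {R : Ring} (ι-morphism : IntegerMorphism R) where
  open CommutativeRing R hiding (zero)
  open _-Raw-AlmostCommutative⟶_ ι-morphism public using ()
    renaming (⟦_⟧ to ι; +-homo to ι-+; *-homo to ι-*; -‿homo to ι-neg; 0-homo to ι-0; 1-homo to ι-1)

  ι-cong : ∀ {i j} → i ≡ j → ι i ≈ ι j
  ι-cong i≡j = reflexive (cong ι i≡j)

  open RingSolver ℤ.+-*-rawRing (fromCommutativeRing R) ι-morphism
    (λ i j → Maybe.map ι-cong (dec⇒maybe (i ℤ.≟ j))) public
    using (solve; con; _:=_; _:+_; _:*_; _:-_; :-_)

Nontrivial : Ring → Set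
Nontrivial R = ¬ 1# ≈ 0#
  where open CommutativeRing R

TwoIsUnit : Ring → Set
TwoIsUnit R = IsUnit R (1# + 1#)
  where open CommutativeRing R

module Units (R : Ring) where
  open CommutativeRing R hiding (zero) renaming (refl to ≈-refl; sym to ≈-sym; trans to ≈-trans)
  open SetoidReasoning setoid
  open CommutativeSemigroupProperties *-commutativeSemigroup using (interchange)

  isUnit : ∀ {x y} → x * y ≈ 1# → IsUnit R x
  isUnit {x} {y} xy≈1 = y , ≈-trans (*-comm y x) xy≈1 , xy≈1

  *-unit : ∀ {x y} → IsUnit R x → IsUnit R y → IsUnit R (x * y)
  *-unit {x} {y} (x′ , _ , xx′) (y′ , _ , yy′) = isUnit (begin
    (x * y) * (x′ * y′) ≈⟨ interchange x y x′ y′ ⟩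
    (x * x′) * (y * y′) ≈⟨ *-cong xx′ yy′ ⟩
    1# * 1#             ≈⟨ *-identityˡ 1# ⟩
    1#                  ∎)

  1#-unit : IsUnit R 1#
  1#-unit = isUnit (*-identityˡ 1#)

  inverse-unit : ∀ {x} (u : IsUnit R x) → IsUnit R (proj₁ u)
  inverse-unit {x} (x′ , x′x , xx′) = x , xx′ , x′x

  unit-resp : ∀ {x y} → x ≈ y → IsUnit R x → IsUnit R y
  unit-resp x≈y (x′ , _ , xx′) = isUnit (≈-trans (*-congʳ (≈-sym x≈y)) xx′)

  *-cancelʳ-unit : ∀ {x y p} → IsUnit R p → x * p ≈ y * p → x ≈ y
  *-cancelʳ-unit {x} {y} {p} (p′ , _ , pp′) xp≈yp = begin
    x            ≈⟨ ≈-sym (*-identityʳ x) ⟩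
    x * 1#       ≈⟨ *-congˡ (≈-sym pp′) ⟩
    x * (p * p′) ≈⟨ ≈-sym (*-assoc x p p′) ⟩
    x * p * p′   ≈⟨ *-congʳ xp≈yp ⟩
    y * p * p′   ≈⟨ *-assoc y p p′ ⟩
    y * (p * p′) ≈⟨ *-congˡ pp′ ⟩
    y * 1#       ≈⟨ *-identityʳ y ⟩
    y            ∎

-- Alternating functions and sorting of words.

swapAt : ∀ {A : Set} → Fin 3 → Vec A 4 → Vec A 4
swapAt 0F (a ∷ b ∷ c ∷ d ∷ []) = b ∷ a ∷ c ∷ d ∷ []
swapAt 1F (a ∷ b ∷ c ∷ d ∷ []) = a ∷ c ∷ b ∷ d ∷ []
swapAt 2F (a ∷ b ∷ c ∷ d ∷ []) = a ∷ b ∷ d ∷ c ∷ []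

IsAlternating : (R : Ring) → ∀ {A} (F : Vec A 4 → CommutativeRing.Carrier R) → Set
IsAlternating R F = ∀ i Z → F (swapAt i Z) ≈ - F Z
  where open CommutativeRing R

ThreeTerm : (R : Ring) → ∀ {n} (F : Vec (Fin n) 4 → CommutativeRing.Carrier R) → Set
ThreeTerm R F = ∀ x₁ x₂ y₁ y₂ w₁ w₂ →
  F (x₁ ∷ x₂ ∷ w₁ ∷ w₂ ∷ []) * F (y₁ ∷ y₂ ∷ w₁ ∷ w₂ ∷ []) ≈
  F (y₁ ∷ x₂ ∷ w₁ ∷ w₂ ∷ []) * F (x₁ ∷ y₂ ∷ w₁ ∷ w₂ ∷ []) +
  F (y₂ ∷ x₂ ∷ w₁ ∷ w₂ ∷ []) * F (y₁ ∷ x₁ ∷ w₁ ∷ w₂ ∷ [])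
  where open CommutativeRing R

data IsSign : ℤ → Set where
  plus  : IsSign 1ℤ
  minus : IsSign -1ℤ

negate : ∀ {s} → IsSign s → IsSign (ℤ.- s)
negate plus  = minus
negate minus = plus

sign² : ∀ {s} → IsSign s → s ℤ.* s ≡ 1ℤ
sign² plus  = refl
sign² minus = refl

-- The lemmas about sorting take an arbitrary list of comparisons, since at this particular list
-- sort unfolds to terms of exponential size.
bubbles : List (Fin 3)
bubbles = 0F ∷ 1F ∷ 0F ∷ 2F ∷ 1F ∷ 0F ∷ []

module _ {n : ℕ} where

  Signed : Set
  Signed = ℤ × Vec (Fin n) 4

  compareAt : Fin 3 → Signed → Signed
  compareAt i (s , Z) with lookup Z (suc i) Fin.<? lookup Z (inject₁ i)
  ... | yes _ = ℤ.- s , swapAt i Z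
  ... | no  _ = s , Z

  compareAt-sign : ∀ i z → IsSign (proj₁ z) → IsSign (proj₁ (compareAt i z))
  compareAt-sign i (s , Z) p with lookup Z (suc i) Fin.<? lookup Z (inject₁ i)
  ... | yes _ = negate p
  ... | no  _ = p

  -- The fold starts at the right end of the list, so `bubbles` compares at 0, 1, 2, then 0, 1, then
  -- 0: the three passes of bubble sort on four letters.
  compareAll : List (Fin 3) → Signed → Signed
  compareAll is z = List.foldr compareAt z is

  compareAll-sign : ∀ is z → IsSign (proj₁ z) → IsSign (proj₁ (compareAll is z))
  compareAll-sign []       z p = p
  compareAll-sign (i ∷ is) z p = compareAt-sign i (compareAll is z) (compareAll-sign is z p)

  sortingSign : List (Fin 3) → Vec (Fin n) 4 → ℤ
  sortingSign is Z = proj₁ (compareAll is (1ℤ , Z))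

  sort : List (Fin 3) → Vec (Fin n) 4 → Vec (Fin n) 4
  sort is Z = proj₂ (compareAll is (1ℤ , Z))

  sortingSign² : ∀ is Z → sortingSign is Z ℤ.* sortingSign is Z ≡ 1ℤ
  sortingSign² is Z = sign² (compareAll-sign is (1ℤ , Z) plus)

module Alternating {R : Ring} (ι-morphism : IntegerMorphism R)
    {n} {F : Vec (Fin n) 4 → CommutativeRing.Carrier R} (alt : IsAlternating R F) where
  open CommutativeRing R hiding (zero) renaming (refl to ≈-refl; sym to ≈-sym; trans to ≈-trans)
  open Integers ι-morphism
  open SetoidReasoning setoid

  private
    -- The invariant of sorting: a swap negates the recorded sign and, since F is alternating, also
    -- the value of F.
    value : Signed → Carrier
    value (s , Z) = ι s * F Z

    compareAt-value : ∀ i z → value (compareAt i z) ≈ value z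
    compareAt-value i (s , Z) with lookup Z (suc i) Fin.<? lookup Z (inject₁ i)
    ... | yes _ = begin
      ι (ℤ.- s) * F (swapAt i Z)  ≈⟨ *-cong (ι-neg s) (alt i Z) ⟩
      - ι s * - F Z               ≈⟨ solve 2 (λ s x → :- s :* :- x := s :* x) ≈-refl (ι s) (F Z) ⟩
      ι s * F Z                   ∎
    ... | no  _ = ≈-refl

    compareAll-value : ∀ is z → value (compareAll is z) ≈ value z
    compareAll-value []       z = ≈-refl
    compareAll-value (i ∷ is) z = ≈-trans (compareAt-value i (compareAll is z)) (compareAll-value is z)

  F-sort : ∀ is Z → F Z ≈ ι (sortingSign is Z) * F (sort is Z)
  F-sort is Z = begin
    F Z                               ≈⟨ ≈-sym (*-identityˡ (F Z)) ⟩
    1# * F Z                          ≈⟨ *-congʳ (≈-sym ι-1) ⟩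
    ι 1ℤ * F Z                        ≈⟨ ≈-sym (compareAll-value is (1ℤ , Z)) ⟩
    ι (sortingSign is Z) * F (sort is Z) ∎

  sort-F : ∀ is Z → F (sort is Z) ≈ ι (sortingSign is Z) * F Z
  sort-F is Z = begin
    F (sort is Z)                ≈⟨ ≈-sym (*-identityˡ _) ⟩
    1# * F (sort is Z)           ≈⟨ *-congʳ (≈-sym (≈-trans (ι-cong (sortingSign² is Z)) ι-1)) ⟩
    ι (s ℤ.* s) * F (sort is Z)  ≈⟨ *-congʳ (ι-* s s) ⟩
    ι s * ι s * F (sort is Z)    ≈⟨ *-assoc _ _ _ ⟩
    ι s * (ι s * F (sort is Z))  ≈⟨ *-congˡ (≈-sym (F-sort is Z)) ⟩
    ι s * F Z                    ∎
    where s = sortingSign is Z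

-- Plücker relations for `det₈` and the bases of P₈.

ℤ-ring : Ring
ℤ-ring = ℤ.+-*-commutativeRing

abstract
  det₈-alternating : IsAlternating ℤ-ring det₈
  det₈-alternating = toWitness {a? = Fin.all? λ i → allWords? λ Z → _ ℤ.≟ _} _

  det₈-isDyadic : ∀ Z → det₈ Z ≡ 0ℤ ⊎ ∃[ k ] (det₈ Z ≡ + (2 ℕ.^ toℕ {3} k) ⊎ det₈ Z ≡ ℤ.- (+ (2 ℕ.^ toℕ {3} k)))
  det₈-isDyadic = toWitness
    {a? = allWords? λ Z → (det₈ Z ℤ.≟ _) ⊎-dec (Fin.any? λ k → (_ ℤ.≟ _) ⊎-dec (_ ℤ.≟ _))} _

-- With two columns fixed, det₈ is an alternating form of rank at most two, hence up to a
-- nonzero factor α(x) β(y) − α(y) β(x).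
Splits : (Fin 8 → Fin 8 → ℤ) → Set
Splits ω = (∀ x y → ω x y ≡ 0ℤ) ⊎ (∃[ e ] ∃[ e′ ] ω e e′ ≢ 0ℤ × (∀ x y →
  ω e e′ ℤ.* ω x y ≡ ω x e′ ℤ.* ω e y ℤ.- ω y e′ ℤ.* ω e x))

splits? : ∀ ω → Dec (Splits ω)
splits? ω = (Fin.all? λ x → Fin.all? λ y → _ ℤ.≟ _) ⊎-dec
  (Fin.any? λ e → Fin.any? λ e′ → ¬? (_ ℤ.≟ _) ×-dec (Fin.all? λ x → Fin.all? λ y → _ ℤ.≟ _))

abstract
  det₈-splits : ∀ w₁ w₂ → Splits (λ x y → det₈ (x ∷ y ∷ w₁ ∷ w₂ ∷ []))
  det₈-splits = toWitness {a? = Fin.all? λ w₁ → Fin.all? λ w₂ → splits? (λ x y → det₈ (x ∷ y ∷ w₁ ∷ w₂ ∷ []))} _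

-- After multiplication by `o` twice, every `o * ω x y` becomes a 2 × 2 determinant in the vectors
-- (α x, β x), and the claim is the Plücker identity for these, a polynomial identity; ℤ is a
-- domain, so `o` cancels. A direct check of the three-term relation would run over 8⁶ choices of
-- letters, whereas `det₈-splits` fixes only two letters and looks for one pair `e`, `e′`.
splits⇒threeTerm : ∀ {ω} → Splits ω → ∀ x₁ x₂ y₁ y₂ →
  ω x₁ x₂ ℤ.* ω y₁ y₂ ≡ ω y₁ x₂ ℤ.* ω x₁ y₂ ℤ.+ ω y₂ x₂ ℤ.* ω y₁ x₁
splits⇒threeTerm (inj₁ ω≡0) x₁ x₂ y₁ y₂
  rewrite ω≡0 x₁ x₂ | ω≡0 y₁ x₂ | ω≡0 y₂ x₂ = refl
splits⇒threeTerm {ω} (inj₂ (e , e′ , o≢0 , split)) x₁ x₂ y₁ y₂ =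
  ℤ.*-cancelˡ-≡ o _ _ (ℤ.*-cancelˡ-≡ o _ _ (begin
    o ℤ.* (o ℤ.* (ω x₁ x₂ ℤ.* ω y₁ y₂))
      ≡⟨ pull₁ o (ω x₁ x₂) (ω y₁ y₂) ⟩
    (o ℤ.* ω x₁ x₂) ℤ.* (o ℤ.* ω y₁ y₂)
      ≡⟨ cong₂ ℤ._*_ (split x₁ x₂) (split y₁ y₂) ⟩
    (α x₁ ℤ.* β x₂ ℤ.- α x₂ ℤ.* β x₁) ℤ.* (α y₁ ℤ.* β y₂ ℤ.- α y₂ ℤ.* β y₁)
      ≡⟨ identity (α x₁) (α x₂) (α y₁) (α y₂) (β x₁) (β x₂) (β y₁) (β y₂) ⟩
    (α y₁ ℤ.* β x₂ ℤ.- α x₂ ℤ.* β y₁) ℤ.* (α x₁ ℤ.* β y₂ ℤ.- α y₂ ℤ.* β x₁) ℤ.+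
    (α y₂ ℤ.* β x₂ ℤ.- α x₂ ℤ.* β y₂) ℤ.* (α y₁ ℤ.* β x₁ ℤ.- α x₁ ℤ.* β y₁)
      ≡⟨ sym (cong₂ ℤ._+_ (cong₂ ℤ._*_ (split y₁ x₂) (split x₁ y₂)) (cong₂ ℤ._*_ (split y₂ x₂) (split y₁ x₁))) ⟩
    (o ℤ.* ω y₁ x₂) ℤ.* (o ℤ.* ω x₁ y₂) ℤ.+ (o ℤ.* ω y₂ x₂) ℤ.* (o ℤ.* ω y₁ x₁)
      ≡⟨ pull₂ o (ω y₁ x₂) (ω x₁ y₂) (ω y₂ x₂) (ω y₁ x₁) ⟩
    o ℤ.* (o ℤ.* (ω y₁ x₂ ℤ.* ω x₁ y₂ ℤ.+ ω y₂ x₂ ℤ.* ω y₁ x₁)) ∎))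
  where
  open ≡.≡-Reasoning
  open +-*-Solver
  o : ℤ
  o = ω e e′
  α β : Fin 8 → ℤ
  α x = ω x e′
  β y = ω e y
  instance
    o-nonZero : ℤ.NonZero o
    o-nonZero = ℤ.≢-nonZero o≢0
  pull₁ : ∀ o x y → o ℤ.* (o ℤ.* (x ℤ.* y)) ≡ (o ℤ.* x) ℤ.* (o ℤ.* y)
  pull₁ = solve 3 (λ o x y → o :* (o :* (x :* y)) := (o :* x) :* (o :* y)) refl
  pull₂ : ∀ o x y z w → (o ℤ.* x) ℤ.* (o ℤ.* y) ℤ.+ (o ℤ.* z) ℤ.* (o ℤ.* w) ≡ o ℤ.* (o ℤ.* (x ℤ.* y ℤ.+ z ℤ.* w))
  pull₂ = solve 5 (λ o x y z w → (o :* x) :* (o :* y) :+ (o :* z) :* (o :* w) := o :* (o :* (x :* y :+ z :* w))) refl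
  identity : ∀ a b c d a′ b′ c′ d′ → _
  identity = solve 8 (λ a b c d a′ b′ c′ d′ →
    (a :* b′ :- b :* a′) :* (c :* d′ :- d :* c′) :=
    (c :* b′ :- b :* c′) :* (a :* d′ :- d :* a′) :+ (d :* b′ :- b :* d′) :* (c :* a′ :- a :* c′)) refl

det₈-threeTerm : ThreeTerm ℤ-ring det₈
det₈-threeTerm x₁ x₂ y₁ y₂ w₁ w₂ = splits⇒threeTerm (det₈-splits w₁ w₂) x₁ x₂ y₁ y₂

private
  nonzero? : List (Fin 8) → Bool
  nonzero? (a ∷ b ∷ c ∷ d ∷ []) = not ⌊ det₈ (a ∷ b ∷ c ∷ d ∷ []) ℤ.≟ 0ℤ ⌋
  nonzero? _                    = false

abstract
  -- The comparison with `det₈` is made in two finite checks, so that the rational determinants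
  -- behind `isBasis?` are computed for the 256 subsets only; the 4096 words are then compared by
  -- integer arithmetic. Sets without exactly four elements count as `false`, which matches `det₈`
  -- vanishing on words with a repeated letter.
  isBasis≡nonzero : ∀ S → ⌊ Matroid.isBasis? P₈ S ⌋ ≡ nonzero? (toList (elements S))
  isBasis≡nonzero = toWitness {a? = allSubsets? λ S → _ Bool.≟ _} _

  entries-nonzero : ∀ Z → nonzero? (toList (elements (entries Z))) ≡ not ⌊ det₈ Z ℤ.≟ 0ℤ ⌋
  entries-nonzero = toWitness {a? = allWords? λ Z → _ Bool.≟ _} _

isBasis?≡det₈≢0 : ∀ Z → ⌊ Matroid.isBasis? P₈ (entries Z) ⌋ ≡ not ⌊ det₈ Z ℤ.≟ 0ℤ ⌋
isBasis?≡det₈≢0 Z = trans (isBasis≡nonzero (entries Z)) (entries-nonzero Z)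

isBasis⇒det₈≢0 : ∀ Z → Matroid.IsBasis P₈ (entries Z) → det₈ Z ≢ 0ℤ
isBasis⇒det₈≢0 Z = forward (Matroid.isBasis? P₈ (entries Z)) (det₈ Z ℤ.≟ 0ℤ) (isBasis?≡det₈≢0 Z)
  where
  forward : ∀ {P Q : Set} (P? : Dec P) (Q? : Dec Q) → ⌊ P? ⌋ ≡ not ⌊ Q? ⌋ → P → ¬ Q
  forward P?     (no ¬q) _ _ = ¬q
  forward (no ¬p) _      _ p = contradiction p ¬p

det₈≢0⇒isBasis : ∀ Z → det₈ Z ≢ 0ℤ → Matroid.IsBasis P₈ (entries Z)
det₈≢0⇒isBasis Z = backward (Matroid.isBasis? P₈ (entries Z)) (det₈ Z ℤ.≟ 0ℤ) (isBasis?≡det₈≢0 Z)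
  where
  backward : ∀ {P Q : Set} (P? : Dec P) (Q? : Dec Q) → ⌊ P? ⌋ ≡ not ⌊ Q? ⌋ → ¬ Q → P
  backward (yes p) _       _ _  = p
  backward (no _)  (yes q) _ ¬q = contradiction q ¬q

det₈-sort : ∀ is Z → det₈ Z ≡ sortingSign is Z ℤ.* det₈ (sort is Z)
det₈-sort = Alternating.F-sort {ℤ-ring} (-raw-almostCommutative⟶ (fromCommutativeRing ℤ-ring)) det₈-alternating

sort-det₈ : ∀ is Z → det₈ (sort is Z) ≡ sortingSign is Z ℤ.* det₈ Z
sort-det₈ = Alternating.sort-F {ℤ-ring} (-raw-almostCommutative⟶ (fromCommutativeRing ℤ-ring)) det₈-alternating

-- Here v is a word of positions in Z, and v ↦ det₈ (Z ∘ v) is again alternating. When v sorts to 0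
-- 1 2 3, this reaches an arbitrary permutation of Z from adjacent swaps.
det₈-sortingPermutation : ∀ {n} (Z : Vec (Fin 8) n) is (v : Vec (Fin n) 4) →
  det₈ (Vec.map (lookup Z) v) ≡ sortingSign is v ℤ.* det₈ (Vec.map (lookup Z) (sort is v))
det₈-sortingPermutation Z = Alternating.F-sort {ℤ-ring} (-raw-almostCommutative⟶ (fromCommutativeRing ℤ-ring)) alt
  where
  map-swapAt : ∀ i v → Vec.map (lookup Z) (swapAt i v) ≡ swapAt i (Vec.map (lookup Z) v)
  map-swapAt 0F (a ∷ b ∷ c ∷ d ∷ []) = refl
  map-swapAt 1F (a ∷ b ∷ c ∷ d ∷ []) = refl
  map-swapAt 2F (a ∷ b ∷ c ∷ d ∷ []) = refl
  alt : IsAlternating ℤ-ring (λ v → det₈ (Vec.map (lookup Z) v))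
  alt i v = trans (cong det₈ (map-swapAt i v)) (det₈-alternating i _)

swapsSign : List (Fin 3) → ℤ
swapsSign []       = 1ℤ
swapsSign (i ∷ is) = ℤ.- swapsSign is

det₈-swaps : ∀ is Z → det₈ (List.foldr swapAt Z is) ≡ swapsSign is ℤ.* det₈ Z
det₈-swaps []       Z = sym (ℤ.*-identityˡ (det₈ Z))
det₈-swaps (i ∷ is) Z = trans (det₈-alternating i (List.foldr swapAt Z is))
  (trans (cong ℤ.-_ (det₈-swaps is Z)) (ℤ.neg-distribˡ-* (swapsSign is) (det₈ Z)))

-- The three-term relation speaks of the first two letters; this moves any two positions there. The
-- factor `s` is the sign of the adjacent swaps used, listed from the last applied to the first, and
-- it is the same for all p and q.
det₈-front : ∀ {x u : Fin 4} → x ≢ u → ∀ B → ∃[ s ] ∃[ w₁ ] ∃[ w₂ ]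
  (∀ p q → det₈ ((B [ x ]≔ p) [ u ]≔ q) ≡ s ℤ.* det₈ (p ∷ q ∷ w₁ ∷ w₂ ∷ []))
det₈-front {x} {u} x≢u (a ∷ b ∷ c ∷ d ∷ []) = front x u x≢u
  where
  Goal : Fin 4 → Fin 4 → Set
  Goal x u = ∃[ s ] ∃[ w₁ ] ∃[ w₂ ]
    (∀ p q → det₈ (((a ∷ b ∷ c ∷ d ∷ []) [ x ]≔ p) [ u ]≔ q) ≡ s ℤ.* det₈ (p ∷ q ∷ w₁ ∷ w₂ ∷ []))
  front : ∀ x u → x ≢ u → Goal x u
  front 0F 0F 0≢0 = contradiction refl 0≢0
  front 1F 1F 0≢0 = contradiction refl 0≢0
  front 2F 2F 0≢0 = contradiction refl 0≢0
  front 3F 3F 0≢0 = contradiction refl 0≢0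
  front 0F 1F _ = 1ℤ , c , d , λ p q → det₈-swaps [] (p ∷ q ∷ c ∷ d ∷ [])
  front 1F 0F _ = -1ℤ , c , d , λ p q → det₈-swaps (0F ∷ []) (p ∷ q ∷ c ∷ d ∷ [])
  front 0F 2F _ = -1ℤ , b , d , λ p q → det₈-swaps (1F ∷ []) (p ∷ q ∷ b ∷ d ∷ [])
  front 2F 0F _ = 1ℤ , b , d , λ p q → det₈-swaps (1F ∷ 0F ∷ []) (p ∷ q ∷ b ∷ d ∷ [])
  front 0F 3F _ = 1ℤ , b , c , λ p q → det₈-swaps (2F ∷ 1F ∷ []) (p ∷ q ∷ b ∷ c ∷ [])
  front 3F 0F _ = -1ℤ , b , c , λ p q → det₈-swaps (2F ∷ 1F ∷ 0F ∷ []) (p ∷ q ∷ b ∷ c ∷ [])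
  front 1F 2F _ = 1ℤ , a , d , λ p q → det₈-swaps (0F ∷ 1F ∷ []) (p ∷ q ∷ a ∷ d ∷ [])
  front 2F 1F _ = -1ℤ , a , d , λ p q → det₈-swaps (1F ∷ 0F ∷ 1F ∷ []) (p ∷ q ∷ a ∷ d ∷ [])
  front 1F 3F _ = -1ℤ , a , c , λ p q → det₈-swaps (2F ∷ 0F ∷ 1F ∷ []) (p ∷ q ∷ a ∷ c ∷ [])
  front 3F 1F _ = 1ℤ , a , c , λ p q → det₈-swaps (2F ∷ 1F ∷ 0F ∷ 1F ∷ []) (p ∷ q ∷ a ∷ c ∷ [])
  front 2F 3F _ = 1ℤ , a , b , λ p q → det₈-swaps (1F ∷ 0F ∷ 2F ∷ 1F ∷ []) (p ∷ q ∷ a ∷ b ∷ [])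
  front 3F 2F _ = -1ℤ , a , b , λ p q → det₈-swaps (2F ∷ 1F ∷ 0F ∷ 2F ∷ 1F ∷ []) (p ∷ q ∷ a ∷ b ∷ [])

update-lookup : ∀ {n} (B : Vec (Fin 8) n) {x u} p → x ≢ u → (B [ x ]≔ p) [ u ]≔ lookup B u ≡ B [ x ]≔ p
update-lookup B {x} {u} p x≢u = trans (cong ((B [ x ]≔ p) [ u ]≔_) (sym (Vec.lookup∘update′ (x≢u ∘ sym) B p)))
  (Vec.[]≔-lookup (B [ x ]≔ p) u)

module _ {x u : Fin 4} (x≢u : x ≢ u) (B : Word) (p : Fin 8) where
  private
    α β : Fin 8
    α = lookup B x
    β = lookup B u
    s : ℤ
    s = proj₁ (det₈-front x≢u B)
    w₁ w₂ : Fin 8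
    w₁ = proj₁ (proj₂ (det₈-front x≢u B))
    w₂ = proj₁ (proj₂ (proj₂ (det₈-front x≢u B)))
    d : Fin 8 → Fin 8 → ℤ
    d y z = det₈ (y ∷ z ∷ w₁ ∷ w₂ ∷ [])
    front : ∀ y z → det₈ ((B [ x ]≔ y) [ u ]≔ z) ≡ s ℤ.* d y z
    front = proj₂ (proj₂ (proj₂ (det₈-front x≢u B)))
    at-x : ∀ y → det₈ (B [ x ]≔ y) ≡ s ℤ.* d y β
    at-x y = trans (cong det₈ (sym (update-lookup B y x≢u))) (front y β)
    at-u : ∀ z → det₈ (B [ u ]≔ z) ≡ s ℤ.* d α z
    at-u z = trans (cong (λ B → det₈ (B [ u ]≔ z)) (sym (Vec.[]≔-lookup B x))) (front α z)
    d-swap : ∀ y z → d y z ≡ ℤ.- d z y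
    d-swap y z = det₈-alternating 0F (z ∷ y ∷ w₁ ∷ w₂ ∷ [])
    open ≡.≡-Reasoning

  -- Up to sign both sides have the letters p and `lookup B x` in the two places, in opposite order.
  -- This is the source of the minus sign in the pivot column.
  det₈-exchange : det₈ ((B [ x ]≔ p) [ u ]≔ lookup B x) ≡ ℤ.- det₈ (B [ u ]≔ p)
  det₈-exchange = begin
    det₈ ((B [ x ]≔ p) [ u ]≔ α)  ≡⟨ front p α ⟩
    s ℤ.* d p α                  ≡⟨ cong (s ℤ.*_) (d-swap p α) ⟩
    s ℤ.* (ℤ.- d α p)            ≡⟨ sym (ℤ.neg-distribʳ-* s (d α p)) ⟩
    ℤ.- (s ℤ.* d α p)            ≡⟨ cong ℤ.-_ (sym (at-u p)) ⟩
    ℤ.- det₈ (B [ u ]≔ p)         ∎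

  -- The three-term relation with y₁ = p and y₂ = q, multiplied by s². It is the pivot formula for
  -- the entries outside the pivot row and column, cleared of denominators.
  det₈-pivot : ∀ q → det₈ B ℤ.* det₈ ((B [ x ]≔ p) [ u ]≔ q) ≡
    det₈ (B [ x ]≔ p) ℤ.* det₈ (B [ u ]≔ q) ℤ.- det₈ (B [ u ]≔ p) ℤ.* det₈ (B [ x ]≔ q)
  det₈-pivot q = begin
    det₈ B ℤ.* det₈ ((B [ x ]≔ p) [ u ]≔ q)
      ≡⟨ cong₂ ℤ._*_ (trans (cong det₈ (sym (Vec.[]≔-lookup B u))) (at-u β)) (front p q) ⟩
    (s ℤ.* d α β) ℤ.* (s ℤ.* d p q)
      ≡⟨ pull s (d α β) (d p q) ⟩
    (s ℤ.* s) ℤ.* (d α β ℤ.* d p q)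
      ≡⟨ cong ((s ℤ.* s) ℤ.*_) (det₈-threeTerm α β p q w₁ w₂) ⟩
    (s ℤ.* s) ℤ.* (d p β ℤ.* d α q ℤ.+ d q β ℤ.* d p α)
      ≡⟨ cong (λ z → (s ℤ.* s) ℤ.* (d p β ℤ.* d α q ℤ.+ d q β ℤ.* z)) (d-swap p α) ⟩
    (s ℤ.* s) ℤ.* (d p β ℤ.* d α q ℤ.+ d q β ℤ.* (ℤ.- d α p))
      ≡⟨ push s (d p β) (d α q) (d q β) (d α p) ⟩
    (s ℤ.* d p β) ℤ.* (s ℤ.* d α q) ℤ.- (s ℤ.* d α p) ℤ.* (s ℤ.* d q β)
      ≡⟨ sym (cong₂ ℤ._-_ (cong₂ ℤ._*_ (at-x p) (at-u q)) (cong₂ ℤ._*_ (at-u p) (at-x q))) ⟩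
    det₈ (B [ x ]≔ p) ℤ.* det₈ (B [ u ]≔ q) ℤ.- det₈ (B [ u ]≔ p) ℤ.* det₈ (B [ x ]≔ q) ∎
    where
    open +-*-Solver
    pull : ∀ s y z → (s ℤ.* y) ℤ.* (s ℤ.* z) ≡ (s ℤ.* s) ℤ.* (y ℤ.* z)
    pull = solve 3 (λ s y z → (s :* y) :* (s :* z) := (s :* s) :* (y :* z)) refl
    push : ∀ s a b c d → (s ℤ.* s) ℤ.* (a ℤ.* b ℤ.+ c ℤ.* (ℤ.- d)) ≡ (s ℤ.* a) ℤ.* (s ℤ.* b) ℤ.- (s ℤ.* d) ℤ.* (s ℤ.* c)
    push = solve 5 (λ s a b c d → (s :* s) :* (a :* b :+ c :* (:- d)) := (s :* a) :* (s :* b) :- (s :* d) :* (s :* c)) refl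

-- Propagation of bracket values along three-term relations.

open DecMembership (Vec.≡-dec {n = 4} (Fin._≟_ {8})) using (_∈_; _∈?_)

-- `L` collects sorted words whose bracket is known; reordering the letters changes a bracket by a
-- known sign only.
Determined : List Word → Word → Set
Determined L Z = det₈ Z ≡ 0ℤ ⊎ sort bubbles Z ∈ L

determined? : ∀ L Z → Dec (Determined L Z)
determined? L Z = (det₈ Z ℤ.≟ 0ℤ) ⊎-dec (sort bubbles Z ∈? L)

-- A product with a vanishing factor is known even if the other factor is not. Many relations become
-- usable only in this way.
DeterminedProduct : List Word → Word → Word → Set
DeterminedProduct L Q R = (det₈ Q ≡ 0ℤ ⊎ det₈ R ≡ 0ℤ) ⊎ (Determined L Q × Determined L R)

determinedProduct? : ∀ L Q R → Dec (DeterminedProduct L Q R)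
determinedProduct? L Q R = ((det₈ Q ℤ.≟ 0ℤ) ⊎-dec (det₈ R ℤ.≟ 0ℤ)) ⊎-dec (determined? L Q ×-dec determined? L R)

-- (x₁ , x₂ , y₁ , y₂ , w₁ , w₂) stands for the three-term relation with these entries.
Relation : Set
Relation = Vec (Fin 8) 6

leading partner : Relation → Word
leading (x₁ ∷ x₂ ∷ y₁ ∷ y₂ ∷ w₁ ∷ w₂ ∷ []) = x₁ ∷ x₂ ∷ w₁ ∷ w₂ ∷ []
partner (x₁ ∷ x₂ ∷ y₁ ∷ y₂ ∷ w₁ ∷ w₂ ∷ []) = y₁ ∷ y₂ ∷ w₁ ∷ w₂ ∷ []

DeterminesProduct : List Word → Relation → Set
DeterminesProduct L (x₁ ∷ x₂ ∷ y₁ ∷ y₂ ∷ w₁ ∷ w₂ ∷ []) =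
  DeterminedProduct L (y₁ ∷ x₂ ∷ w₁ ∷ w₂ ∷ []) (x₁ ∷ y₂ ∷ w₁ ∷ w₂ ∷ []) ×
  DeterminedProduct L (y₂ ∷ x₂ ∷ w₁ ∷ w₂ ∷ []) (y₁ ∷ x₁ ∷ w₁ ∷ w₂ ∷ [])

determinesProduct? : ∀ L ρ → Dec (DeterminesProduct L ρ)
determinesProduct? L (x₁ ∷ x₂ ∷ y₁ ∷ y₂ ∷ w₁ ∷ w₂ ∷ []) =
  determinedProduct? L (y₁ ∷ x₂ ∷ w₁ ∷ w₂ ∷ []) (x₁ ∷ y₂ ∷ w₁ ∷ w₂ ∷ []) ×-dec
  determinedProduct? L (y₂ ∷ x₂ ∷ w₁ ∷ w₂ ∷ []) (y₁ ∷ x₁ ∷ w₁ ∷ w₂ ∷ [])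

DeterminesLeading : List Word → Relation → Set
DeterminesLeading L ρ = DeterminesProduct L ρ × det₈ (partner ρ) ≢ 0ℤ × Determined L (partner ρ)

determinesLeading? : ∀ L ρ → Dec (DeterminesLeading L ρ)
determinesLeading? L ρ = determinesProduct? L ρ ×-dec (¬? (det₈ (partner ρ) ℤ.≟ 0ℤ) ×-dec determined? L (partner ρ))

-- A relation that fails its condition leaves the list as it is. Soundness therefore holds for every
-- list of relations, and the result of the search has to be certified only once, in
-- `all-determined`.
extend : List Word → Relation → List Word
extend L ρ = if ⌊ determinesLeading? L ρ ⌋ then sort bubbles (leading ρ) ∷ L else L

extendAll : List Relation → List Word → List Word
extendAll []       L = L
extendAll (ρ ∷ ρs) L = extendAll ρs (extend L ρ)

-- The basis 0123 and its neighbours along a spanning tree of the bipartite graph of A₈.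
frame : List Word
frame = (0F ∷ 1F ∷ 2F ∷ 3F ∷ [])
  ∷ (5F ∷ 1F ∷ 2F ∷ 3F ∷ [])
  ∷ (6F ∷ 1F ∷ 2F ∷ 3F ∷ [])
  ∷ (0F ∷ 4F ∷ 2F ∷ 3F ∷ [])
  ∷ (0F ∷ 6F ∷ 2F ∷ 3F ∷ [])
  ∷ (0F ∷ 7F ∷ 2F ∷ 3F ∷ [])
  ∷ (0F ∷ 1F ∷ 4F ∷ 3F ∷ [])
  ∷ (0F ∷ 1F ∷ 2F ∷ 5F ∷ [])
  ∷ []

-- Found by search: each relation determines its leading bracket from those already known.
relations₁ relations₂ : List Relation
relations₁ =
    (5F ∷ 6F ∷ 1F ∷ 3F ∷ 0F ∷ 2F ∷ [])
  ∷ (1F ∷ 7F ∷ 2F ∷ 4F ∷ 0F ∷ 3F ∷ [])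
  ∷ (4F ∷ 6F ∷ 1F ∷ 2F ∷ 0F ∷ 3F ∷ [])
  ∷ (6F ∷ 7F ∷ 1F ∷ 2F ∷ 0F ∷ 3F ∷ [])
  ∷ (0F ∷ 6F ∷ 3F ∷ 5F ∷ 1F ∷ 2F ∷ [])
  ∷ (4F ∷ 6F ∷ 0F ∷ 1F ∷ 2F ∷ 3F ∷ [])
  ∷ (5F ∷ 6F ∷ 0F ∷ 1F ∷ 2F ∷ 3F ∷ [])
  ∷ (6F ∷ 7F ∷ 1F ∷ 3F ∷ 0F ∷ 2F ∷ [])
  ∷ []
relations₂ =
    (4F ∷ 6F ∷ 2F ∷ 3F ∷ 0F ∷ 1F ∷ [])
  ∷ (5F ∷ 7F ∷ 2F ∷ 3F ∷ 0F ∷ 1F ∷ [])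
  ∷ (6F ∷ 7F ∷ 2F ∷ 3F ∷ 0F ∷ 1F ∷ [])
  ∷ (4F ∷ 5F ∷ 1F ∷ 3F ∷ 0F ∷ 2F ∷ [])
  ∷ (5F ∷ 7F ∷ 1F ∷ 3F ∷ 0F ∷ 2F ∷ [])
  ∷ (1F ∷ 5F ∷ 2F ∷ 6F ∷ 0F ∷ 3F ∷ [])
  ∷ (4F ∷ 5F ∷ 1F ∷ 2F ∷ 0F ∷ 3F ∷ [])
  ∷ (5F ∷ 7F ∷ 1F ∷ 2F ∷ 0F ∷ 3F ∷ [])
  ∷ (1F ∷ 5F ∷ 3F ∷ 6F ∷ 0F ∷ 4F ∷ [])
  ∷ (2F ∷ 1F ∷ 3F ∷ 5F ∷ 0F ∷ 4F ∷ [])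
  ∷ (2F ∷ 6F ∷ 1F ∷ 3F ∷ 0F ∷ 4F ∷ [])
  ∷ (1F ∷ 6F ∷ 2F ∷ 4F ∷ 0F ∷ 5F ∷ [])
  ∷ (4F ∷ 7F ∷ 1F ∷ 2F ∷ 0F ∷ 5F ∷ [])
  ∷ (6F ∷ 7F ∷ 1F ∷ 2F ∷ 0F ∷ 5F ∷ [])
  ∷ (4F ∷ 7F ∷ 1F ∷ 2F ∷ 0F ∷ 6F ∷ [])
  ∷ (1F ∷ 4F ∷ 3F ∷ 5F ∷ 0F ∷ 7F ∷ [])
  ∷ (2F ∷ 4F ∷ 1F ∷ 3F ∷ 0F ∷ 7F ∷ [])
  ∷ (4F ∷ 5F ∷ 0F ∷ 3F ∷ 1F ∷ 2F ∷ [])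
  ∷ (4F ∷ 6F ∷ 0F ∷ 3F ∷ 1F ∷ 2F ∷ [])
  ∷ (4F ∷ 5F ∷ 0F ∷ 2F ∷ 1F ∷ 3F ∷ [])
  ∷ (4F ∷ 6F ∷ 0F ∷ 2F ∷ 1F ∷ 3F ∷ [])
  ∷ (5F ∷ 6F ∷ 0F ∷ 2F ∷ 1F ∷ 3F ∷ [])
  ∷ (6F ∷ 7F ∷ 0F ∷ 2F ∷ 1F ∷ 3F ∷ [])
  ∷ (2F ∷ 7F ∷ 0F ∷ 5F ∷ 1F ∷ 4F ∷ [])
  ∷ (3F ∷ 7F ∷ 0F ∷ 2F ∷ 1F ∷ 4F ∷ [])
  ∷ (5F ∷ 6F ∷ 0F ∷ 2F ∷ 1F ∷ 4F ∷ [])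
  ∷ (6F ∷ 7F ∷ 0F ∷ 2F ∷ 1F ∷ 4F ∷ [])
  ∷ (2F ∷ 7F ∷ 0F ∷ 4F ∷ 1F ∷ 5F ∷ [])
  ∷ (3F ∷ 7F ∷ 0F ∷ 2F ∷ 1F ∷ 5F ∷ [])
  ∷ (6F ∷ 7F ∷ 0F ∷ 2F ∷ 1F ∷ 5F ∷ [])
  ∷ (2F ∷ 7F ∷ 0F ∷ 4F ∷ 1F ∷ 6F ∷ [])
  ∷ (2F ∷ 3F ∷ 0F ∷ 4F ∷ 1F ∷ 7F ∷ [])
  ∷ (4F ∷ 5F ∷ 0F ∷ 1F ∷ 2F ∷ 3F ∷ [])
  ∷ (4F ∷ 7F ∷ 0F ∷ 1F ∷ 2F ∷ 3F ∷ [])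
  ∷ (5F ∷ 7F ∷ 0F ∷ 1F ∷ 2F ∷ 3F ∷ [])
  ∷ (6F ∷ 7F ∷ 0F ∷ 1F ∷ 2F ∷ 3F ∷ [])
  ∷ (5F ∷ 6F ∷ 0F ∷ 1F ∷ 2F ∷ 4F ∷ [])
  ∷ (5F ∷ 7F ∷ 0F ∷ 1F ∷ 2F ∷ 4F ∷ [])
  ∷ (6F ∷ 7F ∷ 0F ∷ 1F ∷ 2F ∷ 5F ∷ [])
  ∷ (5F ∷ 6F ∷ 0F ∷ 1F ∷ 3F ∷ 4F ∷ [])
  ∷ (5F ∷ 7F ∷ 0F ∷ 1F ∷ 3F ∷ 4F ∷ [])
  ∷ (6F ∷ 7F ∷ 0F ∷ 1F ∷ 3F ∷ 4F ∷ [])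
  ∷ (6F ∷ 7F ∷ 0F ∷ 1F ∷ 4F ∷ 5F ∷ [])
  ∷ []

-- The word 0356 inserted between the two stages is justified by `a-agrees`, which treats several
-- unknown brackets simultaneously.
determined₁ determined₂ : List Word
determined₁ = extendAll relations₁ (List.map (sort bubbles) frame)
determined₂ = extendAll relations₂ ((0F ∷ 3F ∷ 5F ∷ 6F ∷ []) ∷ determined₁)

abstract
  all-determined : ∀ Z → Determined determined₂ Z
  all-determined = toWitness {a? = allWords? (determined? determined₂)} _

-- Uniqueness of the normalised bracket function.

module Uniqueness {R : Ring} (ι-morphism : IntegerMorphism R) where
  open CommutativeRing R hiding (zero) renaming (refl to ≈-refl; sym to ≈-sym; trans to ≈-trans)
  open Integers ι-morphism
  open Units R
  open SetoidReasoning setoid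

  module _ {F : Word → Carrier} (alternating : IsAlternating R F) (threeTerm : ThreeTerm R F)
           (F-zero : ∀ Z → det₈ Z ≡ 0ℤ → F Z ≈ 0#) (F-unit : ∀ Z → det₈ Z ≢ 0ℤ → IsUnit R (F Z))
           (F-frame : All (λ Z → F Z ≈ 1#) frame) where

    private
      Agrees : Word → Set
      Agrees Z = F Z ≈ ι (det₈ Z)

      open Alternating ι-morphism alternating using (F-sort; sort-F)

      sort-agrees : ∀ is Z → Agrees Z → Agrees (sort is Z)
      sort-agrees is Z F≈d = begin
        F (sort is Z)             ≈⟨ sort-F is Z ⟩
        ι s * F Z                 ≈⟨ *-congˡ F≈d ⟩
        ι s * ι (det₈ Z)           ≈⟨ ≈-sym (ι-* s (det₈ Z)) ⟩
        ι (s ℤ.* det₈ Z)           ≈⟨ ι-cong (≡.sym (sort-det₈ is Z)) ⟩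
        ι (det₈ (sort is Z))       ∎
        where s = sortingSign is Z

      agrees-sort : ∀ is Z → Agrees (sort is Z) → Agrees Z
      agrees-sort is Z F≈d = begin
        F Z                          ≈⟨ F-sort is Z ⟩
        ι s * F (sort is Z)          ≈⟨ *-congˡ F≈d ⟩
        ι s * ι (det₈ (sort is Z))    ≈⟨ ≈-sym (ι-* s _) ⟩
        ι (s ℤ.* det₈ (sort is Z))    ≈⟨ ι-cong (≡.sym (det₈-sort is Z)) ⟩
        ι (det₈ Z)                    ∎
        where s = sortingSign is Z

      zero-agrees : ∀ Z → det₈ Z ≡ 0ℤ → Agrees Z
      zero-agrees Z d≡0 = ≈-trans (F-zero Z d≡0) (≈-trans (≈-sym ι-0) (ι-cong (≡.sym d≡0)))

      agrees : ∀ {L} → All Agrees L → ∀ Z → Determined L Z → Agrees Z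
      agrees L-agrees Z (inj₁ d≡0) = zero-agrees Z d≡0
      agrees L-agrees Z (inj₂ Z∈L) = agrees-sort bubbles Z (All.lookup L-agrees Z∈L)

      product-agrees : ∀ {L} → All Agrees L → ∀ Q P → DeterminedProduct L Q P →
                       F Q * F P ≈ ι (det₈ Q ℤ.* det₈ P)
      product-agrees L-agrees Q P (inj₂ (q , p)) =
        ≈-trans (*-cong (agrees L-agrees Q q) (agrees L-agrees P p)) (≈-sym (ι-* _ _))
      product-agrees L-agrees Q P (inj₁ (inj₁ q≡0)) = begin
        F Q * F P              ≈⟨ *-congʳ (F-zero Q q≡0) ⟩
        0# * F P               ≈⟨ zeroˡ _ ⟩
        0#                     ≈⟨ ≈-sym ι-0 ⟩
        ι 0ℤ                   ≈⟨ ι-cong (≡.sym (≡.cong (ℤ._* det₈ P) q≡0)) ⟩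
        ι (det₈ Q ℤ.* det₈ P)    ∎
      product-agrees L-agrees Q P (inj₁ (inj₂ p≡0)) = begin
        F Q * F P              ≈⟨ *-congˡ (F-zero P p≡0) ⟩
        F Q * 0#               ≈⟨ zeroʳ _ ⟩
        0#                     ≈⟨ ≈-sym ι-0 ⟩
        ι 0ℤ                   ≈⟨ ι-cong (≡.sym (≡.trans (≡.cong (det₈ Q ℤ.*_) p≡0) (ℤ.*-zeroʳ (det₈ Q)))) ⟩
        ι (det₈ Q ℤ.* det₈ P)    ∎

      leadingProduct : ∀ {L} → All Agrees L → ∀ ρ → DeterminesProduct L ρ →
                       F (leading ρ) * F (partner ρ) ≈ ι (det₈ (leading ρ) ℤ.* det₈ (partner ρ))
      leadingProduct L-agrees (x₁ ∷ x₂ ∷ y₁ ∷ y₂ ∷ w₁ ∷ w₂ ∷ []) (qr , st) =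
        transfer (threeTerm x₁ x₂ y₁ y₂ w₁ w₂)
          (product-agrees L-agrees (y₁ ∷ x₂ ∷ w₁ ∷ w₂ ∷ []) (x₁ ∷ y₂ ∷ w₁ ∷ w₂ ∷ []) qr)
          (product-agrees L-agrees (y₂ ∷ x₂ ∷ w₁ ∷ w₂ ∷ []) (y₁ ∷ x₁ ∷ w₁ ∷ w₂ ∷ []) st)
          (det₈-threeTerm x₁ x₂ y₁ y₂ w₁ w₂)
        where
        transfer : ∀ {x y z i j k} → x ≈ y + z → y ≈ ι i → z ≈ ι j → k ≡ i ℤ.+ j → x ≈ ι k
        transfer x≈y+z y≈i z≈j k≡i+j = ≈-trans x≈y+z (≈-trans (+-cong y≈i z≈j)
          (≈-trans (≈-sym (ι-+ _ _)) (ι-cong (≡.sym k≡i+j))))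

      -- The relation gives the product of the two brackets on its left side; the partner is a
      -- basis, hence a unit, and is cancelled.
      leading-agrees : ∀ {L} → All Agrees L → ∀ ρ → DeterminesLeading L ρ → Agrees (leading ρ)
      leading-agrees L-agrees ρ (product , p≢0 , p) = *-cancelʳ-unit (F-unit (partner ρ) p≢0) (begin
        F (leading ρ) * F (partner ρ)              ≈⟨ leadingProduct L-agrees ρ product ⟩
        ι (det₈ (leading ρ) ℤ.* det₈ (partner ρ))    ≈⟨ ι-* _ _ ⟩
        ι (det₈ (leading ρ)) * ι (det₈ (partner ρ))  ≈⟨ *-congˡ (≈-sym (agrees L-agrees (partner ρ) p)) ⟩
        ι (det₈ (leading ρ)) * F (partner ρ)        ∎)

      extend-agrees : ∀ {L} → All Agrees L → ∀ ρ → All Agrees (extend L ρ)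
      extend-agrees {L} L-agrees ρ = if-agrees (determinesLeading? L ρ)
        (λ d → sort-agrees bubbles (leading ρ) (leading-agrees L-agrees ρ d))
        where
        if-agrees : ∀ {P : Set} (P? : Dec P) {Z} → (P → Agrees Z) →
                    All Agrees (if ⌊ P? ⌋ then Z ∷ L else L)
        if-agrees (yes p) Z-agrees = Z-agrees p ∷ L-agrees
        if-agrees (no _)  _        = L-agrees

      extendAll-agrees : ∀ ρs {L} → All Agrees L → All Agrees (extendAll ρs L)
      extendAll-agrees []       L-agrees = L-agrees
      extendAll-agrees (ρ ∷ ρs) L-agrees = extendAll-agrees ρs (extend-agrees L-agrees ρ)

      sort-product : ∀ is X P → F X * F P ≈ ι (det₈ X ℤ.* det₈ P) →
        F (sort is X) * F (sort is P) ≈ ι (det₈ (sort is X) ℤ.* det₈ (sort is P))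
      sort-product is X P FXP = begin
        F (sort is X) * F (sort is P)           ≈⟨ *-cong (sort-F is X) (sort-F is P) ⟩
        (ι s * F X) * (ι t * F P)               ≈⟨ rearrange (ι s) (F X) (ι t) (F P) ⟩
        (ι s * ι t) * (F X * F P)               ≈⟨ *-cong (≈-sym (ι-* s t)) FXP ⟩
        ι (s ℤ.* t) * ι (det₈ X ℤ.* det₈ P)       ≈⟨ ≈-sym (ι-* _ _) ⟩
        ι ((s ℤ.* t) ℤ.* (det₈ X ℤ.* det₈ P))     ≈⟨ ι-cong (ℤ-interchange s t (det₈ X) (det₈ P)) ⟩
        ι ((s ℤ.* det₈ X) ℤ.* (t ℤ.* det₈ P))     ≈⟨ ι-cong (≡.sym (≡.cong₂ ℤ._*_ (sort-det₈ is X) (sort-det₈ is P))) ⟩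
        ι (det₈ (sort is X) ℤ.* det₈ (sort is P)) ∎
        where
        s = sortingSign is X
        t = sortingSign is P
        open CommutativeSemigroupProperties *-commutativeSemigroup using () renaming (interchange to rearrange)
        open CommutativeSemigroupProperties ℤ.*-commutativeSemigroup using () renaming (interchange to ℤ-interchange)

      sorted-agree : ∀ is {L} → All (λ Z → F Z ≈ 1#) L → All (λ Z → det₈ Z ≡ 1ℤ) L →
                     All Agrees (List.map (sort is) L)
      sorted-agree is []            []          = []
      sorted-agree is {Z ∷ _} (F≈1 ∷ Fs) (d≡1 ∷ ds) =
        sort-agrees is Z (≈-trans F≈1 (≈-trans (≈-sym ι-1) (ι-cong (≡.sym d≡1)))) ∷ sorted-agree is Fs ds

      frame-det₈ : All (λ Z → det₈ Z ≡ 1ℤ) frame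
      frame-det₈ = toWitness {a? = All.all? (λ Z → det₈ Z ℤ.≟ 1ℤ) frame} _

      frame-agrees : All Agrees (List.map (sort bubbles) frame)
      frame-agrees = sorted-agree bubbles {frame} F-frame frame-det₈

      determined₁-agrees : All Agrees determined₁
      determined₁-agrees = extendAll-agrees relations₁ {List.map (sort bubbles) frame} frame-agrees

      -- Yields an equation between brackets neither of which has to be known, as long as the right
      -- side of the relation is known.
      sortedProduct : ∀ ρ → {True (determinesProduct? determined₁ ρ)} →
        F (sort bubbles (leading ρ)) * F (sort bubbles (partner ρ)) ≈
        ι (det₈ (sort bubbles (leading ρ)) ℤ.* det₈ (sort bubbles (partner ρ)))
      sortedProduct ρ {t} = sort-product bubbles (leading ρ) (partner ρ)
        (leadingProduct determined₁-agrees ρ (toWitness t))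

      -- Four brackets outside `determined₁`. Pairwise products tie `a`, `b` and `c` together. `p`
      -- is the bracket whose determinant is 2: the spurious solution a = 1, b = -1 would make it 0,
      -- so its invertibility decides the sign.
      a b c p : Carrier
      a = F (0F ∷ 3F ∷ 5F ∷ 6F ∷ [])
      b = F (0F ∷ 2F ∷ 4F ∷ 6F ∷ [])
      c = F (2F ∷ 3F ∷ 6F ∷ 7F ∷ [])
      p = F (4F ∷ 1F ∷ 0F ∷ 2F ∷ [])

      ab≈-1 : a * b ≈ ι -1ℤ
      ab≈-1 = sortedProduct (3F ∷ 5F ∷ 2F ∷ 4F ∷ 0F ∷ 6F ∷ [])

      cb≈-1 : c * b ≈ ι -1ℤ
      cb≈-1 = sortedProduct (3F ∷ 7F ∷ 0F ∷ 4F ∷ 2F ∷ 6F ∷ [])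

      ca≈1 : c * a ≈ ι 1ℤ
      ca≈1 = sortedProduct (2F ∷ 7F ∷ 0F ∷ 5F ∷ 3F ∷ 6F ∷ [])

      agrees₁ : ∀ Z → {True (determined? determined₁ Z)} → Agrees Z
      agrees₁ Z {t} = agrees determined₁-agrees Z (toWitness t)

      -- In the relation for [1302] [4602] every bracket other than `p` and [4602] is already known,
      -- so `b` is affine in `p`.
      b≈p-1 : b ≈ p - 1#
      b≈p-1 = begin
        b ≈⟨ sort-F bubbles (4F ∷ 6F ∷ 0F ∷ 2F ∷ []) ⟩
        ι 1ℤ * F (4F ∷ 6F ∷ 0F ∷ 2F ∷ [])
          ≈⟨ solve 1 (λ x → con 1ℤ :* x := :- (con -1ℤ :* x)) ≈-refl _ ⟩
        - (ι -1ℤ * F (4F ∷ 6F ∷ 0F ∷ 2F ∷ []))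
          ≈⟨ -‿cong (*-congʳ (≈-sym (agrees₁ (1F ∷ 3F ∷ 0F ∷ 2F ∷ [])))) ⟩
        - (F (1F ∷ 3F ∷ 0F ∷ 2F ∷ []) * F (4F ∷ 6F ∷ 0F ∷ 2F ∷ []))
          ≈⟨ -‿cong (threeTerm 1F 3F 4F 6F 0F 2F) ⟩
        - (F (4F ∷ 3F ∷ 0F ∷ 2F ∷ []) * F (1F ∷ 6F ∷ 0F ∷ 2F ∷ []) + F (6F ∷ 3F ∷ 0F ∷ 2F ∷ []) * p)
          ≈⟨ -‿cong (+-cong (*-cong (agrees₁ (4F ∷ 3F ∷ 0F ∷ 2F ∷ [])) (agrees₁ (1F ∷ 6F ∷ 0F ∷ 2F ∷ [])))
                            (*-congʳ (agrees₁ (6F ∷ 3F ∷ 0F ∷ 2F ∷ [])))) ⟩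
        - (ι -1ℤ * ι -1ℤ + ι -1ℤ * p)
          ≈⟨ solve 1 (λ p → :- (con -1ℤ :* con -1ℤ :+ con -1ℤ :* p) := p :- con 1ℤ) ≈-refl p ⟩
        p - ι 1ℤ
          ≈⟨ +-congˡ (-‿cong ι-1) ⟩
        p - 1# ∎

      -- The relations force a = c, a² = 1 and b = −a, whence p (a + 1) = 1 − a² = 0.
      a-agrees : Agrees (0F ∷ 3F ∷ 5F ∷ 6F ∷ [])
      a-agrees = *-cancelʳ-unit (F-unit (4F ∷ 1F ∷ 0F ∷ 2F ∷ []) λ ()) (begin
        a * p                          ≈⟨ *-congˡ p≈b+1 ⟩
        a * (b + 1#)                   ≈⟨ ≈-trans (distribˡ a b 1#) (+-congˡ (*-identityʳ a)) ⟩
        a * b + a                      ≈⟨ +-cong ab≈-1 a≈-b ⟩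
        ι -1ℤ - b                      ≈⟨ solve 1 (λ b → con -1ℤ :- b := con -1ℤ :* (b :+ con 1ℤ)) ≈-refl b ⟩
        ι -1ℤ * (b + ι 1ℤ)             ≈⟨ *-congˡ (≈-trans (+-congˡ ι-1) (≈-sym p≈b+1)) ⟩
        ι -1ℤ * p                      ∎)
        where
        p≈b+1 : p ≈ b + 1#
        p≈b+1 = ≈-sym (≈-trans (+-congʳ b≈p-1) (≈-trans (+-assoc p _ _)
          (≈-trans (+-congˡ (-‿inverseˡ 1#)) (+-identityʳ p))))
        -- (c b) a = (c a) b
        a≈-b : a ≈ - b
        a≈-b = begin
          a                 ≈⟨ solve 1 (λ a → a := :- (con -1ℤ :* a)) ≈-refl a ⟩
          - (ι -1ℤ * a)     ≈⟨ -‿cong (*-congʳ (≈-sym cb≈-1)) ⟩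
          - (c * b * a)     ≈⟨ solve 3 (λ a b c → :- (c :* b :* a) := :- (c :* a :* b)) ≈-refl a b c ⟩
          - (c * a * b)     ≈⟨ -‿cong (*-congʳ ca≈1) ⟩
          - (ι 1ℤ * b)      ≈⟨ -‿cong (≈-trans (*-congʳ ι-1) (*-identityˡ b)) ⟩
          - b               ∎

    F≈det₈ : ∀ Z → F Z ≈ ι (det₈ Z)
    F≈det₈ Z = agrees {determined₂} (extendAll-agrees relations₂ {(0F ∷ 3F ∷ 5F ∷ 6F ∷ []) ∷ determined₁}
      (a-agrees ∷ determined₁-agrees)) Z (all-determined Z)

-- Normalising the brackets by rescaling the elements.

module Brackets {R : Ring} (ι-morphism : IntegerMorphism R)
    {P : Word → CommutativeRing.Carrier R} (alternating : IsAlternating R P) (threeTerm : ThreeTerm R P)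
    (P-zero : ∀ Z → det₈ Z ≡ 0ℤ → CommutativeRing._≈_ R (P Z) (CommutativeRing.0# R))
    (P-unit : ∀ Z → det₈ Z ≢ 0ℤ → IsUnit R (P Z)) where
  open CommutativeRing R hiding (zero) renaming (refl to ≈-refl; sym to ≈-sym; trans to ≈-trans)
  open Integers ι-morphism
  open Units R
  open SetoidReasoning setoid

  product : (Fin 8 → Carrier) → Word → Carrier
  product f (a ∷ b ∷ c ∷ d ∷ []) = f a * f b * f c * f d

  product-unit : ∀ f → (∀ z → IsUnit R (f z)) → ∀ Z → IsUnit R (product f Z)
  product-unit f f-unit (a ∷ b ∷ c ∷ d ∷ []) =
    *-unit (*-unit (*-unit (f-unit a) (f-unit b)) (f-unit c)) (f-unit d)

  product-update : ∀ f (f-unit : ∀ z → IsUnit R (f z)) Z i v →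
    product f (Z [ i ]≔ v) ≈ product f Z * proj₁ (f-unit (lookup Z i)) * f v
  product-update f f-unit Z i v = *-cancelʳ-unit (f-unit (lookup Z i)) (begin
    product f (Z [ i ]≔ v) * z                ≈⟨ exchange Z i ⟩
    product f Z * f v                         ≈⟨ ≈-sym (*-identityʳ _) ⟩
    product f Z * f v * 1#                    ≈⟨ *-congˡ (≈-sym (proj₁ (proj₂ (f-unit (lookup Z i))))) ⟩
    product f Z * f v * (z⁻¹ * z)             ≈⟨ solve 4 (λ p v y z → p :* v :* (y :* z) := p :* y :* v :* z) ≈-refl (product f Z) (f v) z⁻¹ z ⟩
    product f Z * z⁻¹ * f v * z               ∎)
    where
    z z⁻¹ : Carrier
    z = f (lookup Z i)
    z⁻¹ = proj₁ (f-unit (lookup Z i))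
    exchange : ∀ Z i → product f (Z [ i ]≔ v) * f (lookup Z i) ≈ product f Z * f v
    exchange (a ∷ b ∷ c ∷ d ∷ []) 0F = solve 5 (λ a b c d v → v :* b :* c :* d :* a := a :* b :* c :* d :* v) ≈-refl (f a) (f b) (f c) (f d) (f v)
    exchange (a ∷ b ∷ c ∷ d ∷ []) 1F = solve 5 (λ a b c d v → a :* v :* c :* d :* b := a :* b :* c :* d :* v) ≈-refl (f a) (f b) (f c) (f d) (f v)
    exchange (a ∷ b ∷ c ∷ d ∷ []) 2F = solve 5 (λ a b c d v → a :* b :* v :* d :* c := a :* b :* c :* d :* v) ≈-refl (f a) (f b) (f c) (f d) (f v)
    exchange (a ∷ b ∷ c ∷ d ∷ []) 3F = solve 5 (λ a b c d v → a :* b :* c :* v :* d := a :* b :* c :* d :* v) ≈-refl (f a) (f b) (f c) (f d) (f v)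

  module Rescaling (s : Fin 8 → Carrier) (k : Carrier) where

    rescaled : Word → Carrier
    rescaled Z = k * product s Z * P Z

    rescaled-alternating : IsAlternating R rescaled
    rescaled-alternating i Z = begin
      k * product s (swapAt i Z) * P (swapAt i Z)  ≈⟨ *-cong (*-congˡ (product-swap i Z)) (alternating i Z) ⟩
      k * product s Z * - P Z                      ≈⟨ solve 2 (λ x y → x :* (:- y) := :- (x :* y)) ≈-refl _ (P Z) ⟩
      - (k * product s Z * P Z)                    ∎
      where
      product-swap : ∀ i Z → product s (swapAt i Z) ≈ product s Z
      product-swap 0F (a ∷ b ∷ c ∷ d ∷ []) = solve 4 (λ a b c d → b :* a :* c :* d := a :* b :* c :* d) ≈-refl (s a) (s b) (s c) (s d)
      product-swap 1F (a ∷ b ∷ c ∷ d ∷ []) = solve 4 (λ a b c d → a :* c :* b :* d := a :* b :* c :* d) ≈-refl (s a) (s b) (s c) (s d)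
      product-swap 2F (a ∷ b ∷ c ∷ d ∷ []) = solve 4 (λ a b c d → a :* b :* d :* c := a :* b :* c :* d) ≈-refl (s a) (s b) (s c) (s d)

    -- All three products in the relation contain x₁, x₂, y₁, y₂ once and w₁, w₂ twice, hence
    -- acquire the same factor.
    rescaled-threeTerm : ThreeTerm R rescaled
    rescaled-threeTerm x₁ x₂ y₁ y₂ w₁ w₂ = begin
      rescaled (x₁ ∷ x₂ ∷ w₁ ∷ w₂ ∷ []) * rescaled (y₁ ∷ y₂ ∷ w₁ ∷ w₂ ∷ [])
        ≈⟨ collect (s x₁) (s x₂) (s y₁) (s y₂) _ _ ⟩
      κ * (P (x₁ ∷ x₂ ∷ w₁ ∷ w₂ ∷ []) * P (y₁ ∷ y₂ ∷ w₁ ∷ w₂ ∷ []))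
        ≈⟨ *-congˡ (threeTerm x₁ x₂ y₁ y₂ w₁ w₂) ⟩
      κ * (P (y₁ ∷ x₂ ∷ w₁ ∷ w₂ ∷ []) * P (x₁ ∷ y₂ ∷ w₁ ∷ w₂ ∷ []) +
           P (y₂ ∷ x₂ ∷ w₁ ∷ w₂ ∷ []) * P (y₁ ∷ x₁ ∷ w₁ ∷ w₂ ∷ []))
        ≈⟨ distribˡ κ _ _ ⟩
      κ * (P (y₁ ∷ x₂ ∷ w₁ ∷ w₂ ∷ []) * P (x₁ ∷ y₂ ∷ w₁ ∷ w₂ ∷ [])) +
      κ * (P (y₂ ∷ x₂ ∷ w₁ ∷ w₂ ∷ []) * P (y₁ ∷ x₁ ∷ w₁ ∷ w₂ ∷ []))
        ≈⟨ +-cong (*-congʳ (swap₁ (s x₁) (s x₂) (s y₁) (s y₂))) (*-congʳ (swap₂ (s x₁) (s x₂) (s y₁) (s y₂))) ⟩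
      scale (s y₁) (s x₂) (s x₁) (s y₂) * (P (y₁ ∷ x₂ ∷ w₁ ∷ w₂ ∷ []) * P (x₁ ∷ y₂ ∷ w₁ ∷ w₂ ∷ [])) +
      scale (s y₂) (s x₂) (s y₁) (s x₁) * (P (y₂ ∷ x₂ ∷ w₁ ∷ w₂ ∷ []) * P (y₁ ∷ x₁ ∷ w₁ ∷ w₂ ∷ []))
        ≈⟨ ≈-sym (+-cong (collect (s y₁) (s x₂) (s x₁) (s y₂) _ _) (collect (s y₂) (s x₂) (s y₁) (s x₁) _ _)) ⟩
      rescaled (y₁ ∷ x₂ ∷ w₁ ∷ w₂ ∷ []) * rescaled (x₁ ∷ y₂ ∷ w₁ ∷ w₂ ∷ []) +
      rescaled (y₂ ∷ x₂ ∷ w₁ ∷ w₂ ∷ []) * rescaled (y₁ ∷ x₁ ∷ w₁ ∷ w₂ ∷ []) ∎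
      where
      u v : Carrier
      u = s w₁
      v = s w₂
      scale : Carrier → Carrier → Carrier → Carrier → Carrier
      scale a b c d = (k * k) * (u * u) * (v * v) * (a * b * (c * d))
      κ : Carrier
      κ = scale (s x₁) (s x₂) (s y₁) (s y₂)
      collect : ∀ a b c d X Y → (k * (a * b * u * v) * X) * (k * (c * d * u * v) * Y) ≈ scale a b c d * (X * Y)
      collect a b c d X Y = solve 9 (λ k u v a b c d X Y →
        (k :* (a :* b :* u :* v) :* X) :* (k :* (c :* d :* u :* v) :* Y) :=
        (k :* k) :* (u :* u) :* (v :* v) :* (a :* b :* (c :* d)) :* (X :* Y)) ≈-refl k u v a b c d X Y
      swap₁ : ∀ a b c d → scale a b c d ≈ scale c b a d
      swap₁ a b c d = *-congˡ (solve 4 (λ a b c d → a :* b :* (c :* d) := c :* b :* (a :* d)) ≈-refl a b c d)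
      swap₂ : ∀ a b c d → scale a b c d ≈ scale d b c a
      swap₂ a b c d = *-congˡ (solve 4 (λ a b c d → a :* b :* (c :* d) := d :* b :* (c :* a)) ≈-refl a b c d)

  private
    p p₀₅ p₀₆ p₁₄ p₁₆ p₁₇ p₂₄ p₃₅ : Σ[ x ∈ Carrier ] IsUnit R x
    p   = _ , P-unit (0F ∷ 1F ∷ 2F ∷ 3F ∷ []) λ ()
    p₀₅ = _ , P-unit (5F ∷ 1F ∷ 2F ∷ 3F ∷ []) λ ()
    p₀₆ = _ , P-unit (6F ∷ 1F ∷ 2F ∷ 3F ∷ []) λ ()
    p₁₄ = _ , P-unit (0F ∷ 4F ∷ 2F ∷ 3F ∷ []) λ ()
    p₁₆ = _ , P-unit (0F ∷ 6F ∷ 2F ∷ 3F ∷ []) λ ()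
    p₁₇ = _ , P-unit (0F ∷ 7F ∷ 2F ∷ 3F ∷ []) λ ()
    p₂₄ = _ , P-unit (0F ∷ 1F ∷ 4F ∷ 3F ∷ []) λ ()
    p₃₅ = _ , P-unit (0F ∷ 1F ∷ 2F ∷ 5F ∷ []) λ ()

    infixl 7 _⊙_
    _⊙_ : Σ[ x ∈ Carrier ] IsUnit R x → Σ[ x ∈ Carrier ] IsUnit R x → Σ[ x ∈ Carrier ] IsUnit R x
    (x , u) ⊙ (y , v) = x * y , *-unit u v
    inv : Σ[ x ∈ Carrier ] IsUnit R x → Σ[ x ∈ Carrier ] IsUnit R x
    inv (x , u) = proj₁ u , inverse-unit u

    -- Along each tree edge i j the factors satisfy σ j · [0123 with i replaced by j] = σ i · [0123].
    σ₀ σ₁ σ₂ σ₃ σ₄ σ₅ σ₆ σ₇ : Σ[ x ∈ Carrier ] IsUnit R x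
    σ₀ = 1# , 1#-unit
    σ₅ = σ₀ ⊙ p ⊙ inv p₀₅
    σ₆ = σ₀ ⊙ p ⊙ inv p₀₆
    σ₁ = σ₆ ⊙ p₁₆ ⊙ inv p
    σ₄ = σ₁ ⊙ p ⊙ inv p₁₄
    σ₇ = σ₁ ⊙ p ⊙ inv p₁₇
    σ₂ = σ₄ ⊙ p₂₄ ⊙ inv p
    σ₃ = σ₅ ⊙ p₃₅ ⊙ inv p

    σ : Fin 8 → Σ[ x ∈ Carrier ] IsUnit R x
    σ = lookup (σ₀ ∷ σ₁ ∷ σ₂ ∷ σ₃ ∷ σ₄ ∷ σ₅ ∷ σ₆ ∷ σ₇ ∷ [])

    cancel : ∀ x y ((z , u) : Σ[ x ∈ Carrier ] IsUnit R x) → x * y * proj₁ u * z ≈ x * y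
    cancel x y (z , z⁻¹ , z⁻¹z , _) = ≈-trans (*-assoc (x * y) z⁻¹ z) (≈-trans (*-congˡ z⁻¹z) (*-identityʳ _))

    κ : Σ[ x ∈ Carrier ] IsUnit R x
    κ = inv (σ₀ ⊙ σ₁ ⊙ σ₂ ⊙ σ₃ ⊙ p)

  s : Fin 8 → Carrier
  s z = proj₁ (σ z)

  s-unit : ∀ z → IsUnit R (s z)
  s-unit z = proj₂ (σ z)

  open Rescaling s (proj₁ κ)

  private
    k b : Carrier
    k = proj₁ κ
    b = proj₁ p

    normalised : k * (s 0F * s 1F * s 2F * s 3F) * b ≈ 1#
    normalised = ≈-trans (*-assoc k _ b) (proj₁ (proj₂ (proj₂ (σ₀ ⊙ σ₁ ⊙ σ₂ ⊙ σ₃ ⊙ p))))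

    -- Replacing the letter 0 of [0123] multiplies the weight by x / s 0; if x · e equals s 0 ·
    -- [0123], the rescaled bracket keeps the value 1 that `k` gives to [0123]. The next three
    -- lemmas do the same at the other positions.
    at₀ : ∀ {x e} → x * e ≈ s 0F * b → k * (x * s 1F * s 2F * s 3F) * e ≈ 1#
    at₀ {x} {e} xe≈ = ≈-trans (swap x e) (≈-trans (*-congʳ xe≈) (≈-trans (≈-sym (swap (s 0F) b)) normalised))
      where
      swap : ∀ x e → k * (x * s 1F * s 2F * s 3F) * e ≈ x * e * (k * (s 1F * s 2F * s 3F))
      swap x e = solve 6 (λ k x y z w e → k :* (x :* y :* z :* w) :* e := x :* e :* (k :* (y :* z :* w))) ≈-refl k x (s 1F) (s 2F) (s 3F) e

    at₁ : ∀ {x e} → x * e ≈ s 1F * b → k * (s 0F * x * s 2F * s 3F) * e ≈ 1#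
    at₁ {x} {e} xe≈ = ≈-trans (swap x e) (≈-trans (*-congʳ xe≈) (≈-trans (≈-sym (swap (s 1F) b)) normalised))
      where
      swap : ∀ x e → k * (s 0F * x * s 2F * s 3F) * e ≈ x * e * (k * (s 0F * s 2F * s 3F))
      swap x e = solve 6 (λ k x y z w e → k :* (y :* x :* z :* w) :* e := x :* e :* (k :* (y :* z :* w))) ≈-refl k x (s 0F) (s 2F) (s 3F) e

    at₂ : ∀ {x e} → x * e ≈ s 2F * b → k * (s 0F * s 1F * x * s 3F) * e ≈ 1#
    at₂ {x} {e} xe≈ = ≈-trans (swap x e) (≈-trans (*-congʳ xe≈) (≈-trans (≈-sym (swap (s 2F) b)) normalised))
      where
      swap : ∀ x e → k * (s 0F * s 1F * x * s 3F) * e ≈ x * e * (k * (s 0F * s 1F * s 3F))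
      swap x e = solve 6 (λ k x y z w e → k :* (y :* z :* x :* w) :* e := x :* e :* (k :* (y :* z :* w))) ≈-refl k x (s 0F) (s 1F) (s 3F) e

    at₃ : ∀ {x e} → x * e ≈ s 3F * b → k * (s 0F * s 1F * s 2F * x) * e ≈ 1#
    at₃ {x} {e} xe≈ = ≈-trans (swap x e) (≈-trans (*-congʳ xe≈) (≈-trans (≈-sym (swap (s 3F) b)) normalised))
      where
      swap : ∀ x e → k * (s 0F * s 1F * s 2F * x) * e ≈ x * e * (k * (s 0F * s 1F * s 2F))
      swap x e = solve 6 (λ k x y z w e → k :* (y :* z :* w :* x) :* e := x :* e :* (k :* (y :* z :* w))) ≈-refl k x (s 0F) (s 1F) (s 2F) e

    rescaled-frame : All (λ Z → rescaled Z ≈ 1#) frame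
    rescaled-frame = normalised
      ∷ at₀ (cancel (s 0F) b p₀₅)
      ∷ at₀ (cancel (s 0F) b p₀₆)
      ∷ at₁ (cancel (s 1F) b p₁₄)
      -- For the edges 16, 24 and 35 the factor of the row was computed from that of the column, so
      -- the edge equation is used from right to left.
      ∷ at₁ (≈-sym (cancel (s 6F) (proj₁ p₁₆) p))
      ∷ at₁ (cancel (s 1F) b p₁₇)
      ∷ at₂ (≈-sym (cancel (s 4F) (proj₁ p₂₄) p))
      ∷ at₃ (≈-sym (cancel (s 5F) (proj₁ p₃₅) p))
      ∷ []

    weight-unit : ∀ Z → IsUnit R (k * product s Z)
    weight-unit Z = *-unit (proj₂ κ) (product-unit s s-unit Z)

    rescaled≈det₈ : ∀ Z → rescaled Z ≈ ι (det₈ Z)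
    rescaled≈det₈ = Uniqueness.F≈det₈ ι-morphism rescaled-alternating rescaled-threeTerm
      (λ Z d≡0 → ≈-trans (*-congˡ (P-zero Z d≡0)) (zeroʳ _))
      (λ Z d≢0 → *-unit (weight-unit Z) (P-unit Z d≢0))
      rescaled-frame

  -- The word 4102 is a basis of determinant 2, so 2 is a unit times the unit [4102].
  2-unit : TwoIsUnit R
  2-unit = unit-resp (≈-trans (rescaled≈det₈ (4F ∷ 1F ∷ 0F ∷ 2F ∷ [])) (≈-trans (ι-+ 1ℤ 1ℤ) (+-cong ι-1 ι-1)))
    (*-unit (weight-unit (4F ∷ 1F ∷ 0F ∷ 2F ∷ [])) (P-unit (4F ∷ 1F ∷ 0F ∷ 2F ∷ []) λ ()))

  module _ (Z : Word) where
    rowFactor : Fin 4 → Carrier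
    rowFactor i = proj₁ (weight-unit Z) * s (lookup Z i)

    columnFactor : Fin 8 → Carrier
    columnFactor v = proj₁ (s-unit v)

    rowFactor-unit : ∀ i → IsUnit R (rowFactor i)
    rowFactor-unit i = *-unit (inverse-unit (weight-unit Z)) (s-unit (lookup Z i))

    columnFactor-unit : ∀ v → IsUnit R (columnFactor v)
    columnFactor-unit v = inverse-unit (s-unit v)

    -- The weight of `Z [ i ]≔ v` is that of Z times s v / s (Z i). It splits into a part depending
    -- on i and a part depending on v, so passing from brackets to determinants is a row and column
    -- scaling.
    factors : ∀ i v → P (Z [ i ]≔ v) ≈ rowFactor i * columnFactor v * ι (det₈ (Z [ i ]≔ v))
    factors i v = *-cancelʳ-unit (weight-unit (Z [ i ]≔ v)) (begin
      x * (k * product s (Z [ i ]≔ v))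
        ≈⟨ *-comm x _ ⟩
      rescaled (Z [ i ]≔ v)
        ≈⟨ rescaled≈det₈ (Z [ i ]≔ v) ⟩
      δ
        ≈⟨ ≈-sym (≈-trans (*-congʳ (≈-trans (*-cong (*-cong w⁻¹w zz⁻¹) v⁻¹v) (≈-trans (*-identityʳ _) (*-identityʳ 1#)))) (*-identityˡ δ)) ⟩
      (w⁻¹ * (k * π)) * (z * z⁻¹) * (v⁻¹ * s v) * δ
        ≈⟨ solve 8 (λ w k π z z′ v v′ δ → (w :* (k :* π)) :* (z :* z′) :* (v′ :* v) :* δ := (w :* z) :* v′ :* δ :* (k :* (π :* z′ :* v)))
             ≈-refl w⁻¹ k π z z⁻¹ (s v) v⁻¹ δ ⟩
      (w⁻¹ * z) * v⁻¹ * δ * (k * (π * z⁻¹ * s v))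
        ≈⟨ *-congˡ (*-congˡ (≈-sym (product-update s s-unit Z i v))) ⟩
      (w⁻¹ * z) * v⁻¹ * δ * (k * product s (Z [ i ]≔ v)) ∎)
      where
      x δ π w⁻¹ z z⁻¹ v⁻¹ : Carrier
      x = P (Z [ i ]≔ v)
      δ = ι (det₈ (Z [ i ]≔ v))
      π = product s Z
      w⁻¹ = proj₁ (weight-unit Z)
      z = s (lookup Z i)
      z⁻¹ = proj₁ (s-unit (lookup Z i))
      v⁻¹ = proj₁ (s-unit v)
      w⁻¹w = proj₁ (proj₂ (weight-unit Z))
      zz⁻¹ = proj₂ (proj₂ (s-unit (lookup Z i)))
      v⁻¹v = proj₁ (proj₂ (s-unit v))

    bracket-factors : ∀ y i v → P (Z [ i ]≔ v) * y ≈ rowFactor i * y * columnFactor v * ι (det₈ (Z [ i ]≔ v))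
    bracket-factors y i v = ≈-trans (*-congʳ (factors i v))
      (solve 4 (λ r c d y → r :* c :* d :* y := r :* y :* c :* d) ≈-refl
        (rowFactor i) (columnFactor v) (ι (det₈ (Z [ i ]≔ v))) y)

-- Matrices below A_{M,B} and their cross ratios.

module Tameness {R : Ring} (ι-morphism : IntegerMorphism R)
    (1≉0 : Nontrivial R) (2-unit : TwoIsUnit R) where
  open CommutativeRing R hiding (zero) renaming (refl to ≈-refl; sym to ≈-sym; trans to ≈-trans)
  open Integers ι-morphism
  open Units R
  open SetoidReasoning setoid

  IsGenerator : Carrier → Set
  IsGenerator x = x ≈ - 1# ⊎ x ≈ 1# + 1#

  Dyadic : Carrier → Set
  Dyadic = SubgroupGeneratedBy R IsGenerator

  dyadic-unit : ∀ {x} → Dyadic x → IsUnit R x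
  dyadic-unit = PartialField.G-units (partialField R IsGenerator (inj₁ ≈-refl))

  nonzero-unit : ∀ {x} → IsUnit R x → ¬ x ≈ 0#
  nonzero-unit {x} (x′ , x′x , _) x≈0 =
    1≉0 (≈-trans (≈-sym x′x) (≈-trans (*-congˡ x≈0) (zeroʳ x′)))

  ι-2^ : ∀ k → Dyadic (ι (+ (2 ℕ.^ k)))
  ι-2^ zero    = resp-≈ (≈-sym ι-1) 1#∈
  ι-2^ (suc k) = resp-≈ (≈-sym eq) (*-∈ (gen (inj₂ ≈-refl) 2-unit) (ι-2^ k))
    where
    eq : ι (+ (2 ℕ.^ suc k)) ≈ (1# + 1#) * ι (+ (2 ℕ.^ k))
    eq = ≈-trans (ι-cong (ℤ.pos-* 2 (2 ℕ.^ k))) (≈-trans (ι-* (+ 2) (+ (2 ℕ.^ k)))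
      (*-congʳ (≈-trans (ι-+ 1ℤ 1ℤ) (+-cong ι-1 ι-1))))

  ι-neg-dyadic : ∀ {i} → Dyadic (ι i) → Dyadic (ι (ℤ.- i))
  ι-neg-dyadic {i} d = resp-≈ eq (*-∈ (gen (inj₁ ≈-refl) (isUnit -1*-1≈1)) d)
    where
    eq : - 1# * ι i ≈ ι (ℤ.- i)
    eq = ≈-trans (*-congʳ (-‿cong (≈-sym ι-1)))
      (≈-trans (solve 1 (λ x → :- con 1ℤ :* x := :- x) ≈-refl (ι i)) (≈-sym (ι-neg i)))
    -1*-1≈1 : - 1# * - 1# ≈ 1#
    -1*-1≈1 = ≈-trans (*-cong (-‿cong (≈-sym ι-1)) (-‿cong (≈-sym ι-1)))
      (≈-trans (solve 0 (:- con 1ℤ :* :- con 1ℤ := con 1ℤ) ≈-refl) ι-1)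

  δ : Word → Carrier
  δ Z = ι (det₈ Z)

  δ-zero : ∀ Z → det₈ Z ≡ 0ℤ → δ Z ≈ 0#
  δ-zero Z d≡0 = ≈-trans (ι-cong d≡0) ι-0

  δ-dyadic : ∀ Z → det₈ Z ≡ 0ℤ ⊎ Dyadic (δ Z)
  δ-dyadic Z with det₈-isDyadic Z
  ... | inj₁ d≡0                = inj₁ d≡0
  ... | inj₂ (k , inj₁ d≡2^k)  = inj₂ (resp-≈ (ι-cong (sym d≡2^k)) (ι-2^ (toℕ k)))
  ... | inj₂ (k , inj₂ d≡-2^k) = inj₂ (resp-≈ (ι-cong (sym d≡-2^k)) (ι-neg-dyadic (ι-2^ (toℕ k))))

  δ-unit : ∀ Z → det₈ Z ≢ 0ℤ → IsUnit R (δ Z)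
  δ-unit Z d≢0 with δ-dyadic Z
  ... | inj₁ d≡0 = contradiction d≡0 d≢0
  ... | inj₂ d   = dyadic-unit d

  -- Up to scaling, the matrices obtained from A_{M,B} by ⪯ are submatrices of A_{M,B′}
  -- for other bases B′, with entries given by Cramer's rule.
  record Tame {m n} (A : Matrix Carrier m n) : Set where
    field
      B           : Word
      B-basis     : det₈ B ≢ 0ℤ
      row         : Fin m → Fin 4
      row-inj     : ∀ {i j} → row i ≡ row j → i ≡ j
      label     : Fin n → Fin 8
      r           : Fin m → Carrier
      c           : Fin n → Carrier
      r-unit      : ∀ i → IsUnit R (r i)
      c-unit      : ∀ j → IsUnit R (c j)
      entry       : ∀ i j → A i j ≈ r i * c j * δ (B [ row i ]≔ label j)

  module Pivot {m n} {A : Matrix Carrier m n} (t : Tame A) (x : Fin m) (y : Fin n)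
      (A≉0 : ¬ A x y ≈ 0#) (A-unit : IsUnit R (A x y)) where
    open Tame t

    a : Carrier
    a = proj₁ A-unit

    aA≈1 : a * A x y ≈ 1#
    aA≈1 = proj₁ (proj₂ A-unit)

    B⁺ : Word
    B⁺ = B [ row x ]≔ label y

    B⁺-basis : det₈ B⁺ ≢ 0ℤ
    B⁺-basis d≡0 = A≉0 (≈-trans (entry x y) (≈-trans (*-congˡ (δ-zero B⁺ d≡0)) (zeroʳ _)))

    β d e ρ : Carrier
    β = δ B
    d = δ B⁺
    e = proj₁ (δ-unit B⁺ B⁺-basis)
    ρ = proj₁ (r-unit x)
    β⁻¹ : Carrier
    β⁻¹ = proj₁ (δ-unit B B-basis)

    -- Column y receives the element that leaves the basis. By `det₈-pivot` an entry outside the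
    -- pivot row and column acquires β / d, which is put into the row factor; the factor ρ β⁻¹ of
    -- column y then compensates β there, and row x keeps its determinants and is scaled by a alone.
    column⁺ : Fin n → Fin 8
    column⁺ = Vector.updateAt label y (const (lookup B (row x)))
    r⁺ : Fin m → Carrier
    r⁺ = Vector.updateAt (λ u → r u * β * e) x (const (a * r x))
    c⁺ : Fin n → Carrier
    c⁺ = Vector.updateAt c y (const (ρ * β⁻¹))

    -- The pivot entry is r x · c y · d and `a` is its inverse.
    a*c≈ρ*e : a * c y ≈ ρ * e
    a*c≈ρ*e = *-cancelʳ-unit (r-unit x) (*-cancelʳ-unit (δ-unit B⁺ B⁺-basis) (begin
      a * c y * r x * d      ≈⟨ solve 4 (λ a c r d → a :* c :* r :* d := a :* (r :* c :* d)) ≈-refl a (c y) (r x) d ⟩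
      a * (r x * c y * d)    ≈⟨ *-congˡ (≈-sym (entry x y)) ⟩
      a * A x y              ≈⟨ aA≈1 ⟩
      1#                     ≈⟨ ≈-sym (*-identityˡ 1#) ⟩
      1# * 1#                ≈⟨ *-cong (≈-sym (proj₁ (proj₂ (r-unit x)))) (≈-sym (proj₁ (proj₂ (δ-unit B⁺ B⁺-basis)))) ⟩
      (ρ * r x) * (e * d)    ≈⟨ solve 4 (λ ρ r e d → (ρ :* r) :* (e :* d) := ρ :* e :* r :* d) ≈-refl ρ (r x) e d ⟩
      ρ * e * r x * d        ∎))

    δ⁺ : Fin m → Fin 8 → Carrier
    δ⁺ u v = δ (B⁺ [ row u ]≔ v)

    corner : a ≈ a * r x * (ρ * β⁻¹) * δ⁺ x (lookup B (row x))
    corner = ≈-sym (begin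
      a * r x * (ρ * β⁻¹) * δ⁺ x (lookup B (row x))
        ≈⟨ *-congˡ (ι-cong (cong det₈ (trans (Vec.[]≔-idempotent B (row x)) (Vec.[]≔-lookup B (row x))))) ⟩
      a * r x * (ρ * β⁻¹) * β
        ≈⟨ solve 5 (λ a r ρ b β → a :* r :* (ρ :* b) :* β := a :* ((ρ :* r) :* (b :* β))) ≈-refl a (r x) ρ β⁻¹ β ⟩
      a * ((ρ * r x) * (β⁻¹ * β))
        ≈⟨ *-congˡ (*-cong (proj₁ (proj₂ (r-unit x))) (proj₁ (proj₂ (δ-unit B B-basis)))) ⟩
      a * (1# * 1#)
        ≈⟨ ≈-trans (*-congˡ (*-identityˡ 1#)) (*-identityʳ a) ⟩
      a ∎)

    pivotRow : ∀ v → a * A x v ≈ a * r x * c v * δ⁺ x (label v)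
    pivotRow v = begin
      a * A x v                                           ≈⟨ *-congˡ (entry x v) ⟩
      a * (r x * c v * δ (B [ row x ]≔ label v))        ≈⟨ *-congˡ (*-congˡ (ι-cong (cong det₈ (sym (Vec.[]≔-idempotent B (row x)))))) ⟩
      a * (r x * c v * δ⁺ x (label v))                  ≈⟨ solve 4 (λ a r c z → a :* (r :* c :* z) := a :* r :* c :* z) ≈-refl a (r x) (c v) _ ⟩
      a * r x * c v * δ⁺ x (label v)                    ∎

    pivotColumn : ∀ {u} → u ≢ x → - (a * A u y) ≈ r u * β * e * (ρ * β⁻¹) * δ⁺ u (lookup B (row x))
    pivotColumn {u} u≢x = begin
      - (a * A u y)
        ≈⟨ -‿cong (*-congˡ (entry u y)) ⟩
      - (a * (r u * c y * z))
        ≈⟨ solve 4 (λ a r c z → :- (a :* (r :* c :* z)) := a :* c :* (r :* (:- z))) ≈-refl a (r u) (c y) z ⟩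
      a * c y * (r u * - z)
        ≈⟨ *-cong a*c≈ρ*e (*-congˡ (≈-sym exchange)) ⟩
      ρ * e * (r u * z⁺)
        ≈⟨ ≈-sym (*-identityʳ _) ⟩
      ρ * e * (r u * z⁺) * 1#
        ≈⟨ *-congˡ (≈-sym (proj₁ (proj₂ (δ-unit B B-basis)))) ⟩
      ρ * e * (r u * z⁺) * (β⁻¹ * β)
        ≈⟨ solve 6 (λ ρ e r z b β → ρ :* e :* (r :* z) :* (b :* β) := r :* β :* e :* (ρ :* b) :* z) ≈-refl ρ e (r u) z⁺ β⁻¹ β ⟩
      r u * β * e * (ρ * β⁻¹) * z⁺ ∎
      where
      z = δ (B [ row u ]≔ label y)
      z⁺ = δ⁺ u (lookup B (row x))
      exchange : z⁺ ≈ - z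
      exchange = ≈-trans (ι-cong (det₈-exchange (λ eq → u≢x (sym (row-inj eq))) B (label y))) (ι-neg _)

    elsewhere : ∀ {u} v → u ≢ x → A u v - a * A u y * A x v ≈ r u * β * e * c v * δ⁺ u (label v)
    elsewhere {u} v u≢x = begin
      A u v - a * A u y * A x v
        ≈⟨ +-cong (entry u v) (-‿cong (*-cong (*-congˡ (entry u y)) (entry x v))) ⟩
      r u * c v * zuv - a * (r u * c y * zuy) * (r x * c v * zxv)
        -- The coefficient 1 in front of `zuv` is made explicit so that the next step can replace it
        -- by `e * d`.
        ≈⟨ solve 8 (λ ru cv zuv a cy zuy rx zxv →
             ru :* cv :* zuv :- a :* (ru :* cy :* zuy) :* (rx :* cv :* zxv) :=
             ru :* cv :* (con 1ℤ :* zuv :- a :* cy :* rx :* (zuy :* zxv))) ≈-refl (r u) (c v) zuv a (c y) zuy (r x) zxv ⟩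
      r u * c v * (ι 1ℤ * zuv - a * c y * r x * (zuy * zxv))
        ≈⟨ *-congˡ (+-cong (*-congʳ (≈-trans ι-1 (≈-sym (proj₁ (proj₂ (δ-unit B⁺ B⁺-basis))))))
             (-‿cong (*-congʳ (≈-trans (*-congʳ a*c≈ρ*e) ρer≈e)))) ⟩
      r u * c v * (e * d * zuv - e * (zuy * zxv))
        ≈⟨ solve 7 (λ ru cv e d zuv zuy zxv →
             ru :* cv :* (e :* d :* zuv :- e :* (zuy :* zxv)) :=
             ru :* cv :* e :* (d :* zuv :- zuy :* zxv)) ≈-refl (r u) (c v) e d zuv zuy zxv ⟩
      r u * c v * e * (d * zuv - zuy * zxv)
        ≈⟨ *-congˡ (≈-sym plücker) ⟩
      r u * c v * e * (β * z⁺)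
        ≈⟨ solve 5 (λ ru cv e β z → ru :* cv :* e :* (β :* z) := ru :* β :* e :* cv :* z) ≈-refl (r u) (c v) e β z⁺ ⟩
      r u * β * e * c v * z⁺ ∎
      where
      zuv = δ (B [ row u ]≔ label v)
      zuy = δ (B [ row u ]≔ label y)
      zxv = δ (B [ row x ]≔ label v)
      z⁺ = δ⁺ u (label v)
      ρer≈e : ρ * e * r x ≈ e
      ρer≈e = ≈-trans (solve 3 (λ ρ e r → ρ :* e :* r := (ρ :* r) :* e) ≈-refl ρ e (r x))
        (≈-trans (*-congʳ (proj₁ (proj₂ (r-unit x)))) (*-identityˡ e))
      plücker : β * z⁺ ≈ d * zuv - zuy * zxv
      plücker = begin
        β * z⁺                 ≈⟨ ≈-sym (ι-* _ _) ⟩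
        ι (det₈ B ℤ.* det₈ (B⁺ [ row u ]≔ label v))
          ≈⟨ ι-cong (det₈-pivot (λ eq → u≢x (sym (row-inj eq))) B (label y) (label v)) ⟩
        ι _                    ≈⟨ ι-+ _ _ ⟩
        ι _ + ι (ℤ.- _)        ≈⟨ +-cong (ι-* _ _) (≈-trans (ι-neg _) (-‿cong (ι-* _ _))) ⟩
        d * zuv - zuy * zxv    ∎

    entry⁺ : ∀ u v → pivot R A x y a u v ≈ r⁺ u * c⁺ v * δ⁺ u (column⁺ v)
    entry⁺ u v with u Fin.≟ x | v Fin.≟ y
    ... | yes refl | yes refl
      rewrite Vector.updateAt-updates u {const (a * r u)} (λ u → r u * β * e)
            | Vector.updateAt-updates v {const (ρ * β⁻¹)} c
            | Vector.updateAt-updates v {const (lookup B (row u))} label = corner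
    ... | yes refl | no v≢y
      rewrite Vector.updateAt-updates u {const (a * r u)} (λ u → r u * β * e)
            | Vector.updateAt-minimal v y {const (ρ * β⁻¹)} c v≢y
            | Vector.updateAt-minimal v y {const (lookup B (row u))} label v≢y = pivotRow v
    ... | no u≢x | yes refl
      rewrite Vector.updateAt-minimal u x {const (a * r x)} (λ u → r u * β * e) u≢x
            | Vector.updateAt-updates v {const (ρ * β⁻¹)} c
            | Vector.updateAt-updates v {const (lookup B (row x))} label = pivotColumn u≢x
    ... | no u≢x | no v≢y
      rewrite Vector.updateAt-minimal u x {const (a * r x)} (λ u → r u * β * e) u≢x
            | Vector.updateAt-minimal v y {const (ρ * β⁻¹)} c v≢y
            | Vector.updateAt-minimal v y {const (lookup B (row x))} label v≢y = elsewhere v u≢x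

    updateAt-unit : ∀ {k} (f : Fin k → Carrier) i {z} → (∀ j → IsUnit R (f j)) → IsUnit R z →
      ∀ j → IsUnit R (Vector.updateAt f i (const z) j)
    updateAt-unit f i {z} f-unit z-unit j with j Fin.≟ i
    ... | yes refl rewrite Vector.updateAt-updates j {const z} f = z-unit
    ... | no j≢i rewrite Vector.updateAt-minimal j i {const z} f j≢i = f-unit j

    tame-pivot : Tame (pivot R A x y a)
    tame-pivot = record
      { B = B⁺ ; B-basis = B⁺-basis ; row = row ; row-inj = row-inj ; label = column⁺
      ; r = r⁺ ; c = c⁺
      ; r-unit = updateAt-unit _ x
          (λ u → *-unit (*-unit (r-unit u) (δ-unit B B-basis)) (inverse-unit (δ-unit B⁺ B⁺-basis)))
          (*-unit (isUnit aA≈1) (r-unit x))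
      ; c-unit = updateAt-unit c y c-unit (*-unit (inverse-unit (r-unit x)) (inverse-unit (δ-unit B B-basis)))
      ; entry = entry⁺
      }

  tame-⪯ : ∀ {m n m′ n′} {A : Matrix Carrier m n} {A′ : Matrix Carrier m′ n′} → _⪯_ R A′ A → Tame A → Tame A′
  tame-⪯ (equal A′≈A) t = record
    { Tame t ; entry = λ i j → ≈-trans (A′≈A i j) (Tame.entry t i j) }
  tame-⪯ (transitive A″⪯A′ A′⪯A) t = tame-⪯ A″⪯A′ (tame-⪯ A′⪯A t)
  tame-⪯ (scaleRows s s-unit) t = record
    { Tame t
    ; r = λ i → s i * r i
    ; r-unit = λ i → *-unit (s-unit i) (r-unit i)
    ; entry = λ i j → ≈-trans (*-congˡ (entry i j))
        (solve 4 (λ s r c z → s :* (r :* c :* z) := s :* r :* c :* z) ≈-refl (s i) (r i) (c j) _)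
    }
    where open Tame t
  tame-⪯ (scaleColumns s s-unit) t = record
    { Tame t
    ; c = λ j → c j * s j
    ; c-unit = λ j → *-unit (c-unit j) (s-unit j)
    ; entry = λ i j → ≈-trans (*-congʳ (entry i j))
        (solve 4 (λ s r c z → r :* c :* z :* s := r :* (c :* s) :* z) ≈-refl (s j) (r i) (c j) _)
    }
    where open Tame t
  tame-⪯ (deleteRow x) t = record
    { Tame t
    ; row = row ∘ punchIn x ; row-inj = Fin.punchIn-injective x _ _ ∘ row-inj
    ; r = r ∘ punchIn x ; r-unit = r-unit ∘ punchIn x
    ; entry = entry ∘ punchIn x
    }
    where open Tame t
  tame-⪯ (deleteColumn y) t = record
    { Tame t
    ; label = label ∘ punchIn y ; c = c ∘ punchIn y ; c-unit = c-unit ∘ punchIn y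
    ; entry = λ i j → entry i (punchIn y j)
    }
    where open Tame t
  tame-⪯ (permuteRows σ) t = record
    { Tame t
    ; row = row ∘ (σ ⟨$⟩ʳ_) ; row-inj = permutation-injective σ ∘ row-inj
    ; r = r ∘ (σ ⟨$⟩ʳ_) ; r-unit = r-unit ∘ (σ ⟨$⟩ʳ_)
    ; entry = entry ∘ (σ ⟨$⟩ʳ_)
    }
    where open Tame t
  tame-⪯ (permuteColumns σ) t = record
    { Tame t
    ; label = label ∘ (σ ⟨$⟩ʳ_) ; c = c ∘ (σ ⟨$⟩ʳ_) ; c-unit = c-unit ∘ (σ ⟨$⟩ʳ_)
    ; entry = λ i j → entry i (σ ⟨$⟩ʳ j)
    }
    where open Tame t
  tame-⪯ (pivotOn x y A≉0 u) t = Pivot.tame-pivot t x y A≉0 u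

  quotient-dyadic : ∀ {p x y} → Dyadic y → p * y ≈ x → Dyadic x → Dyadic p
  quotient-dyadic {p} {x} {y} y-dyadic py≈x x-dyadic =
    resp-≈ (*-cancelʳ-unit (dyadic-unit y-dyadic) (begin
      x * y′ * y    ≈⟨ ≈-trans (*-assoc x y′ y) (≈-trans (*-congˡ y′y≈1) (*-identityʳ x)) ⟩
      x             ≈⟨ ≈-sym py≈x ⟩
      p * y         ∎)) (*-∈ x-dyadic (inv-∈ yy′≈1 y-dyadic))
    where
    y′ = proj₁ (dyadic-unit y-dyadic)
    y′y≈1 = proj₁ (proj₂ (dyadic-unit y-dyadic))
    yy′≈1 = proj₂ (proj₂ (dyadic-unit y-dyadic))

  -- The row and column factors cancel in the ratio of the two diagonal products, so p = d₀₁ d₁₀ /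
  -- (d₀₀ d₁₁). The diagonal entries are 1, hence nonzero in a nontrivial ring, and nonzero
  -- determinants are dyadic.
  tame-crossRatio : ∀ {p} → Tame (crossRatioMatrix R p) → p ≈ 0# ⊎ Dyadic p
  tame-crossRatio {p} t = conclude (δ-dyadic (Z 0F 0F)) (δ-dyadic (Z 0F 1F)) (δ-dyadic (Z 1F 0F)) (δ-dyadic (Z 1F 1F))
    where
    open Tame t
    Z : Fin 2 → Fin 2 → Word
    Z i j = B [ row i ]≔ label j
    pd≈d : p * (δ (Z 0F 0F) * δ (Z 1F 1F)) ≈ δ (Z 0F 1F) * δ (Z 1F 0F)
    pd≈d = begin
      p * (d₀₀ * d₁₁)
        ≈⟨ ≈-trans (≈-sym (*-identityʳ _)) (*-congˡ (entry 0F 1F)) ⟩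
      p * (d₀₀ * d₁₁) * (r 0F * c 1F * d₀₁)
        ≈⟨ *-congʳ (*-congʳ (entry 1F 0F)) ⟩
      r 1F * c 0F * d₁₀ * (d₀₀ * d₁₁) * (r 0F * c 1F * d₀₁)
        ≈⟨ solve 8 (λ r₀ r₁ c₀ c₁ d₀₀ d₀₁ d₁₀ d₁₁ →
             r₁ :* c₀ :* d₁₀ :* (d₀₀ :* d₁₁) :* (r₀ :* c₁ :* d₀₁) :=
             (r₀ :* c₀ :* d₀₀) :* (r₁ :* c₁ :* d₁₁) :* (d₀₁ :* d₁₀)) ≈-refl (r 0F) (r 1F) (c 0F) (c 1F) d₀₀ d₀₁ d₁₀ d₁₁ ⟩
      (r 0F * c 0F * d₀₀) * (r 1F * c 1F * d₁₁) * (d₀₁ * d₁₀)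
        ≈⟨ *-congʳ (*-cong (≈-sym (entry 0F 0F)) (≈-sym (entry 1F 1F))) ⟩
      1# * 1# * (d₀₁ * d₁₀)
        ≈⟨ ≈-trans (*-congʳ (*-identityˡ 1#)) (*-identityˡ _) ⟩
      d₀₁ * d₁₀ ∎
      where
      d₀₀ = δ (Z 0F 0F)
      d₀₁ = δ (Z 0F 1F)
      d₁₀ = δ (Z 1F 0F)
      d₁₁ = δ (Z 1F 1F)
    1≉rc0 : ∀ z {i j} → 1# ≈ r i * c j * δ z → ¬ det₈ z ≡ 0ℤ
    1≉rc0 z 1≈rcd d≡0 = 1≉0 (≈-trans 1≈rcd (≈-trans (*-congˡ (δ-zero z d≡0)) (zeroʳ _)))
    vanish : ∀ {x y} → Dyadic y → p * y ≈ x → x ≈ 0# → p ≈ 0#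
    vanish {x} {y} y-dyadic py≈x x≈0 = *-cancelʳ-unit (dyadic-unit y-dyadic)
      (≈-trans py≈x (≈-trans x≈0 (≈-sym (zeroˡ y))))
    conclude : det₈ (Z 0F 0F) ≡ 0ℤ ⊎ Dyadic (δ (Z 0F 0F)) → det₈ (Z 0F 1F) ≡ 0ℤ ⊎ Dyadic (δ (Z 0F 1F)) →
               det₈ (Z 1F 0F) ≡ 0ℤ ⊎ Dyadic (δ (Z 1F 0F)) → det₈ (Z 1F 1F) ≡ 0ℤ ⊎ Dyadic (δ (Z 1F 1F)) →
               p ≈ 0# ⊎ Dyadic p
    conclude (inj₁ d₀₀≡0) _ _ _ = contradiction d₀₀≡0 (1≉rc0 (Z 0F 0F) {0F} {0F} (entry 0F 0F))
    conclude _ _ _ (inj₁ d₁₁≡0) = contradiction d₁₁≡0 (1≉rc0 (Z 1F 1F) {1F} {1F} (entry 1F 1F))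
    conclude (inj₂ d₀₀) (inj₁ d₀₁≡0) _ (inj₂ d₁₁) =
      inj₁ (vanish (*-∈ d₀₀ d₁₁) pd≈d (≈-trans (*-congʳ (δ-zero (Z 0F 1F) d₀₁≡0)) (zeroˡ _)))
    conclude (inj₂ d₀₀) (inj₂ d₀₁) (inj₁ d₁₀≡0) (inj₂ d₁₁) =
      inj₁ (vanish (*-∈ d₀₀ d₁₁) pd≈d (≈-trans (*-congˡ (δ-zero (Z 1F 0F) d₁₀≡0)) (zeroʳ _)))
    conclude (inj₂ d₀₀) (inj₂ d₀₁) (inj₂ d₁₀) (inj₂ d₁₁) =
      inj₂ (quotient-dyadic (*-∈ d₀₀ d₁₁) pd≈d (*-∈ d₀₁ d₁₀))

-- One half is a cross ratio.

dets : ∀ {n} → Word → (Fin n → Fin 8) → Matrix ℤ 4 n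
dets B g i j = det₈ (B [ i ]≔ g j)

-- The ratio of the two diagonal products is unchanged by row and column scaling, so the value ½ can
-- be recognised on integer determinants. Exchanging both rows and both columns preserves the
-- condition, which allows the search to assume j₁ < j₂.
HasHalf : ∀ {m n} → Matrix ℤ m n → Set
HasHalf D = ∃[ i₁ ] ∃[ j₁ ] D i₁ j₁ ≢ 0ℤ × ∃[ i₂ ] ∃[ j₂ ] i₁ ≢ i₂ × j₁ Fin.< j₂ × D i₂ j₂ ≢ 0ℤ ×
  + 2 ℤ.* (D i₁ j₂ ℤ.* D i₂ j₁) ≡ D i₁ j₁ ℤ.* D i₂ j₂

hasHalf? : ∀ {m n} (D : Matrix ℤ m n) → Dec (HasHalf D)
hasHalf? D = Fin.any? λ i₁ → Fin.any? λ j₁ → ¬? (D i₁ j₁ ℤ.≟ 0ℤ) ×-dec (Fin.any? λ i₂ → Fin.any? λ j₂ →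
  ¬? (i₁ Fin.≟ i₂) ×-dec ((j₁ Fin.<? j₂) ×-dec (¬? (D i₂ j₂ ℤ.≟ 0ℤ) ×-dec (_ ℤ.≟ _))))

nonElements : (B : Word) → Fin ∣ ∁ (entries B) ∣ → Fin 8
nonElements B = lookup (elements (∁ (entries B)))

-- The new basis and the updated labels are exactly those of `Pivot`, so a witness found here
-- applies directly to `tame-pivot`.
PivotHasHalf : Word → Set
PivotHasHalf B = ∃[ x ] ∃[ y ] det₈ (B [ x ]≔ nonElements B y) ≢ 0ℤ ×
  HasHalf (dets (B [ x ]≔ nonElements B y) (Vector.updateAt (nonElements B) y (const (lookup B x))))

pivotHasHalf? : ∀ B → Dec (PivotHasHalf B)
pivotHasHalf? B = Fin.any? λ x → Fin.any? λ y → ¬? (_ ℤ.≟ _) ×-dec hasHalf? (dets (B [ x ]≔ nonElements B y) (Vector.updateAt (nonElements B) y (const (lookup B x))))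

abstract
  pivot-hasHalf : ∀ B → det₈ B ≢ 0ℤ → PivotHasHalf B
  pivot-hasHalf = toWitness {a? = allWords? λ B → ¬? (det₈ B ℤ.≟ 0ℤ) →-dec pivotHasHalf? B} _

-- An injection from two points is the identity or the reversal of `Fin 2` followed by maps
-- `punchIn`: as long as n ≥ 3 some index outside the image can be removed. It lets the selection of
-- two rows or columns be built from the deletions and permutations of `⪯`.
pairInduction : (C : ∀ {n} → (Fin 2 → Fin n) → Set) →
  (∀ {n} {f g : Fin 2 → Fin n} → (∀ i → f i ≡ g i) → C f → C g) →
  C (λ i → i) → C (Perm.reverse {2} ⟨$⟩ʳ_) →
  (∀ {n} x (f : Fin 2 → Fin n) → C f → C (punchIn x ∘ f)) →
  ∀ {n} (f : Fin 2 → Fin n) → f 0F ≢ f 1F → C f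
pairInduction C resp identity reversed punch {0} f f₀≢f₁ with () ← f 0F
pairInduction C resp identity reversed punch {1} f f₀≢f₁ with f 0F | f 1F
... | 0F | 0F = contradiction refl f₀≢f₁
pairInduction C resp identity reversed punch {2} f f₀≢f₁ with f 0F in f₀ | f 1F in f₁
... | 0F | 0F = contradiction refl f₀≢f₁
... | 1F | 1F = contradiction refl f₀≢f₁
... | 0F | 1F = resp (λ { 0F → sym f₀ ; 1F → sym f₁ }) identity
... | 1F | 0F = resp (λ { 0F → sym f₀ ; 1F → sym f₁ }) reversed
pairInduction C resp identity reversed punch {suc (suc (suc n))} f f₀≢f₁ =
  resp f≗ (punch x f⁻ (pairInduction C resp identity reversed punch f⁻ f⁻₀≢f⁻₁))
  where
  third : ∀ i j → ∃[ k ] k ≢ i × k ≢ j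
  third zero          zero          = 1F , (λ ()) , λ ()
  third zero          (suc zero)    = 2F , (λ ()) , λ ()
  third zero          (suc (suc _)) = 1F , (λ ()) , λ ()
  third (suc zero)    zero          = 2F , (λ ()) , λ ()
  third (suc (suc _)) zero          = 1F , (λ ()) , λ ()
  third (suc _)       (suc _)       = 0F , (λ ()) , λ ()
  x : Fin (suc (suc (suc n)))
  x = proj₁ (third (f 0F) (f 1F))
  x≢f : ∀ i → x ≢ f i
  x≢f 0F = proj₁ (proj₂ (third (f 0F) (f 1F)))
  x≢f 1F = proj₂ (proj₂ (third (f 0F) (f 1F)))
  f⁻ : Fin 2 → Fin (suc (suc n))
  f⁻ i = punchOut (x≢f i)
  f≗ : ∀ i → punchIn x (f⁻ i) ≡ f i
  f≗ i = Fin.punchIn-punchOut (x≢f i)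
  f⁻₀≢f⁻₁ : f⁻ 0F ≢ f⁻ 1F
  f⁻₀≢f⁻₁ eq = f₀≢f₁ (Fin.punchOut-injective (x≢f 0F) (x≢f 1F) eq)

pair : ∀ {A : Set} → A → A → Fin 2 → A
pair a b 0F = a
pair a b 1F = b

module Half {R : Ring} (ι-morphism : IntegerMorphism R)
    (1≉0 : Nontrivial R) (2-unit : TwoIsUnit R) where
  open CommutativeRing R hiding (zero) renaming (refl to ≈-refl; sym to ≈-sym; trans to ≈-trans)
  open Integers ι-morphism
  open Units R
  open Tameness ι-morphism 1≉0 2-unit
  open SetoidReasoning setoid

  infix 4 _≼_
  _≼_ : ∀ {m n m′ n′} → Matrix Carrier m′ n′ → Matrix Carrier m n → Set
  _≼_ = _⪯_ R

  selectRows : ∀ {m n} (A : Matrix Carrier m n) (f : Fin 2 → Fin m) → f 0F ≢ f 1F → (λ i j → A (f i) j) ≼ A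
  selectRows A f f₀≢f₁ = pairInduction (λ {m} f → ∀ A → (λ i j → A (f i) j) ≼ A)
    (λ f≗g C A → transitive (equal λ i j → reflexive (cong (λ i → A i j) (sym (f≗g i)))) (C A))
    (λ A → equal λ i j → ≈-refl)
    (λ A → permuteRows Perm.reverse)
    (λ x f C A → transitive (C (λ i j → A (punchIn x i) j)) (deleteRow x))
    f f₀≢f₁ A

  selectColumns : ∀ {m n} (A : Matrix Carrier m n) (f : Fin 2 → Fin n) → f 0F ≢ f 1F → (λ i j → A i (f j)) ≼ A
  selectColumns A f f₀≢f₁ = pairInduction (λ {n} f → ∀ A → (λ i j → A i (f j)) ≼ A)
    (λ f≗g C A → transitive (equal λ i j → reflexive (cong (A i) (sym (f≗g j)))) (C A))
    (λ A → equal λ i j → ≈-refl)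
    (λ A → permuteColumns Perm.reverse)
    (λ x f C A → transitive (C (λ i j → A i (punchIn x j))) (deleteColumn x))
    f f₀≢f₁ A

  ½# : Carrier
  ½# = proj₁ 2-unit

  -- In the selected 2 × 2 matrix with rows (a, b) and (c′, d), dividing the columns by a and b
  -- makes the first row (1, 1). Multiplying the second row by b / d then gives (b c′ / (a d), 1),
  -- and b c′ / (a d) = ½.
  half-crossRatio : ∀ {m n} {A : Matrix Carrier m n} (t : Tame A) →
    HasHalf (λ i j → det₈ (Tame.B t [ Tame.row t i ]≔ Tame.label t j)) → Cr R A ½#
  half-crossRatio {A = A} t (i₁ , j₁ , a≢0 , i₂ , j₂ , i₁≢i₂ , j₁<j₂ , d≢0 , 2D≡D) =
    transitive (equal scaled) (transitive (scaleRows (pair 1# (b * d⁻¹)) rows-unit)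
      (transitive (scaleColumns (pair a⁻¹ b⁻¹) columns-unit)
        (transitive (selectRows (λ i j → A i (pair j₁ j₂ j)) (pair i₁ i₂) i₁≢i₂)
          (selectColumns A (pair j₁ j₂) (Fin.<⇒≢ j₁<j₂)))))
    where
    open Tame t
    D : _ → _ → ℤ
    D i j = det₈ (B [ row i ]≔ label j)
    a b c′ d : Carrier
    a  = A i₁ j₁
    b  = A i₁ j₂
    c′ = A i₂ j₁
    d  = A i₂ j₂

    2bc≈ad : (1# + 1#) * (b * c′) ≈ a * d
    2bc≈ad = begin
      (1# + 1#) * (b * c′)
        ≈⟨ *-cong (≈-trans (+-cong (≈-sym ι-1) (≈-sym ι-1)) (≈-sym (ι-+ 1ℤ 1ℤ))) (*-cong (entry i₁ j₂) (entry i₂ j₁)) ⟩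
      ι (+ 2) * ((r i₁ * c j₂ * ι (D i₁ j₂)) * (r i₂ * c j₁ * ι (D i₂ j₁)))
        ≈⟨ solve 7 (λ t r₁ c₂ x r₂ c₁ y → t :* ((r₁ :* c₂ :* x) :* (r₂ :* c₁ :* y)) :=
             (r₁ :* c₁ :* (r₂ :* c₂)) :* (t :* (x :* y))) ≈-refl (ι (+ 2)) (r i₁) (c j₂) (ι (D i₁ j₂)) (r i₂) (c j₁) (ι (D i₂ j₁)) ⟩
      (r i₁ * c j₁ * (r i₂ * c j₂)) * (ι (+ 2) * (ι (D i₁ j₂) * ι (D i₂ j₁)))
        ≈⟨ *-congˡ (≈-trans (*-congˡ (≈-sym (ι-* _ _))) (≈-trans (≈-sym (ι-* (+ 2) _)) (≈-trans (ι-cong 2D≡D) (ι-* _ _)))) ⟩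
      (r i₁ * c j₁ * (r i₂ * c j₂)) * (ι (D i₁ j₁) * ι (D i₂ j₂))
        ≈⟨ solve 6 (λ r₁ c₁ x r₂ c₂ y → (r₁ :* c₁ :* (r₂ :* c₂)) :* (x :* y) :=
             (r₁ :* c₁ :* x) :* (r₂ :* c₂ :* y)) ≈-refl (r i₁) (c j₁) (ι (D i₁ j₁)) (r i₂) (c j₂) (ι (D i₂ j₂)) ⟩
      (r i₁ * c j₁ * ι (D i₁ j₁)) * (r i₂ * c j₂ * ι (D i₂ j₂))
        ≈⟨ ≈-sym (*-cong (entry i₁ j₁) (entry i₂ j₂)) ⟩
      a * d ∎

    entry-unit : ∀ i j → D i j ≢ 0ℤ → IsUnit R (A i j)
    entry-unit i j D≢0 = unit-resp (≈-sym (entry i j))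
      (*-unit (*-unit (r-unit i) (c-unit j)) (δ-unit (B [ row i ]≔ label j) D≢0))

    a-unit : IsUnit R a
    a-unit = entry-unit i₁ j₁ a≢0
    b-unit : IsUnit R b
    -- If `D i₁ j₂` vanished, `2D≡D` would make the product of two nonzero integers zero.
    b-unit = entry-unit i₁ j₂ λ b≡0 → [ a≢0 , d≢0 ]′ (ℤ.i*j≡0⇒i≡0∨j≡0 (D i₁ j₁)
      (trans (sym 2D≡D) (cong (λ x → + 2 ℤ.* (x ℤ.* D i₂ j₁)) b≡0)))
    d-unit : IsUnit R d
    d-unit = entry-unit i₂ j₂ d≢0
    a⁻¹ b⁻¹ d⁻¹ : Carrier
    a⁻¹ = proj₁ a-unit
    b⁻¹ = proj₁ b-unit
    d⁻¹ = proj₁ d-unit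
    aa⁻¹ : a * a⁻¹ ≈ 1#
    aa⁻¹ = proj₂ (proj₂ a-unit)
    bb⁻¹ : b * b⁻¹ ≈ 1#
    bb⁻¹ = proj₂ (proj₂ b-unit)
    dd⁻¹ : d * d⁻¹ ≈ 1#
    dd⁻¹ = proj₂ (proj₂ d-unit)

    rows-unit : ∀ i → IsUnit R (pair 1# (b * d⁻¹) i)
    rows-unit 0F = 1#-unit
    rows-unit 1F = *-unit b-unit (inverse-unit d-unit)
    columns-unit : ∀ j → IsUnit R (pair a⁻¹ b⁻¹ j)
    columns-unit 0F = inverse-unit a-unit
    columns-unit 1F = inverse-unit b-unit

    scaled : ∀ i j → crossRatioMatrix R ½# i j ≈
      pair 1# (b * d⁻¹) i * (A (pair i₁ i₂ i) (pair j₁ j₂ j) * pair a⁻¹ b⁻¹ j)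
    scaled 0F 0F = ≈-sym (≈-trans (*-identityˡ _) aa⁻¹)
    scaled 0F 1F = ≈-sym (≈-trans (*-identityˡ _) bb⁻¹)
    scaled 1F 0F = *-cancelʳ-unit 2-unit (begin
      ½# * (1# + 1#)                          ≈⟨ proj₁ (proj₂ 2-unit) ⟩
      1#                                      ≈⟨ ≈-sym (≈-trans (*-cong aa⁻¹ dd⁻¹) (*-identityˡ 1#)) ⟩
      (a * a⁻¹) * (d * d⁻¹)                   ≈⟨ solve 4 (λ a x d y → (a :* x) :* (d :* y) := (a :* d) :* (x :* y)) ≈-refl a a⁻¹ d d⁻¹ ⟩
      (a * d) * (a⁻¹ * d⁻¹)                   ≈⟨ *-congʳ (≈-sym 2bc≈ad) ⟩
      (1# + 1#) * (b * c′) * (a⁻¹ * d⁻¹)      ≈⟨ solve 5 (λ t b c x y → t :* (b :* c) :* (x :* y) := b :* y :* (c :* x) :* t) ≈-refl (1# + 1#) b c′ a⁻¹ d⁻¹ ⟩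
      b * d⁻¹ * (c′ * a⁻¹) * (1# + 1#)        ∎)
    scaled 1F 1F = ≈-sym (begin
      b * d⁻¹ * (d * b⁻¹)    ≈⟨ solve 4 (λ b x d y → b :* x :* (d :* y) := (b :* y) :* (d :* x)) ≈-refl b d⁻¹ d b⁻¹ ⟩
      (b * b⁻¹) * (d * d⁻¹)  ≈⟨ ≈-trans (*-cong bb⁻¹ dd⁻¹) (*-identityˡ 1#) ⟩
      1#                     ∎)

  basis-half-crossRatio : ∀ (Z : Word) → det₈ Z ≢ 0ℤ → {A : Matrix Carrier 4 ∣ ∁ (entries Z) ∣}
    (r : Fin 4 → Carrier) (c : Fin ∣ ∁ (entries Z) ∣ → Carrier) →
    (∀ i → IsUnit R (r i)) → (∀ j → IsUnit R (c j)) →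
    (∀ i j → A i j ≈ r i * c j * δ (Z [ i ]≔ nonElements Z j)) → Cr R A ½#
  basis-half-crossRatio Z Z-basis {A} r c r-unit c-unit entry =
    transitive (half-crossRatio tame-pivot hasHalf) (pivotOn x y (nonzero-unit A-unit) A-unit)
    where
    t : Tame A
    t = record { B = Z ; B-basis = Z-basis ; row = λ i → i ; row-inj = λ eq → eq ; label = nonElements Z
               ; r = r ; c = c ; r-unit = r-unit ; c-unit = c-unit ; entry = entry }
    x : Fin 4
    x = proj₁ (pivot-hasHalf Z Z-basis)
    y : Fin ∣ ∁ (entries Z) ∣
    y = proj₁ (proj₂ (pivot-hasHalf Z Z-basis))
    hasHalf = proj₂ (proj₂ (proj₂ (pivot-hasHalf Z Z-basis)))
    A-unit : IsUnit R (A x y)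
    A-unit = unit-resp (≈-sym (entry x y)) (*-unit (*-unit (r-unit x) (c-unit y))
      (δ-unit (Z [ x ]≔ nonElements Z y) (proj₁ (proj₂ (proj₂ (pivot-hasHalf Z Z-basis))))))
    open Pivot t x y (nonzero-unit A-unit) A-unit using (tame-pivot)

-- Dyadic fractions inside a ring in which 2 is a unit.

module Fractions {R : Ring} (ι-morphism : IntegerMorphism R)
    (1≉0 : Nontrivial R) (2-unit : TwoIsUnit R) where
  open CommutativeRing R hiding (zero) renaming (refl to ≈-refl; sym to ≈-sym; trans to ≈-trans)
  open Integers ι-morphism
  open Units R
  open Tameness ι-morphism 1≉0 2-unit
  open SetoidReasoning setoid

  2^ : ℕ → ℤ
  2^ k = + (2 ℕ.^ k)

  -- Means x = n / 2^k, with the denominator cleared. The numerator decides whether x vanishes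
  -- (`fraction-zero`), which reduces injectivity of a ring map on such elements to injectivity on
  -- integers.
  Fraction : Carrier → Set
  Fraction x = ∃[ n ] ∃[ k ] x * ι (2^ k) ≈ ι n

  ι-2^-unit : ∀ k → IsUnit R (ι (2^ k))
  ι-2^-unit k = dyadic-unit (ι-2^ k)

  ι-2^-+ : ∀ k l → ι (2^ (k ℕ.+ l)) ≈ ι (2^ k) * ι (2^ l)
  ι-2^-+ k l = ≈-trans (ι-cong (trans (cong +_ (ℕ.^-distribˡ-+-* 2 k l)) (ℤ.pos-* (2 ℕ.^ k) (2 ℕ.^ l)))) (ι-* (2^ k) (2^ l))

  fraction-resp : ∀ {x y} → x ≈ y → Fraction x → Fraction y
  fraction-resp x≈y (n , k , xk≈n) = n , k , ≈-trans (*-congʳ (≈-sym x≈y)) xk≈n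

  fraction-ι : ∀ n → Fraction (ι n)
  fraction-ι n = n , 0 , ≈-trans (*-congˡ ι-1) (*-identityʳ (ι n))

  fraction-+ : ∀ {x y} → Fraction x → Fraction y → Fraction (x + y)
  fraction-+ {x} {y} (n , k , xk≈n) (m , l , yl≈m) = n ℤ.* 2^ l ℤ.+ m ℤ.* 2^ k , k ℕ.+ l , (begin
    (x + y) * ι (2^ (k ℕ.+ l))                      ≈⟨ *-congˡ (ι-2^-+ k l) ⟩
    (x + y) * (ι (2^ k) * ι (2^ l))                 ≈⟨ solve 4 (λ x y k l → (x :+ y) :* (k :* l) := x :* k :* l :+ y :* l :* k) ≈-refl x y (ι (2^ k)) (ι (2^ l)) ⟩
    x * ι (2^ k) * ι (2^ l) + y * ι (2^ l) * ι (2^ k)  ≈⟨ +-cong (*-congʳ xk≈n) (*-congʳ yl≈m) ⟩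
    ι n * ι (2^ l) + ι m * ι (2^ k)                 ≈⟨ +-cong (≈-sym (ι-* n (2^ l))) (≈-sym (ι-* m (2^ k))) ⟩
    ι (n ℤ.* 2^ l) + ι (m ℤ.* 2^ k)                 ≈⟨ ≈-sym (ι-+ (n ℤ.* 2^ l) (m ℤ.* 2^ k)) ⟩
    ι (n ℤ.* 2^ l ℤ.+ m ℤ.* 2^ k)                   ∎)

  fraction-* : ∀ {x y} → Fraction x → Fraction y → Fraction (x * y)
  fraction-* {x} {y} (n , k , xk≈n) (m , l , yl≈m) = n ℤ.* m , k ℕ.+ l , (begin
    (x * y) * ι (2^ (k ℕ.+ l))             ≈⟨ *-congˡ (ι-2^-+ k l) ⟩
    (x * y) * (ι (2^ k) * ι (2^ l))        ≈⟨ solve 4 (λ x y k l → (x :* y) :* (k :* l) := (x :* k) :* (y :* l)) ≈-refl x y (ι (2^ k)) (ι (2^ l)) ⟩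
    (x * ι (2^ k)) * (y * ι (2^ l))        ≈⟨ *-cong xk≈n yl≈m ⟩
    ι n * ι m                              ≈⟨ ≈-sym (ι-* n m) ⟩
    ι (n ℤ.* m)                            ∎)

  fraction-neg : ∀ {x} → Fraction x → Fraction (- x)
  fraction-neg {x} f = fraction-resp (solve 1 (λ x → con -1ℤ :* x := :- x) ≈-refl x) (fraction-* (fraction-ι -1ℤ) f)

  -- Unlike Fraction, this form is symmetric under inversion.
  PowerQuotient : Carrier → Set
  PowerQuotient x = ∃[ s ] ∃[ k ] ∃[ l ] (s ℤ.* s ≡ 1ℤ) × x * ι (2^ k) ≈ ι s * ι (2^ l)

  dyadic-powerQuotient : ∀ {x} → Dyadic x → PowerQuotient x
  dyadic-powerQuotient (gen (inj₁ x≈-1) _) = -1ℤ , 0 , 0 , refl ,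
    *-congʳ (≈-trans x≈-1 (≈-trans (-‿cong (≈-sym ι-1)) (≈-sym (ι-neg 1ℤ))))
  dyadic-powerQuotient (gen (inj₂ x≈2) _) = 1ℤ , 0 , 1 , refl ,
    ≈-trans (*-comm _ _) (*-congˡ (≈-trans x≈2 (≈-trans (+-cong (≈-sym ι-1) (≈-sym ι-1)) (≈-sym (ι-+ 1ℤ 1ℤ)))))
  dyadic-powerQuotient 1#∈ = 1ℤ , 0 , 0 , refl , *-congʳ (≈-sym ι-1)
  dyadic-powerQuotient (*-∈ {x} {y} p q) with dyadic-powerQuotient p | dyadic-powerQuotient q
  ... | s , k , l , s² , xk≈sl | s′ , k′ , l′ , s′² , yk≈sl =
    s ℤ.* s′ , k ℕ.+ k′ , l ℕ.+ l′ , trans (ℤ-interchange s s′ s s′) (cong₂ ℤ._*_ s² s′²) , (begin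
    (x * y) * ι (2^ (k ℕ.+ k′))                    ≈⟨ *-congˡ (ι-2^-+ k k′) ⟩
    (x * y) * (ι (2^ k) * ι (2^ k′))               ≈⟨ interchange x y _ _ ⟩
    (x * ι (2^ k)) * (y * ι (2^ k′))               ≈⟨ *-cong xk≈sl yk≈sl ⟩
    (ι s * ι (2^ l)) * (ι s′ * ι (2^ l′))          ≈⟨ interchange _ _ _ _ ⟩
    (ι s * ι s′) * (ι (2^ l) * ι (2^ l′))          ≈⟨ *-cong (≈-sym (ι-* s s′)) (≈-sym (ι-2^-+ l l′)) ⟩
    ι (s ℤ.* s′) * ι (2^ (l ℕ.+ l′))               ∎)
    where
    open CommutativeSemigroupProperties *-commutativeSemigroup using (interchange)
    open CommutativeSemigroupProperties ℤ.*-commutativeSemigroup using () renaming (interchange to ℤ-interchange)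
  dyadic-powerQuotient (inv-∈ {x} {y} xy≈1 p) with dyadic-powerQuotient p
  ... | s , k , l , s² , xk≈sl = s , l , k , s² , (begin
    y * ι (2^ l)                            ≈⟨ *-congˡ (≈-trans (≈-sym (*-identityˡ _)) (*-congʳ (≈-trans (≈-sym ι-1) (≈-trans (≈-sym (ι-cong s²)) (ι-* s s))))) ⟩
    y * (ι s * ι s * ι (2^ l))              ≈⟨ *-congˡ (*-assoc _ _ _) ⟩
    y * (ι s * (ι s * ι (2^ l)))            ≈⟨ *-congˡ (*-congˡ (≈-sym xk≈sl)) ⟩
    y * (ι s * (x * ι (2^ k)))              ≈⟨ solve 4 (λ y s x k → y :* (s :* (x :* k)) := (x :* y) :* (s :* k)) ≈-refl y (ι s) x (ι (2^ k)) ⟩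
    x * y * (ι s * ι (2^ k))                ≈⟨ ≈-trans (*-congʳ xy≈1) (*-identityˡ _) ⟩
    ι s * ι (2^ k)                          ∎)
  dyadic-powerQuotient (resp-≈ x≈y p) with dyadic-powerQuotient p
  ... | s , k , l , s² , eq = s , k , l , s² , ≈-trans (*-congʳ (≈-sym x≈y)) eq

  dyadic-fraction : ∀ {x} → Dyadic x → Fraction x
  dyadic-fraction p with dyadic-powerQuotient p
  ... | s , k , l , _ , eq = s ℤ.* 2^ l , k , ≈-trans eq (≈-sym (ι-* s (2^ l)))

  fraction-zero : ∀ {x} ((n , _) : Fraction x) → n ≡ 0ℤ → x ≈ 0#
  fraction-zero {x} (n , k , xk≈n) n≡0 = *-cancelʳ-unit (ι-2^-unit k)
    (≈-trans xk≈n (≈-trans (ι-cong n≡0) (≈-trans ι-0 (≈-sym (zeroˡ _)))))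

-- The bracket ring 𝔹 of P₈.

open Polynomial (Symbol P₈) hiding (Poly; con; var; polynomialRing; distribˡ)
open Polynomial using (con; var)

Poly₈ : Set
Poly₈ = Polynomial.Poly (Symbol P₈)

polynomials : Ring
polynomials = Polynomial.polynomialRing (Symbol P₈)

𝔹₈ : Ring
𝔹₈ = 𝔹 P₈

module 𝔹 = CommutativeRing 𝔹₈
private module Poly = CommutativeRing polynomials

≋⇒≈ : ∀ {p q : Poly₈} → p ≋ q → p 𝔹.≈ q
≋⇒≈ {p} {q} p≋q = resp-≈ (≋-sym (≋-trans (Poly.+-congʳ p≋q) (Poly.-‿inverseʳ q))) 0#∈

con-morphism : IntegerMorphism 𝔹₈
con-morphism = record
  { ⟦_⟧    = con
  ; +-homo = λ i j → ≋⇒≈ (con-⊕ i j)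
  ; *-homo = λ i j → ≋⇒≈ (con-⊗ i j)
  ; -‿homo = λ i → ≋⇒≈ (inverseˡ-unique (con (ℤ.- i)) (con i)
      (≋-trans (≋-sym (con-⊕ (ℤ.- i) i)) (Poly.reflexive (cong con (ℤ.+-inverseˡ i)))))
  ; 0-homo = 𝔹.refl
  ; 1-homo = 𝔹.refl
  }
  where open GroupProperties Poly.+-group using (inverseˡ-unique)

bracket : Word → Poly₈
bracket Z = var ⟦ Z ⟧

bracket-alternating : IsAlternating 𝔹₈ bracket
bracket-alternating i Z = 𝔹.trans (𝔹.sym (-‿involutive _)) (𝔹.-‿cong (𝔹.sym (negated i Z)))
  where
  open RingProperties 𝔹.ring using (-‿involutive; -‿distribˡ-*)
  negated : ∀ i Z → bracket Z 𝔹.≈ 𝔹.- bracket (swapAt i Z)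
  -- An adjacent transposition has one inversion, so its `sgn` is the first power of -1, which
  -- unfolds to `- 1# * 1#`.
  minus-one : ∀ x → (𝔹.- 𝔹.1# 𝔹.* 𝔹.1#) 𝔹.* x 𝔹.≈ 𝔹.- x
  minus-one x = 𝔹.trans (𝔹.*-congʳ (𝔹.*-identityʳ _))
    (𝔹.trans (𝔹.sym (-‿distribˡ-* 𝔹.1# x)) (𝔹.-‿cong (𝔹.*-identityˡ x)))
  negated 0F Z@(a ∷ b ∷ c ∷ d ∷ []) = 𝔹.trans (gen (alternating Z (Perm.transpose 0F 1F))) (minus-one _)
  negated 1F Z@(a ∷ b ∷ c ∷ d ∷ []) = 𝔹.trans (gen (alternating Z (Perm.transpose 1F 2F))) (minus-one _)
  negated 2F Z@(a ∷ b ∷ c ∷ d ∷ []) = 𝔹.trans (gen (alternating Z (Perm.transpose 2F 3F))) (minus-one _)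

bracket-threeTerm : ThreeTerm 𝔹₈ bracket
bracket-threeTerm x₁ x₂ y₁ y₂ w₁ w₂ =
  resp-≈ (≋-trans (Poly.+-assoc _ _ _) (Poly.+-congˡ (-‿+-comm _ _)))
    (gen (three-term refl x₁ x₂ y₁ y₂ (w₁ ∷ w₂ ∷ [])))
  where open RingProperties Poly.ring using (-‿+-comm)

bracket-zero : ∀ Z → det₈ Z ≡ 0ℤ → bracket Z 𝔹.≈ 𝔹.0#
bracket-zero Z d≡0 = resp-≈ (≋-sym (≋-trans (Poly.+-congˡ -0#≈0#) (Poly.+-identityʳ _)))
  (gen (nonbasis Z (λ b → isBasis⇒det₈≢0 Z b d≡0)))
  where open RingProperties Poly.ring using (-0#≈0#)

inverse-bracket : ∀ Z (b : Matroid.IsBasis P₈ (entries Z)) → bracket Z 𝔹.* var (⟦ Z ⟧⁻ b) 𝔹.≈ 𝔹.1#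
inverse-bracket Z b = gen (inverse Z b)

bracket-unit : ∀ Z → det₈ Z ≢ 0ℤ → IsUnit 𝔹₈ (bracket Z)
bracket-unit Z d≢0 = Units.isUnit 𝔹₈ (inverse-bracket Z (det₈≢0⇒isBasis Z d≢0))

-- Signs of arbitrary permutations.

-- The count underlying `inversions`, stated for functions: it can then be evaluated on the position
-- words over which `permutation-sorts` ranges.
inversionCount : ∀ {n} → (Fin n → Fin n) → ℕ
inversionCount f = length (filter
  (λ (i , j) → (i Fin.<? j) ×-dec (f j Fin.<? f i)) (cartesianProduct (allFin _) (allFin _)))

inversionCount-cong : ∀ {n} {f g : Fin n → Fin n} → (∀ i → f i ≡ g i) → inversionCount f ≡ inversionCount g
inversionCount-cong {f = f} {g} f≗g = cong length (List.filter-≐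
  (λ (i , j) → (i Fin.<? j) ×-dec (f j Fin.<? f i)) (λ (i , j) → (i Fin.<? j) ×-dec (g j Fin.<? g i))
  ( (λ {(i , j)} (i<j , p) → i<j , ≡.subst₂ Fin._<_ (f≗g j) (f≗g i) p)
  , (λ {(i , j)} (i<j , p) → i<j , ≡.subst₂ Fin._<_ (sym (f≗g j)) (sym (f≗g i)) p))
  (cartesianProduct (allFin _) (allFin _)))

IsInjective : Vec (Fin 4) 4 → Set
IsInjective v = ∀ i j → lookup v i ≡ lookup v j → i ≡ j

isInjective? : ∀ v → Dec (IsInjective v)
isInjective? v = Fin.all? λ i → Fin.all? λ j → (lookup v i Fin.≟ lookup v j) →-dec (i Fin.≟ j)

SortsWithSign : List (Fin 3) → Vec (Fin 4) 4 → Set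
SortsWithSign is v = sort is v ≡ 0F ∷ 1F ∷ 2F ∷ 3F ∷ [] × sortingSign is v ≡ -1ℤ ℤ.^ inversionCount (lookup v)

sortsWithSign? : ∀ is v → Dec (SortsWithSign is v)
sortsWithSign? is v = Vec.≡-dec Fin._≟_ (sort is v) (0F ∷ 1F ∷ 2F ∷ 3F ∷ []) ×-dec
  (sortingSign is v ℤ.≟ -1ℤ ℤ.^ inversionCount (lookup v))

abstract
  permutation-sorts : ∀ v → IsInjective v → SortsWithSign bubbles v
  permutation-sorts = toWitness {a? = allWords? λ v → isInjective? v →-dec sortsWithSign? bubbles v} _

det₈-sorts : ∀ is Z v → SortsWithSign is v →
  det₈ (Vec.map (lookup Z) v) ≡ -1ℤ ℤ.^ inversionCount (lookup v) ℤ.* det₈ Z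
det₈-sorts is Z v (sorted , sign) = trans (det₈-sortingPermutation Z is v)
  (cong₂ ℤ._*_ sign (cong det₈ (trans (cong (Vec.map (lookup Z)) sorted) (select Z))))
  where
  select : ∀ Z → Vec.map (lookup Z) (0F ∷ 1F ∷ 2F ∷ 3F ∷ []) ≡ Z
  select (a ∷ b ∷ c ∷ d ∷ []) = refl

-- The alternating generators of the ideal run over all permutations and take their sign from
-- inversions, whereas `IsAlternating` concerns adjacent swaps. Sorting the word of positions
-- mediates: `permutation-sorts` compares the two signs on the 24 injective words.
det₈-permutation : ∀ Z (σ : Permutation′ 4) →
  det₈ (tabulate (λ i → lookup Z (σ ⟨$⟩ʳ i))) ≡ -1ℤ ℤ.^ inversionCount (σ ⟨$⟩ʳ_) ℤ.* det₈ Z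
det₈-permutation Z σ = begin
  det₈ (tabulate (λ i → lookup Z (σ ⟨$⟩ʳ i)))
    ≡⟨ cong det₈ (Vec.tabulate-∘ (lookup Z) (σ ⟨$⟩ʳ_)) ⟩
  det₈ (Vec.map (lookup Z) (tabulate (σ ⟨$⟩ʳ_)))
    ≡⟨ det₈-sorts bubbles Z (tabulate (σ ⟨$⟩ʳ_)) (permutation-sorts (tabulate (σ ⟨$⟩ʳ_)) injective) ⟩
  -1ℤ ℤ.^ inversionCount (lookup (tabulate (σ ⟨$⟩ʳ_))) ℤ.* det₈ Z
    ≡⟨ cong (λ n → -1ℤ ℤ.^ n ℤ.* det₈ Z) (inversionCount-cong (Vec.lookup∘tabulate (σ ⟨$⟩ʳ_))) ⟩
  -1ℤ ℤ.^ inversionCount (σ ⟨$⟩ʳ_) ℤ.* det₈ Z ∎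
  where
  open ≡.≡-Reasoning
  injective : IsInjective (tabulate (σ ⟨$⟩ʳ_))
  injective i j eq = permutation-injective σ
    (trans (sym (Vec.lookup∘tabulate (σ ⟨$⟩ʳ_) i)) (trans eq (Vec.lookup∘tabulate (σ ⟨$⟩ʳ_) j)))

-1^n² : ∀ n → -1ℤ ℤ.^ n ℤ.* -1ℤ ℤ.^ n ≡ 1ℤ
-1^n² zero    = refl
-1^n² (suc n) = trans (interchange -1ℤ (-1ℤ ℤ.^ n) -1ℤ (-1ℤ ℤ.^ n)) (cong (1ℤ ℤ.*_) (-1^n² n))
  where open CommutativeSemigroupProperties ℤ.*-commutativeSemigroup using (interchange)

-- The evaluation homomorphism on 𝔹.

module Evaluation {S : Ring} (ι-morphism : IntegerMorphism S) (d⁻¹ : Word → CommutativeRing.Carrier S)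
    (d⁻¹-inverse : ∀ Z → det₈ Z ≢ 0ℤ →
      CommutativeRing._≈_ S (CommutativeRing._*_ S (Integers.ι ι-morphism (det₈ Z)) (d⁻¹ Z)) (CommutativeRing.1# S)) where
  open CommutativeRing S hiding (zero) renaming (refl to ≈-refl; sym to ≈-sym; trans to ≈-trans)
  open Integers ι-morphism
  open RingProperties ring using (-0#≈0#)

  evalSymbol : Symbol P₈ → Carrier
  evalSymbol ⟦ Z ⟧       = ι (det₈ Z)
  -- The basis proof in the symbol is irrelevant, so the value can depend on Z only; hence `d⁻¹` is
  -- a total function on words.
  evalSymbol (⟦ Z ⟧⁻ _) = d⁻¹ Z

  eval : Poly₈ → Carrier
  eval (con i) = ι i
  eval (var x) = evalSymbol x
  eval (p ⊕ q) = eval p + eval q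
  eval (p ⊗ q) = eval p * eval q
  eval (⊝ p)   = - eval p

  eval-≋ : ∀ {p q} → p ≋ q → eval p ≈ eval q
  eval-≋ ≋-refl          = ≈-refl
  eval-≋ (≋-sym e)       = ≈-sym (eval-≋ e)
  eval-≋ (≋-trans e f)   = ≈-trans (eval-≋ e) (eval-≋ f)
  eval-≋ (⊕-cong e f)    = +-cong (eval-≋ e) (eval-≋ f)
  eval-≋ (⊗-cong e f)    = *-cong (eval-≋ e) (eval-≋ f)
  eval-≋ (⊝-cong e)      = -‿cong (eval-≋ e)
  eval-≋ (⊕-assoc _ _ _) = +-assoc _ _ _
  eval-≋ (⊕-comm _ _)    = +-comm _ _
  eval-≋ (⊕-identityˡ _) = ≈-trans (+-congʳ ι-0) (+-identityˡ _)
  eval-≋ (⊝-inverseˡ _)  = ≈-trans (-‿inverseˡ _) (≈-sym ι-0)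
  eval-≋ (⊗-assoc _ _ _) = *-assoc _ _ _
  eval-≋ (⊗-comm _ _)    = *-comm _ _
  eval-≋ (⊗-identityˡ _) = ≈-trans (*-congʳ ι-1) (*-identityˡ _)
  eval-≋ (Polynomial.distribˡ _ _ _) = distribˡ _ _ _
  eval-≋ (con-⊕ i j)     = ι-+ i j
  eval-≋ (con-⊗ i j)     = ι-* i j

  difference-zero : ∀ {x y} → x ≈ y → x - y ≈ 0#
  difference-zero {x} {y} x≈y = ≈-trans (+-congʳ x≈y) (-‿inverseʳ y)

  eval-sgn : ∀ n → eval (RawSemiringDefinitions._^_ (Semiring.rawSemiring Poly.semiring) (⊝ con 1ℤ) n) ≈ ι (-1ℤ ℤ.^ n)
  eval-sgn zero    = ≈-refl
  eval-sgn (suc n) = ≈-trans (*-cong (≈-sym (ι-neg 1ℤ)) (eval-sgn n)) (≈-sym (ι-* -1ℤ _))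

  eval-generator : ∀ {p} → Generator P₈ p → eval p ≈ 0#
  eval-generator (nonbasis Z ¬b) with det₈ Z ℤ.≟ 0ℤ
  ... | yes d≡0 = ≈-trans (ι-cong d≡0) ι-0
  ... | no d≢0  = contradiction (det₈≢0⇒isBasis Z d≢0) ¬b
  eval-generator (alternating Z σ) = difference-zero (≈-sym (begin
    eval (sgn polynomials σ) * ι (det₈ Zσ)  ≈⟨ *-cong (eval-sgn (inversions polynomials σ)) (ι-cong (det₈-permutation Z σ)) ⟩
    ι ε * ι (ε ℤ.* det₈ Z)                  ≈⟨ ≈-sym (ι-* ε _) ⟩
    ι (ε ℤ.* (ε ℤ.* det₈ Z))                ≈⟨ ι-cong (trans (sym (ℤ.*-assoc ε ε (det₈ Z)))
                                                (trans (cong (ℤ._* det₈ Z) (-1^n² (inversionCount (σ ⟨$⟩ʳ_)))) (ℤ.*-identityˡ (det₈ Z)))) ⟩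
    ι (det₈ Z)                              ∎))
    where
    open SetoidReasoning setoid
    ε = -1ℤ ℤ.^ inversionCount (σ ⟨$⟩ʳ_)
    Zσ = tabulate (λ i → lookup Z (σ ⟨$⟩ʳ i))
  eval-generator (three-term refl x₁ x₂ y₁ y₂ (w₁ ∷ w₂ ∷ [])) =
    ≈-trans (+-assoc _ _ _) (≈-trans (+-congˡ (-‿+-comm _ _)) (difference-zero (begin
      ι dX * ι dP                     ≈⟨ ≈-sym (ι-* dX dP) ⟩
      ι (dX ℤ.* dP)                   ≈⟨ ι-cong (det₈-threeTerm x₁ x₂ y₁ y₂ w₁ w₂) ⟩
      ι (dQ ℤ.* dR ℤ.+ dT ℤ.* dU)     ≈⟨ ι-+ _ _ ⟩
      ι (dQ ℤ.* dR) + ι (dT ℤ.* dU)   ≈⟨ +-cong (ι-* dQ dR) (ι-* dT dU) ⟩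
      ι dQ * ι dR + ι dT * ι dU       ∎)))
    where
    open SetoidReasoning setoid
    open RingProperties ring using (-‿+-comm)
    dX = det₈ (x₁ ∷ x₂ ∷ w₁ ∷ w₂ ∷ [])
    dP = det₈ (y₁ ∷ y₂ ∷ w₁ ∷ w₂ ∷ [])
    dQ = det₈ (y₁ ∷ x₂ ∷ w₁ ∷ w₂ ∷ [])
    dR = det₈ (x₁ ∷ y₂ ∷ w₁ ∷ w₂ ∷ [])
    dT = det₈ (y₂ ∷ x₂ ∷ w₁ ∷ w₂ ∷ [])
    dU = det₈ (y₁ ∷ x₁ ∷ w₁ ∷ w₂ ∷ [])
  eval-generator (inverse Z b) =
    ≈-trans (+-congˡ (-‿cong ι-1)) (difference-zero (d⁻¹-inverse Z (isBasis⇒det₈≢0 Z b)))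

  eval-ideal : ∀ {p} → IdealGeneratedBy polynomials (Generator P₈) p → eval p ≈ 0#
  eval-ideal (gen g)      = eval-generator g
  eval-ideal 0#∈          = ι-0
  eval-ideal (+-∈ p q)    = ≈-trans (+-cong (eval-ideal p) (eval-ideal q)) (+-identityˡ 0#)
  eval-ideal (*-∈ r p)    = ≈-trans (*-congˡ (eval-ideal p)) (zeroʳ _)
  eval-ideal (resp-≈ e p) = ≈-trans (≈-sym (eval-≋ e)) (eval-ideal p)

  eval-cong : ∀ {p q} → p 𝔹.≈ q → eval p ≈ eval q
  eval-cong {p} {q} p≈q = begin
    eval p                        ≈⟨ ≈-sym (+-identityʳ _) ⟩
    eval p + 0#                   ≈⟨ +-congˡ (≈-sym (-‿inverseˡ (eval q))) ⟩
    eval p + (- eval q + eval q)  ≈⟨ ≈-sym (+-assoc _ _ _) ⟩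
    eval p - eval q + eval q      ≈⟨ +-congʳ (eval-ideal p≈q) ⟩
    0# + eval q                   ≈⟨ +-identityˡ _ ⟩
    eval q                        ∎
    where open SetoidReasoning setoid

-- Comparison of the universal partial field with 𝔻.

-- `_*ℙ_` is defined by cases on the membership proofs, so its underlying product does not compute
-- before these are split.
*ℙ-value : ∀ (P : PartialField) (let open PartialField P) p q → proj₁ (p *ℙ q) ≡ proj₁ p * proj₁ q
*ℙ-value P (_ , inj₁ _) _            = refl
*ℙ-value P (_ , inj₂ _) (_ , inj₁ _) = refl
*ℙ-value P (_ , inj₂ _) (_ , inj₂ _) = refl

-- The target of the evaluation ⟦ Z ⟧ ↦ det₈ Z is kept abstract, because arithmetic on concrete
-- fractions unfolds to enormous terms.
record Target (S : Ring) : Set where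
  open CommutativeRing S
  field
    ι-morphism  : IntegerMorphism S
  open Integers ι-morphism
  field
    ι-kernel    : ∀ i → ι i ≈ ι 0ℤ → i ≡ 0ℤ
    d⁻¹         : Word → Carrier
    d⁻¹-inverse : ∀ Z → det₈ Z ≢ 0ℤ → ι (det₈ Z) * d⁻¹ Z ≈ 1#
    ½ₛ          : Carrier
    2*½≈1       : (1# + 1#) * ½ₛ ≈ 1#

module Comparison {S : Ring} (target : Target S) where
  private module S = CommutativeRing S
  open Target target

  open Evaluation ι-morphism d⁻¹ d⁻¹-inverse
  open Integers ι-morphism using () renaming (ι-0 to ιₛ-0; ι-1 to ιₛ-1)

  S[½] : Ring
  S[½] = subring S (S._≈ ½ₛ)

  𝔻ₛ : PartialField
  𝔻ₛ = partialField S[½] (λ x → x ≈ - 1# ⊎ x ≈ 1# + 1#) (inj₁ (CommutativeRing.refl S[½] { - 1# }))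
    where open CommutativeRing S[½] using (_≈_; -_; 1#; _+_)

  -- The evaluation serves as a model: an equality 1 = 0 in 𝔹 would be carried to S, where ℤ embeds.
  𝔹-nontrivial : Nontrivial 𝔹₈
  𝔹-nontrivial 1≈0 with () ← ι-kernel 1ℤ (eval-cong 1≈0)

  open Brackets {𝔹₈} con-morphism {bracket} bracket-alternating bracket-threeTerm bracket-zero bracket-unit
    renaming (2-unit to 𝔹-2-unit)
  open Tameness {𝔹₈} con-morphism 𝔹-nontrivial 𝔹-2-unit
  open Fractions {𝔹₈} con-morphism 𝔹-nontrivial 𝔹-2-unit
  open Half {𝔹₈} con-morphism 𝔹-nontrivial 𝔹-2-unit using (½#; basis-half-crossRatio)
  open Units 𝔹₈
  inverse-unique : ∀ {x y z} → x S.* y S.≈ S.1# → x S.* z S.≈ S.1# → y S.≈ z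
  inverse-unique {x} {y} {z} xy≈1 xz≈1 = Units.*-cancelʳ-unit S (Units.isUnit S xy≈1)
    (S.trans (S.*-comm y x) (S.trans xy≈1 (S.trans (S.sym xz≈1) (S.*-comm x z))))

  -- Evaluating x · 2^k = n shows that n maps to 0 in S, so n = 0; as 2^k is a unit of 𝔹, x = 0.
  fraction-kernel : ∀ {x} → Fraction x → eval x S.≈ S.0# → x 𝔹.≈ 𝔹.0#
  fraction-kernel {x} f@(n , k , xk≈n) eval≈0 = fraction-zero f
    (ι-kernel n (S.trans (S.sym (eval-cong xk≈n)) (S.trans (S.*-congʳ eval≈0) (S.trans (S.zeroˡ _) (S.sym ιₛ-0)))))

  -- `G` is a predicate on elements of the subring, so membership in the subring and in the group
  -- must be built together. Subring membership of an inverse does not come from the induction: it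
  -- is taken from the unit proof in `𝔻ₛ` and transported by uniqueness of inverses.
  dyadic-lifts : ∀ {x} → Dyadic x → Σ[ m ∈ SubringGeneratedBy S (S._≈ ½ₛ) (eval x) ] PartialField.G 𝔻ₛ (eval x , m)
  dyadic-lifts {x} (gen (inj₁ x≈-1) _) = resp-≈ (S.sym x≈) (neg-∈ 1#∈) ,
    resp-≈ {x = S.- S.1# , neg-∈ 1#∈} (S.sym x≈) (PartialField.G-neg1 𝔻ₛ)
    where
    x≈ : eval x S.≈ S.- S.1#
    x≈ = S.trans (eval-cong x≈-1) (S.-‿cong ιₛ-1)
  dyadic-lifts {x} (gen (inj₂ x≈2) _) = resp-≈ (S.sym x≈) (+-∈ 1#∈ 1#∈) ,
    resp-≈ {x = S.1# S.+ S.1# , +-∈ 1#∈ 1#∈} (S.sym x≈) (gen (inj₂ S.refl) ((½ₛ , gen S.refl) , S.trans (S.*-comm ½ₛ _) 2*½≈1 , 2*½≈1))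
    where
    x≈ : eval x S.≈ S.1# S.+ S.1#
    x≈ = S.trans (eval-cong x≈2) (S.+-cong ιₛ-1 ιₛ-1)
  dyadic-lifts 1#∈ = resp-≈ (S.sym ιₛ-1) 1#∈ , resp-≈ (S.sym ιₛ-1) 1#∈
  dyadic-lifts (*-∈ p q) with dyadic-lifts p | dyadic-lifts q
  ... | m , g | m′ , g′ = *-∈ m m′ , *-∈ g g′
  dyadic-lifts (inv-∈ {x} {y} xy≈1 p) with dyadic-lifts p
  ... | m , g with PartialField.G-units 𝔻ₛ g
  ... | (z , m′) , _ , xz≈1 = resp-≈ (inverse-unique xz≈1 xy≈1′) m′ , inv-∈ xy≈1′ g
    where
    xy≈1′ : eval x S.* eval y S.≈ S.1#
    xy≈1′ = S.trans (eval-cong xy≈1) ιₛ-1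
  dyadic-lifts (resp-≈ x≈y p) with dyadic-lifts p
  ... | m , g = resp-≈ (eval-cong x≈y) m , resp-≈ (eval-cong x≈y) g

  module Isomorphism (B : Word) (b : Matroid.IsBasis P₈ (entries B)) where

    ℙ : PartialField
    ℙ = universalPartialField P₈ B b

    module ℙ = PartialField ℙ
    module 𝔻 = PartialField 𝔻ₛ

    A : Matrix 𝔹.Carrier 4 ∣ ∁ (entries B) ∣
    A = basisMatrix P₈ B b

    B≢0 : det₈ B ≢ 0ℤ
    B≢0 = isBasis⇒det₈≢0 B b

    row-factor : Fin 4 → 𝔹.Carrier
    row-factor i = rowFactor B i 𝔹.* var (⟦ B ⟧⁻ b)

    row-factor-unit : ∀ i → IsUnit 𝔹₈ (row-factor i)
    row-factor-unit i = *-unit (rowFactor-unit B i) (isUnit (𝔹.trans (𝔹.*-comm _ _) (inverse-bracket B b)))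

    A-entry : ∀ i j → A i j 𝔹.≈ row-factor i 𝔹.* columnFactor B (nonElements B j) 𝔹.* δ (B [ i ]≔ nonElements B j)
    A-entry i j = bracket-factors B (var (⟦ B ⟧⁻ b)) i (nonElements B j)

    A-tame : Tame A
    A-tame = record
      { B = B ; B-basis = B≢0 ; row = λ i → i ; row-inj = λ eq → eq ; label = nonElements B
      ; r = row-factor ; c = λ j → columnFactor B (nonElements B j)
      ; r-unit = row-factor-unit ; c-unit = λ j → columnFactor-unit B (nonElements B j)
      ; entry = A-entry
      }

    crossRatio-dyadic : ∀ {p} → CrossRatio P₈ B b p → p 𝔹.≈ 𝔹.0# ⊎ Dyadic p
    crossRatio-dyadic p⪯A = tame-crossRatio (tame-⪯ p⪯A A-tame)

    ½-crossRatio : CrossRatio P₈ B b ½#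
    ½-crossRatio = basis-half-crossRatio B B≢0 row-factor (λ j → columnFactor B (nonElements B j))
      row-factor-unit (λ j → columnFactor-unit B (nonElements B j)) A-entry

    eval-∈ : ∀ {x} → SubringGeneratedBy 𝔹₈ (CrossRatio P₈ B b) x → SubringGeneratedBy S (S._≈ ½ₛ) (eval x)
    eval-∈ (gen p) = [ (λ p≈0 → resp-≈ (S.sym (S.trans (eval-cong p≈0) ιₛ-0)) 0#∈)
                     , (λ d → proj₁ (dyadic-lifts d)) ]′ (crossRatio-dyadic p)
    eval-∈ 0#∈          = resp-≈ (S.sym ιₛ-0) 0#∈
    eval-∈ 1#∈          = resp-≈ (S.sym ιₛ-1) 1#∈
    eval-∈ (+-∈ p q)    = +-∈ (eval-∈ p) (eval-∈ q)
    eval-∈ (*-∈ p q)    = *-∈ (eval-∈ p) (eval-∈ q)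
    eval-∈ (neg-∈ p)    = neg-∈ (eval-∈ p)
    eval-∈ (resp-≈ e p) = resp-≈ (eval-cong e) (eval-∈ p)

    fraction : ∀ {x} → SubringGeneratedBy 𝔹₈ (CrossRatio P₈ B b) x → Fraction x
    fraction (gen p) = [ (λ p≈0 → fraction-resp (𝔹.sym p≈0) (fraction-ι 0ℤ)) , dyadic-fraction ]′ (crossRatio-dyadic p)
    fraction 0#∈          = fraction-ι 0ℤ
    fraction 1#∈          = fraction-ι 1ℤ
    fraction (+-∈ p q)    = fraction-+ (fraction p) (fraction q)
    fraction (*-∈ p q)    = fraction-* (fraction p) (fraction q)
    fraction (neg-∈ p)    = fraction-neg (fraction p)
    fraction (resp-≈ e p) = fraction-resp e (fraction p)

    Ψ : ℙ.Carrier → 𝔻.Carrier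
    Ψ (x , x∈) = eval x , eval-∈ x∈

    Ψ-injective : ∀ {x y} → Ψ x 𝔻.≈ Ψ y → x ℙ.≈ y
    Ψ-injective {x , x∈} {y , y∈} eq = x∙y⁻¹≈ε⇒x≈y x y
      (fraction-kernel (fraction (+-∈ x∈ (neg-∈ y∈))) (difference-zero eq))
      where open GroupProperties 𝔹.+-group using (x∙y⁻¹≈ε⇒x≈y)

    -- A generator of the group is a unit, which rules out the cross ratio 0.
    G-dyadic : ∀ {x} → ℙ.G x → Dyadic (proj₁ x)
    G-dyadic (gen (inj₁ p) ((x⁻¹ , _) , x⁻¹x≈1 , xx⁻¹≈1)) =
      [ (λ p≈0 → contradiction p≈0 (nonzero-unit (x⁻¹ , x⁻¹x≈1 , xx⁻¹≈1))) , (λ d → d) ]′ (crossRatio-dyadic p)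
    G-dyadic (gen (inj₂ x≈-1) (x⁻¹ , x⁻¹x≈1 , xx⁻¹≈1)) = gen (inj₁ x≈-1) (proj₁ x⁻¹ , x⁻¹x≈1 , xx⁻¹≈1)
    G-dyadic 1#∈          = 1#∈
    G-dyadic (*-∈ p q)    = *-∈ (G-dyadic p) (G-dyadic q)
    G-dyadic (inv-∈ e p)  = inv-∈ e (G-dyadic p)
    G-dyadic (resp-≈ e p) = resp-≈ e (G-dyadic p)

    Ψ-G : ∀ {x} → ℙ.G x → 𝔻.G (Ψ x)
    Ψ-G g = resp-≈ S.refl (proj₂ (dyadic-lifts (G-dyadic g)))

    Ψ-∈ℙ : ∀ {x} → x ℙ.∈ℙ → Ψ x 𝔻.∈ℙ
    Ψ-∈ℙ (inj₁ x≈0) = inj₁ (S.trans (eval-cong x≈0) ιₛ-0)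
    Ψ-∈ℙ (inj₂ g)   = inj₂ (Ψ-G g)

    -- Obtained as the inverse of the cross ratio ½; with -1 it gives preimages for both generators
    -- of 𝔻.
    2-G : ℙ.G (ℙ.1# ℙ.+ ℙ.1#)
    2-G = inv-∈ (proj₁ (proj₂ 𝔹-2-unit)) (gen {x = ½# , gen ½-crossRatio} (inj₁ ½-crossRatio)
      (ℙ.1# ℙ.+ ℙ.1# , proj₂ (proj₂ 𝔹-2-unit) , proj₁ (proj₂ 𝔹-2-unit)))

    G-preimage : ∀ {y} → 𝔻.G y → ∃[ x ] ℙ.G x × Ψ x 𝔻.≈ y
    G-preimage (gen (inj₁ y≈-1) _) = ℙ.- ℙ.1# , ℙ.G-neg1 , S.trans (S.-‿cong ιₛ-1) (S.sym y≈-1)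
    G-preimage (gen (inj₂ y≈2) _)  = ℙ.1# ℙ.+ ℙ.1# , 2-G , S.trans (S.+-cong ιₛ-1 ιₛ-1) (S.sym y≈2)
    G-preimage 1#∈ = ℙ.1# , ℙ.G-1 , ιₛ-1
    G-preimage (*-∈ p q) =
      let x , g , e = G-preimage p ; x′ , g′ , e′ = G-preimage q
      in x ℙ.* x′ , ℙ.G-* g g′ , S.*-cong e e′
    G-preimage (inv-∈ yz≈1 p) =
      let x , g , e = G-preimage p ; x⁻¹ , _ , xx⁻¹≈1 = ℙ.G-units g
      in x⁻¹ , ℙ.G-inv {x} {x⁻¹} xx⁻¹≈1 g ,
         inverse-unique (S.trans (eval-cong xx⁻¹≈1) ιₛ-1) (S.trans (S.*-congʳ e) yz≈1)
    G-preimage (resp-≈ y≈z p) =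
      let x , g , e = G-preimage p in x , g , S.trans e y≈z

    preimage : ∀ {y} → y 𝔻.∈ℙ → ∃[ x ] x ℙ.∈ℙ × Ψ x 𝔻.≈ y
    preimage (inj₁ y≈0) = ℙ.0# , inj₁ 𝔹.refl , S.trans ιₛ-0 (S.sym y≈0)
    preimage (inj₂ g)   = let x , g′ , e = G-preimage g in x , inj₂ g′ , e

    ∈ℙ-resp : ∀ x y → x ℙ.≈ y → x ℙ.∈ℙ → y ℙ.∈ℙ
    ∈ℙ-resp x y x≈y (inj₁ x≈0) = inj₁ (𝔹.trans (𝔹.sym x≈y) x≈0)
    ∈ℙ-resp x y x≈y (inj₂ g)   = inj₂ (ℙ.G-resp {x} {y} x≈y g)

    -- Ψ is injective on all of R_M and not merely on the elements of ℙ. A preimage of Ψ x in ℙ must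
    -- therefore be x itself. Applied to a sum p + q, which lies in R_M in any case, this shows that
    -- φ reflects the existence of sums.
    ∈ℙ-reflects : ∀ {x} → Ψ x 𝔻.∈ℙ → x ℙ.∈ℙ
    ∈ℙ-reflects {x} Ψx∈ = let y , y∈ , e = preimage Ψx∈ in ∈ℙ-resp y x (Ψ-injective {y} {x} e) y∈

    φ : ℙ.Element → 𝔻.Element
    φ (x , x∈) = Ψ x , Ψ-∈ℙ x∈

    isomorphism : ℙ ≅ 𝔻ₛ
    isomorphism = record
      { φ              = φ
      ; isHomomorphism = record
        { cong   = eval-cong
        ; 1-homo = ιₛ-1
        ; *-homo = λ p q → S.trans (S.reflexive (cong (λ x → proj₁ (Ψ x)) (*ℙ-value ℙ p q)))
            (S.reflexive (sym (cong proj₁ (*ℙ-value 𝔻ₛ (φ p) (φ q)))))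
        ; +-homo = λ p q s p+q≈s → eval-cong p+q≈s
        }
      ; bijective      = (λ {p} {q} → Ψ-injective {proj₁ p} {proj₁ q}) , λ (y , y∈) →
          let x , x∈ , Ψx≈y = preimage y∈ in (x , x∈) , λ z≈x → S.trans (eval-cong z≈x) Ψx≈y
      ; +-reflects     = λ p q → mk⇔ (∈ℙ-reflects {proj₁ p ℙ.+ proj₁ q}) Ψ-∈ℙ
      }

-- The rational numbers as target of the evaluation.

abstract
  -- Defined through unnormalised fractions, where the homomorphism laws are integer identities with
  -- denominator 1 and no common divisors have to be removed.
  ℤ→ℚ : ℤ → ℚ
  ℤ→ℚ i = ℚ.fromℚᵘ (mkℚᵘ i 0)

  private
    to : ∀ i → ℚ.toℚᵘ (ℤ→ℚ i) ℚᵘ.≃ mkℚᵘ i 0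
    to i = ℚ.toℚᵘ-fromℚᵘ (mkℚᵘ i 0)

  ℤ→ℚ-0 : ℤ→ℚ 0ℤ ≡ 0ℚ
  ℤ→ℚ-0 = refl

  ℤ→ℚ-1 : ℤ→ℚ 1ℤ ≡ 1ℚ
  ℤ→ℚ-1 = refl

  ℤ→ℚ-+ : ∀ i j → ℤ→ℚ (i ℤ.+ j) ≡ ℤ→ℚ i ℚ.+ ℤ→ℚ j
  ℤ→ℚ-+ i j = ℚ.toℚᵘ-injective (begin
    ℚ.toℚᵘ (ℤ→ℚ (i ℤ.+ j))                 ≈⟨ to (i ℤ.+ j) ⟩
    mkℚᵘ (i ℤ.+ j) 0                        ≈⟨ *≡* (cong (ℤ._* 1ℤ) (sym (cong₂ ℤ._+_ (ℤ.*-identityʳ i) (ℤ.*-identityʳ j)))) ⟩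
    mkℚᵘ i 0 ℚᵘ.+ mkℚᵘ j 0                  ≈⟨ ℚᵘ.≃-sym (ℚᵘ.+-cong (to i) (to j)) ⟩
    ℚ.toℚᵘ (ℤ→ℚ i) ℚᵘ.+ ℚ.toℚᵘ (ℤ→ℚ j)    ≈⟨ ℚᵘ.≃-sym (ℚ.toℚᵘ-homo-+ (ℤ→ℚ i) (ℤ→ℚ j)) ⟩
    ℚ.toℚᵘ (ℤ→ℚ i ℚ.+ ℤ→ℚ j)               ∎)
    where open SetoidReasoning ℚᵘ.≃-setoid

  ℤ→ℚ-* : ∀ i j → ℤ→ℚ (i ℤ.* j) ≡ ℤ→ℚ i ℚ.* ℤ→ℚ j
  ℤ→ℚ-* i j = ℚ.toℚᵘ-injective (begin
    ℚ.toℚᵘ (ℤ→ℚ (i ℤ.* j))                 ≈⟨ to (i ℤ.* j) ⟩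
    mkℚᵘ i 0 ℚᵘ.* mkℚᵘ j 0                  ≈⟨ ℚᵘ.≃-sym (ℚᵘ.*-cong (to i) (to j)) ⟩
    ℚ.toℚᵘ (ℤ→ℚ i) ℚᵘ.* ℚ.toℚᵘ (ℤ→ℚ j)    ≈⟨ ℚᵘ.≃-sym (ℚ.toℚᵘ-homo-* (ℤ→ℚ i) (ℤ→ℚ j)) ⟩
    ℚ.toℚᵘ (ℤ→ℚ i ℚ.* ℤ→ℚ j)               ∎)
    where open SetoidReasoning ℚᵘ.≃-setoid

  ℤ→ℚ-neg : ∀ i → ℤ→ℚ (ℤ.- i) ≡ ℚ.- ℤ→ℚ i
  ℤ→ℚ-neg i = ℚ.toℚᵘ-injective (begin
    ℚ.toℚᵘ (ℤ→ℚ (ℤ.- i))    ≈⟨ to (ℤ.- i) ⟩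
    ℚᵘ.- mkℚᵘ i 0            ≈⟨ ℚᵘ.≃-sym (ℚᵘ.-‿cong (to i)) ⟩
    ℚᵘ.- ℚ.toℚᵘ (ℤ→ℚ i)     ≈⟨ ℚᵘ.≃-sym (ℚ.toℚᵘ-homo‿- (ℤ→ℚ i)) ⟩
    ℚ.toℚᵘ (ℚ.- ℤ→ℚ i)      ∎)
    where open SetoidReasoning ℚᵘ.≃-setoid

  ℤ→ℚ-injective : ∀ {i j} → ℤ→ℚ i ≡ ℤ→ℚ j → i ≡ j
  ℤ→ℚ-injective {i} {j} eq with *≡* i*1≡j*1 ← ℚ.fromℚᵘ-injective {mkℚᵘ i 0} {mkℚᵘ j 0} eq =
    trans (sym (ℤ.*-identityʳ i)) (trans i*1≡j*1 (ℤ.*-identityʳ j))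

ℤ→ℚ-morphism : IntegerMorphism ℚ-ring
ℤ→ℚ-morphism = record
  { ⟦_⟧ = ℤ→ℚ ; +-homo = ℤ→ℚ-+ ; *-homo = ℤ→ℚ-* ; -‿homo = ℤ→ℚ-neg ; 0-homo = ℤ→ℚ-0 ; 1-homo = ℤ→ℚ-1 }

inverseOrZero : ℚ → ℚ
inverseOrZero q with q ℚ.≟ 0ℚ
-- A default value at 0; the inverse law below is stated for nonzero q.
... | yes _  = 0ℚ
... | no q≢0 = (ℚ.1/ q) {{ℚ.≢-nonZero q≢0}}

inverseOrZero-inverse : ∀ {q} → q ≢ 0ℚ → q ℚ.* inverseOrZero q ≡ 1ℚ
inverseOrZero-inverse {q} q≢0 with q ℚ.≟ 0ℚ
... | yes q≡0 = contradiction q≡0 q≢0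
... | no q≢0′ = ℚ.*-inverseʳ q {{ℚ.≢-nonZero q≢0′}}

abstract
  det₈⁻¹ : Word → ℚ
  det₈⁻¹ Z = inverseOrZero (ℤ→ℚ (det₈ Z))

  det₈⁻¹-inverse : ∀ Z → det₈ Z ≢ 0ℤ → ℤ→ℚ (det₈ Z) ℚ.* det₈⁻¹ Z ≡ 1ℚ
  det₈⁻¹-inverse Z d≢0 = inverseOrZero-inverse {ℤ→ℚ (det₈ Z)} (λ eq → d≢0 (ℤ→ℚ-injective {det₈ Z} {0ℤ} (trans eq (sym ℤ→ℚ-0))))

rationals : Target ℚ-ring
rationals = record
  { ι-morphism  = ℤ→ℚ-morphism
  ; ι-kernel    = λ i → ℤ→ℚ-injective {i} {0ℤ}
  ; d⁻¹         = det₈⁻¹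
  ; d⁻¹-inverse = det₈⁻¹-inverse
  ; ½ₛ          = ½
  ; 2*½≈1       = refl
  }

theorem4p18 : (B : Vec (Fin 8) 4) (b : Matroid.IsBasis P₈ (entries B)) →
    universalPartialField P₈ B b ≅ 𝔻
theorem4p18 = Comparison.Isomorphism.isomorphism rationals
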